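{- Let $q\ge5$ be a prime power. (i) Let $R$ be a real chord of $\mathcal C$ meeting $\mathcal C$ in $P_1,P_2$, and let $\Gamma_1,\Gamma_2$ be the $\Gamma$-planes at $P_1,P_2$. Every $2_{\mathcal C}$-plane through $R$ meets one of $\Gamma_1,\Gamma_2$ in its tangent and the other in a non-tangent unisecant. Moreover $\Lambda_{\mathrm{T},2_{\mathcal C}}=\Lambda_{\mathrm{U}\Gamma,2_{\mathcal C}}=1$, $\Pi_{2_{\mathcal C},\mathrm{U}\Gamma}=\Lambda_{\mathrm{U}\Gamma,\overline{1_{\mathcal C}}}=1$, $\Pi_{\overline{1_{\mathcal C}},\mathrm{U}\Gamma}=\Pi_{3_{\mathcal C},\mathrm{U}\Gamma}=(q-1)/2$, $\Lambda_{\mathrm{U}\Gamma,3_{\mathcal C}}=3$, $\Lambda_{\mathrm{Un}\Gamma,2_{\mathcal C}}=2(q-1)$, $\Pi_{2_{\mathcal C},\mathrm{Un}\Gamma}=2$, and, if $q\not\equiv 0\pmod 3$, $\Pi_{2_{\mathcal C},\mathrm{E}\Gamma}=1$ and $\Lambda_{\mathrm{E}\Gamma,2_{\mathcal C}}=q-1$. (ii) Through every tangent there are exactly $q$ planes of type $2_{\mathcal C}$, and no tangent lies in a $3_{\mathcal C}$-plane, a $\overline{1_{\mathcal C}}$-plane or a $0_{\mathcal C}$-plane; i.e. $\Pi_{2_{\mathcal C},\mathrm{T}}=q$ and $\Lambda_{\mathrm{T},\pi}=\Pi_{\pi,\mathrm{T}}=0$ for $\pi\in\{3_{\mathcal C},\overline{1_{\mathcal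 C}},0_{\mathcal C}\}$.
   Context: Let $\mathrm{PG}(3,q)$ have points $\mathbf{P}(x_0,x_1,x_2,x_3)$; put $P(t)=\mathbf{P}(t^3,t^2,t,1)$ ($t\in\mathbb{F}_q$), $P(\infty)=\mathbf{P}(1,0,0,0)$, and let $\mathcal{C}=\{P(t):t\in\mathbb{F}_q\cup\{\infty\}\}$ be the twisted cubic, $G_q$ the group of projectivities fixing $\mathcal C$. Write $\boldsymbol{\pi}(c_0,c_1,c_2,c_3)$ for the plane $c_0x_0+c_1x_1+c_2x_2+c_3x_3=0$. The osculating plane at $P(t)$ is $\boldsymbol{\pi}(1,-3t,3t^2,-t^3)$ ($t\in\mathbb{F}_q$), $\boldsymbol{\pi}(0,0,0,1)$ ($t=\infty$); these are the $\Gamma$-planes. A $d_{\mathcal C}$-plane ($d\in\{0,2,3\}$) contains exactly $d$ points of $\mathcal C$; a $\overline{1_{\mathcal C}}$-plane is a non-$\Gamma$-plane containing exactly one point of $\mathcal C$. For $q\ge5$ these five plane types are exactly the $G_q$-orbits on planes. Lines: a real chord joins two distinct points of $\mathcal C$; the tangent (T-line) at $P(t)$ is the line through $P(t)$ and $\mathbf{P}(3t^2,2t,1,0)$ ($t\in\mathbb{F}_q$), resp. through $P(\infty)$ and $\mathbf{P}(0,1,0,0)$. A unisecant meets $\mathcal C$ in exactly one point; an external line meets it in none. U$\Gamma$-line: non-tangent unisecant lying in a $\Gamma$-plane; Un$\Gamma$-line: unisecant lying in no $\Gamma$-plane; for $q\not\equiv0\pmod 3$, a real axis is the intersection of two distinct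 $\Gamma$-planes and an E$\Gamma$-line is an external line lying in a $\Gamma$-plane that is not a real axis. Notation: for a line type $\lambda$ and plane type $\pi$, $\Lambda_{\lambda,\pi}$ is the number of $\lambda$-lines in a $\pi$-plane (independent of the chosen $\pi$-plane for $q\ge5$), and $\Pi_{\pi,\lambda}$ is the average, over all $\lambda$-lines, of the number of $\pi$-planes containing the line. -}

module Defs where

open import Data.Bool using (Bool; true; false; _∧_; _∨_; not; T)
open import Data.List using (List; []; _∷_; map; concatMap; length; filterᵇ; deduplicateᵇ)
open import Data.Bool.ListAction using (any)
open import Data.Nat.ListAction using (sum)
open import Data.Maybe using (Maybe; just; nothing)
open import Data.Nat using (ℕ; _≡ᵇ_)
open import Data.Product using (_×_; _,_; proj₁; proj₂; Σ)
open import Algebra.Structures using (IsCommutativeRing)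
open import Relation.Binary.PropositionalEquality using (_≡_; _≢_)
open import Relation.Binary.Definitions using (DecidableEquality)
open import Relation.Nullary using (does)
open import Data.List.Membership.Propositional using (_∈_)
open import Data.List.Relation.Unary.Unique.Propositional using (Unique)

-- A finite field F_q: a commutative ring (w.r.t. propositional equality)
-- with 0 ≠ 1 and multiplicative inverses of nonzero elements, decidable
-- equality, and a duplicate-free complete list of its elements.
-- Its order q is the length of that list (automatically a prime power).

record FiniteField : Set₁ where
  infixl 6 _+_
  infixl 7 _*_
  field
    Carrier           : Set
    _+_ _*_           : Carrier → Carrier → Carrier
    -_                : Carrier → Carrier
    0# 1#             : Carrier
    isCommutativeRing : IsCommutativeRing _≡_ _+_ _*_ -_ 0# 1#
    0≢1               : 0# ≢ 1#
    _⁻¹               : Carrier → Carrier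
    ⁻¹-inverse        : ∀ x → x ≢ 0# → x * (x ⁻¹) ≡ 1#
    _≟_               : DecidableEquality Carrier
    elements          : List Carrier
    complete          : ∀ x → x ∈ elements
    unique            : Unique elements

module Geometry (𝔽 : FiniteField) where
  open FiniteField 𝔽

  q : ℕ
  q = length elements

  _==_ : Carrier → Carrier → Bool
  x == y = does (x ≟ y)

  -- vectors of F_q^4 (homogeneous coordinates of points / coefficients of planes)
  record V4 : Set where
    constructor ⟨_,_,_,_⟩
    field
      c0 c1 c2 c3 : Carrier
  open V4

  allV4 : List V4
  allV4 = concatMap (λ a → concatMap (λ b → concatMap (λ c →
            map (λ d → ⟨ a , b , c , d ⟩) elements) elements) elements) elements

  eqV : V4 → V4 → Bool
  eqV u v = (c0 u == c0 v) ∧ (c1 u == c1 v) ∧ (c2 u == c2 v) ∧ (c3 u == c3 v)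

  zeroV : V4
  zeroV = ⟨ 0# , 0# , 0# , 0# ⟩

  nonzero : V4 → Bool
  nonzero v = not (eqV v zeroV)

  scale : Carrier → V4 → V4
  scale a v = ⟨ a * c0 v , a * c1 v , a * c2 v , a * c3 v ⟩

  addV : V4 → V4 → V4
  addV u v = ⟨ c0 u + c0 v , c1 u + c1 v , c2 u + c2 v , c3 u + c3 v ⟩

  proportional : V4 → V4 → Bool
  proportional u v = any (λ a → not (a == 0#) ∧ eqV u (scale a v)) elements

  onPlane : V4 → V4 → Bool
  onPlane π x = (c0 π * c0 x + c1 π * c1 x + c2 π * c2 x + c3 π * c3 x) == 0#

  allPlanes : List V4
  allPlanes = deduplicateᵇ proportional (filterᵇ nonzero allV4)

  -- the twisted cubic; parameters t ∈ F_q ∪ {∞}, with ∞ = nothing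

  Param : Set
  Param = Maybe Carrier

  params : List Param
  params = nothing ∷ map just elements

  eqParam : Param → Param → Bool
  eqParam nothing  nothing  = true
  eqParam (just s) (just t) = s == t
  eqParam _        _        = false

  2# 3# : Carrier
  2# = 1# + 1#
  3# = 1# + 1# + 1#

  cubicPt : Param → V4
  cubicPt nothing  = ⟨ 1# , 0# , 0# , 0# ⟩
  cubicPt (just t) = ⟨ t * t * t , t * t , t , 1# ⟩

  oscPlane : Param → V4
  oscPlane nothing  = ⟨ 0# , 0# , 0# , 1# ⟩
  oscPlane (just t) = ⟨ 1# , - (3# * t) , 3# * t * t , - (t * t * t) ⟩

  nCPlane : V4 → ℕ
  nCPlane π = length (filterᵇ (λ t → onPlane π (cubicPt t)) params)

  isΓPlane : V4 → Bool
  isΓPlane π = any (λ t → proportional π (oscPlane t)) params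

  is0C is2C is3C is1barC : V4 → Bool
  is0C π    = nCPlane π ≡ᵇ 0
  is2C π    = nCPlane π ≡ᵇ 2
  is3C π    = nCPlane π ≡ᵇ 3
  is1barC π = not (isΓPlane π) ∧ (nCPlane π ≡ᵇ 1)

  -- lines, given by a pair of spanning vectors

  Line : Set
  Line = V4 × V4

  allPairs : List Line
  allPairs = concatMap (λ u → map (λ v → (u , v)) allV4) allV4

  isLine : Line → Bool
  isLine (u , v) = nonzero u ∧ not (any (λ a → eqV v (scale a u)) elements)

  onLine : Line → V4 → Bool
  onLine (u , v) w =
    any (λ a → any (λ b → eqV w (addV (scale a u) (scale b v))) elements) elements

  sameLine : Line → Line → Bool
  sameLine L M = onLine M (proj₁ L) ∧ onLine M (proj₂ L)
               ∧ onLine L (proj₁ M) ∧ onLine L (proj₂ M)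

  allLines : List Line
  allLines = deduplicateᵇ sameLine (filterᵇ isLine allPairs)

  lineInPlane : Line → V4 → Bool
  lineInPlane (u , v) π = onPlane π u ∧ onPlane π v

  nCLine : Line → ℕ
  nCLine L = length (filterᵇ (λ t → onLine L (cubicPt t)) params)

  tangentDir : Param → V4
  tangentDir nothing  = ⟨ 0# , 1# , 0# , 0# ⟩
  tangentDir (just t) = ⟨ 3# * t * t , 2# * t , 1# , 0# ⟩

  tangentLine : Param → Line
  tangentLine t = (cubicPt t , tangentDir t)

  isTangent : Line → Bool
  isTangent L = any (λ t → sameLine L (tangentLine t)) params

  isUnisecant isExternal : Line → Bool
  isUnisecant L = nCLine L ≡ᵇ 1
  isExternal  L = nCLine L ≡ᵇ 0

  inSomeΓ : Line → Bool
  inSomeΓ L = any (λ t → lineInPlane L (oscPlane t)) params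

  isUΓ isUnΓ : Line → Bool
  isUΓ  L = isUnisecant L ∧ not (isTangent L) ∧ inSomeΓ L
  isUnΓ L = isUnisecant L ∧ not (inSomeΓ L)

  isRealAxis : Line → Bool
  isRealAxis L = any (λ s → any (λ t →
      not (proportional (oscPlane s) (oscPlane t))
      ∧ lineInPlane L (oscPlane s) ∧ lineInPlane L (oscPlane t)) params) params

  isEΓ : Line → Bool
  isEΓ L = isExternal L ∧ inSomeΓ L ∧ not (isRealAxis L)

  Λ : (Line → Bool) → V4 → ℕ
  Λ λt π = length (filterᵇ (λ L → λt L ∧ lineInPlane L π) allLines)

  planesThrough : (V4 → Bool) → Line → ℕ
  planesThrough πt L = length (filterᵇ (λ π → πt π ∧ lineInPlane L π) allPlanes)

  nLines : (Line → Bool) → ℕ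
  nLines λt = length (filterᵇ λt allLines)

  -- sum over all λ-lines of the number of π-planes through the line;
  -- Π_{π,λ} is this sum divided by nLines λ
  ΠSum : (V4 → Bool) → (Line → Bool) → ℕ
  ΠSum πt λt = sum (map (planesThrough πt) (filterᵇ λt allLines))

  meetsIn : V4 → V4 → (Line → Bool) → Set
  meetsIn π σ P = Σ Line (λ L → T (isLine L ∧ lineInPlane L π ∧ lineInPlane L σ ∧ P L))

-- A projectivity fixing the cubic moves any of its points P(p) to P(∞). There a plane becomes a
-- polynomial A κ³ + B κ² + C κ + D whose roots are its other points on the cubic; it contains P(p) iff
-- A = 0, and the tangent at P(p) iff also B = 0. So a 2_C-plane is (κ − d)²(κ − s) for exactly one
-- ordered pair of points, and the lines of each type in it can be listed. Every average Π then follows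
-- by counting incidences twice: there are q planes of type 2_C through each of the q + 1 tangents, a
-- 3_C-plane has six ordered pairs of points, and the non-Γ 1_C-planes are what remains of the q non-Γ-planes
-- through a UΓ-line.

module Submission where

open import Defs
open import Algebra.Bundles using (CommutativeRing)
import Algebra.Solver.Ring
open import Algebra.Solver.Ring.AlmostCommutativeRing using (fromCommutativeRing; _-Raw-AlmostCommutative⟶_)
open import Data.Bool using (Bool; true; false; not; _∧_; T)
open import Data.Bool.ListAction using (any)
open import Data.Bool.Properties using (T-∧; T?; ∧-assoc; ∧-zeroʳ)
open import Data.Fin using (Fin; zero; suc)
import Data.Fin.Properties as Fin
open import Data.Integer as ℤ using (ℤ; -[1+_])
import Data.Integer.Properties as ℤ
open import Data.List using (List; []; _∷_; map; length; lookup; filterᵇ; deduplicateᵇ; cartesianProduct)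
open import Data.List.Membership.Propositional using (_∈_; find; lose)
open import Data.List.Membership.Propositional.Properties
  using (∈-map⁺; ∈-map⁻; ∈-filter⁺; ∈-filter⁻; ∈-lookup; ∈-concatMap⁺; ∈-cartesianProduct⁺; ∈-cartesianProduct⁻)
open import Data.List.Properties using (length-++; length-map)
open import Data.List.Relation.Unary.All as All using (All; []; _∷_)
open import Data.List.Relation.Unary.AllPairs as AllPairs using (AllPairs; []; _∷_)
import Data.List.Relation.Unary.AllPairs.Properties as AllPairs
open import Data.List.Relation.Unary.Any as Any using (here; there; index)
open import Data.List.Relation.Unary.Any.Properties using (any⁺; any⁻; lookup-index)
open import Data.List.Relation.Unary.Unique.Propositional using (Unique)
import Data.List.Relation.Unary.Unique.Propositional.Properties as Unique
open import Data.Maybe using (Maybe; just; nothing)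
open import Data.Maybe.Properties using (just-injective; ≡-dec)
open import Data.Nat as ℕ using (ℕ; zero; suc; _≤_)
open import Data.Nat.Divisibility using (_∣_; divides)
open import Data.Nat.ListAction using (sum)
import Data.Nat.Properties as ℕ
open import Data.Nat.Solver using (module +-*-Solver)
open import Data.Product using (_×_; _,_; proj₁; proj₂; ∃; ∃₂)
open import Data.Sum using (_⊎_; inj₁; inj₂; swap)
open import Data.Unit using (⊤; tt)
open import Function using (_∘_; id; Equivalence)
open import Level using (0ℓ)
open import Relation.Binary.Core using (Rel)
open import Relation.Binary.Definitions using (DecidableEquality; Symmetric)
open import Relation.Binary.PropositionalEquality
open import Relation.Binary.Structures using (IsEquivalence)
open import Relation.Nullary using (¬_; ¬?; Dec; yes; no; does; contradiction; _×-dec_)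
open import Relation.Nullary.Decidable using (decidable-stable)

-- The obstacle is the characteristic: 2 or 3 may vanish, so multiplicities cannot be read from
-- iterated derivatives. In a frame, the multiplicity at P(p) is the number of vanishing leading
-- coefficients, and a quadratic is factored from a known root, never by its discriminant. Only the
-- EΓ-lines need 3 to be invertible: a line x₀ = a x₁ + b x₂ of Γ_p lies in a second Γ-plane exactly
-- when a = 3k and b = -3k² for some k, and with 3 ≠ 0 this is the single equation a² + 3b = 0. Each
-- Λ is computed for an arbitrary plane of its type, so its constancy is proved and not drawn from
-- the orbits of G_q. Lines and planes are listed up to an equivalence, and a count compares such a
-- list with a parametrisation that hits every class once: (p, y) for UΓ-lines, (p, z, w) with w ≠ 0
-- for UnΓ- and EΓ-lines. This is the origin of q(q + 1) and (q + 1)q(q - 1). Averages are kept as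
-- products, so nothing is ever divided.

-- Ring identities over the field, with integer coefficients.

module FieldLemmas (𝔽 : FiniteField) where
  open FiniteField 𝔽

  commutativeRing : CommutativeRing _ _
  commutativeRing = record { isCommutativeRing = isCommutativeRing }

  open CommutativeRing commutativeRing public
    using (+-assoc; +-comm; +-identityˡ; +-identityʳ; *-assoc; *-comm; *-identityˡ; *-identityʳ
          ; zeroˡ; zeroʳ; -‿inverseˡ; -‿inverseʳ)
  open CommutativeRing commutativeRing using (semiring; ring)
  open import Algebra.Properties.Ring ring
    using (-‿distribˡ-*; -‿distribʳ-*; -0#≈0#; -‿involutive; -‿+-comm)
  open import Algebra.Properties.Semiring.Mult.TCOptimised semiring
    using (1+×; ×-homo-+; ×1-homo-*) renaming (_×_ to _×ᴿ_)

  module IntegerCoefficients where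
    open ≡-Reasoning

    fromℤ : ℤ → Carrier
    fromℤ (ℤ.+ n)    = n ×ᴿ 1#
    fromℤ -[1+ n ] = - (suc n ×ᴿ 1#)

    fromℤ-neg : ∀ i → fromℤ (ℤ.- i) ≡ - fromℤ i
    fromℤ-neg (ℤ.+ zero)  = sym -0#≈0#
    fromℤ-neg (ℤ.+ suc n) = refl
    fromℤ-neg -[1+ n ]  = sym (-‿involutive _)

    -- The recursion of `⊖` removes one unit from each side; this is the same move in the field.
    cancel-one : ∀ x y → x + - y ≡ (1# + x) + - (1# + y)
    cancel-one x y = sym (begin
      (1# + x) + - (1# + y) ≡⟨ cong₂ _+_ (+-comm 1# x) (sym (-‿+-comm 1# y)) ⟩
      (x + 1#) + (- 1# + - y) ≡⟨ +-assoc x 1# _ ⟩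
      x + (1# + (- 1# + - y)) ≡⟨ cong (x +_) (sym (+-assoc 1# (- 1#) (- y))) ⟩
      x + ((1# + - 1#) + - y) ≡⟨ cong (λ z → x + (z + - y)) (-‿inverseʳ 1#) ⟩
      x + (0# + - y) ≡⟨ cong (x +_) (+-identityˡ (- y)) ⟩
      x + - y ∎)

    fromℤ-⊖ : ∀ m n → fromℤ (m ℤ.⊖ n) ≡ m ×ᴿ 1# + - (n ×ᴿ 1#)
    fromℤ-⊖ m zero = begin
      m ×ᴿ 1# ≡⟨ sym (+-identityʳ _) ⟩
      m ×ᴿ 1# + 0# ≡⟨ cong (m ×ᴿ 1# +_) (sym -0#≈0#) ⟩
      m ×ᴿ 1# + - 0# ∎
    fromℤ-⊖ zero (suc n) = sym (+-identityˡ _)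
    fromℤ-⊖ (suc m) (suc n) = begin
      fromℤ (suc m ℤ.⊖ suc n) ≡⟨ cong fromℤ (ℤ.[1+m]⊖[1+n]≡m⊖n m n) ⟩
      fromℤ (m ℤ.⊖ n) ≡⟨ fromℤ-⊖ m n ⟩
      m ×ᴿ 1# + - (n ×ᴿ 1#) ≡⟨ cancel-one _ _ ⟩
      (1# + m ×ᴿ 1#) + - (1# + n ×ᴿ 1#) ≡⟨ cong₂ (λ a b → a + - b) (sym (1+× m 1#)) (sym (1+× n 1#)) ⟩
      suc m ×ᴿ 1# + - (suc n ×ᴿ 1#) ∎

    fromℤ-+ : ∀ i j → fromℤ (i ℤ.+ j) ≡ fromℤ i + fromℤ j
    fromℤ-+ (ℤ.+ m)    (ℤ.+ n)    = ×-homo-+ 1# m n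
    fromℤ-+ (ℤ.+ m)    -[1+ n ] = fromℤ-⊖ m (suc n)
    fromℤ-+ -[1+ m ] (ℤ.+ n)    = trans (fromℤ-⊖ n (suc m)) (+-comm _ _)
    fromℤ-+ -[1+ m ] -[1+ n ] = begin
      - (suc (suc (m ℕ.+ n)) ×ᴿ 1#) ≡⟨ cong (λ k → - (suc k ×ᴿ 1#)) (sym (ℕ.+-suc m n)) ⟩
      - ((suc m ℕ.+ suc n) ×ᴿ 1#) ≡⟨ cong -_ (×-homo-+ 1# (suc m) (suc n)) ⟩
      - (suc m ×ᴿ 1# + suc n ×ᴿ 1#) ≡⟨ sym (-‿+-comm _ _) ⟩
      - (suc m ×ᴿ 1#) + - (suc n ×ᴿ 1#) ∎

    -- Only the sign of the second factor is split here; `fromℤ-*` then pulls a negative sign out of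
    -- the first.
    fromℤ-pos* : ∀ m j → fromℤ (ℤ.+ m ℤ.* j) ≡ m ×ᴿ 1# * fromℤ j
    fromℤ-pos* m (ℤ.+ n) = trans (cong fromℤ (sym (ℤ.pos-* m n))) (×1-homo-* m n)
    fromℤ-pos* m -[1+ n ] = begin
      fromℤ (ℤ.+ m ℤ.* -[1+ n ]) ≡⟨ cong fromℤ (sym (ℤ.neg-distribʳ-* (ℤ.+ m) (ℤ.+ suc n))) ⟩
      fromℤ (ℤ.- (ℤ.+ m ℤ.* ℤ.+ suc n)) ≡⟨ fromℤ-neg (ℤ.+ m ℤ.* ℤ.+ suc n) ⟩
      - fromℤ (ℤ.+ m ℤ.* ℤ.+ suc n) ≡⟨ cong -_ (fromℤ-pos* m (ℤ.+ suc n)) ⟩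
      - (m ×ᴿ 1# * suc n ×ᴿ 1#) ≡⟨ -‿distribʳ-* _ _ ⟩
      m ×ᴿ 1# * - (suc n ×ᴿ 1#) ∎

    fromℤ-* : ∀ i j → fromℤ (i ℤ.* j) ≡ fromℤ i * fromℤ j
    fromℤ-* (ℤ.+ m)  j = fromℤ-pos* m j
    fromℤ-* -[1+ m ] j = begin
      fromℤ (-[1+ m ] ℤ.* j) ≡⟨ cong fromℤ (sym (ℤ.neg-distribˡ-* (ℤ.+ suc m) j)) ⟩
      fromℤ (ℤ.- (ℤ.+ suc m ℤ.* j)) ≡⟨ fromℤ-neg (ℤ.+ suc m ℤ.* j) ⟩
      - fromℤ (ℤ.+ suc m ℤ.* j) ≡⟨ cong -_ (fromℤ-pos* (suc m) j) ⟩
      - (suc m ×ᴿ 1# * fromℤ j) ≡⟨ -‿distribˡ-* _ _ ⟩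
      - (suc m ×ᴿ 1#) * fromℤ j ∎

    morphism : ℤ.+-*-rawRing -Raw-AlmostCommutative⟶ fromCommutativeRing commutativeRing
    morphism = record
      { ⟦_⟧ = fromℤ ; +-homo = fromℤ-+ ; *-homo = fromℤ-* ; -‿homo = fromℤ-neg
      ; 0-homo = refl ; 1-homo = refl }

    coefficient≟ : ∀ i j → Maybe (fromℤ i ≡ fromℤ j)
    coefficient≟ i j with i ℤ.≟ j
    ... | yes i≡j = just (cong fromℤ i≡j)
    ... | no  _   = nothing

  -- Integer coefficients have decidable equality that computes, unlike those of an abstract field.
  module Solver = Algebra.Solver.Ring ℤ.+-*-rawRing (fromCommutativeRing commutativeRing)
    IntegerCoefficients.morphism IntegerCoefficients.coefficient≟

-- Boolean tests and the propositions they decide.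

module Booleans where

  does⁻ : {A : Set} (a? : Dec A) → T (does a?) → A
  does⁻ (yes a) _ = a

  does⁺ : {A : Set} (a? : Dec A) → A → T (does a?)
  does⁺ (yes _) _ = tt
  does⁺ (no ¬a) a = contradiction a ¬a

  ∧⁻ : ∀ {x y} → T (x ∧ y) → T x × T y
  ∧⁻ = Equivalence.to T-∧

  ∧⁺ : ∀ {x y} → T x → T y → T (x ∧ y)
  ∧⁺ tx ty = Equivalence.from T-∧ (tx , ty)

  not⁻ : ∀ {x} → T (not x) → ¬ T x
  not⁻ {false} _ ()

  not⁺ : ∀ {x} → ¬ T x → T (not x)
  not⁺ {true}  ¬t = contradiction tt ¬t
  not⁺ {false} _  = tt

  any-elim : {A : Set} (p : A → Bool) (xs : List A) → T (any p xs) → ∃ (T ∘ p)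
  any-elim p xs t = Any.satisfied (any⁻ p xs t)

  any-intro : {A : Set} (p : A → Bool) {xs : List A} {x : A} → x ∈ xs → T (p x) → T (any p xs)
  any-intro p x∈xs px = any⁺ p (lose x∈xs px)

-- Counting by systems of representatives, and double counting.

module Counting where
  open Booleans

  private variable
    X Y : Set

  count : (X → Bool) → List X → ℕ
  count p xs = length (filterᵇ p xs)

  indicator : Bool → ℕ
  indicator false = 0
  indicator true  = 1

  count-∷ : ∀ (p : X → Bool) x xs → count p (x ∷ xs) ≡ indicator (p x) ℕ.+ count p xs
  count-∷ p x xs with p x
  ... | true  = refl
  ... | false = refl

  ∈-filterᵇ⁺ : ∀ (p : X → Bool) {x xs} → x ∈ xs → T (p x) → x ∈ filterᵇ p xs
  ∈-filterᵇ⁺ p = ∈-filter⁺ (T? ∘ p)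

  ∈-filterᵇ⁻ : ∀ (p : X → Bool) {x xs} → x ∈ filterᵇ p xs → x ∈ xs × T (p x)
  ∈-filterᵇ⁻ p = ∈-filter⁻ (T? ∘ p)

  -- The identity of indicators says in one equation that the three tests exclude each other and
  -- together amount to `f`.
  count-split : ∀ (f g h k : X → Bool) xs →
    (∀ {x} → x ∈ xs → indicator (f x) ≡ indicator (g x) ℕ.+ indicator (h x) ℕ.+ indicator (k x)) →
    count f xs ≡ count g xs ℕ.+ count h xs ℕ.+ count k xs
  count-split f g h k [] split = refl
  count-split f g h k (x ∷ xs) split = begin
    count f (x ∷ xs)
      ≡⟨ count-∷ f x xs ⟩
    indicator (f x) ℕ.+ count f xs
      ≡⟨ cong₂ ℕ._+_ (split (here refl)) (count-split f g h k xs (split ∘ there)) ⟩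
    (indicator (g x) ℕ.+ indicator (h x) ℕ.+ indicator (k x)) ℕ.+ (count g xs ℕ.+ count h xs ℕ.+ count k xs)
      ≡⟨ solve 6 (λ a b c d e f → (a :+ b :+ c) :+ (d :+ e :+ f) := (a :+ d) :+ (b :+ e) :+ (c :+ f)) refl
           (indicator (g x)) _ _ _ _ _ ⟩
    (indicator (g x) ℕ.+ count g xs) ℕ.+ (indicator (h x) ℕ.+ count h xs) ℕ.+ (indicator (k x) ℕ.+ count k xs)
      ≡⟨ sym (cong₂ ℕ._+_ (cong₂ ℕ._+_ (count-∷ g x xs) (count-∷ h x xs)) (count-∷ k x xs)) ⟩
    count g (x ∷ xs) ℕ.+ count h (x ∷ xs) ℕ.+ count k (x ∷ xs) ∎
    where
    open ≡-Reasoning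
    open +-*-Solver

  count-∧ : ∀ (p r : X → Bool) xs → count (λ x → p x ∧ r x) xs ≡ count r (filterᵇ p xs)
  count-∧ p r [] = refl
  count-∧ p r (x ∷ xs) with p x
  ... | false = count-∧ p r xs
  ... | true  with r x
  ...   | false = count-∧ p r xs
  ...   | true  = cong suc (count-∧ p r xs)

  sum-cong : ∀ (F G : X → ℕ) xs → (∀ {x} → x ∈ xs → F x ≡ G x) → sum (map F xs) ≡ sum (map G xs)
  sum-cong F G [] F≡G = refl
  sum-cong F G (x ∷ xs) F≡G = cong₂ ℕ._+_ (F≡G (here refl)) (sum-cong F G xs (F≡G ∘ there))

  count-cong : ∀ (p r : X → Bool) xs → (∀ x → p x ≡ r x) → count p xs ≡ count r xs
  count-cong p r [] p≡r = refl
  count-cong p r (x ∷ xs) p≡r = trans (count-∷ p x xs)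
    (trans (cong₂ ℕ._+_ (cong indicator (p≡r x)) (count-cong p r xs p≡r)) (sym (count-∷ r x xs)))

  sum-const : ∀ (F : X → ℕ) k xs → (∀ {x} → x ∈ xs → F x ≡ k) → sum (map F xs) ≡ k ℕ.* length xs
  sum-const F k [] F≡k = sym (ℕ.*-zeroʳ k)
  sum-const F k (x ∷ xs) F≡k =
    trans (cong₂ ℕ._+_ (F≡k (here refl)) (sum-const F k xs (F≡k ∘ there))) (sym (ℕ.*-suc k (length xs)))

  sum-+ : ∀ (F G : X → ℕ) xs → sum (map (λ x → F x ℕ.+ G x) xs) ≡ sum (map F xs) ℕ.+ sum (map G xs)
  sum-+ F G [] = refl
  sum-+ F G (x ∷ xs) = trans (cong (F x ℕ.+ G x ℕ.+_) (sum-+ F G xs))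
    (solve 4 (λ a b c d → a :+ b :+ (c :+ d) := a :+ c :+ (b :+ d)) refl (F x) (G x) _ _)
    where open +-*-Solver

  sum-* : ∀ k (F : X → ℕ) xs → sum (map (λ x → k ℕ.* F x) xs) ≡ k ℕ.* sum (map F xs)
  sum-* k F [] = sym (ℕ.*-zeroʳ k)
  sum-* k F (x ∷ xs) = trans (cong (k ℕ.* F x ℕ.+_) (sum-* k F xs)) (sym (ℕ.*-distribˡ-+ k (F x) _))

  sum-indicator : ∀ (p : X → Bool) xs → sum (map (indicator ∘ p) xs) ≡ count p xs
  sum-indicator p [] = refl
  sum-indicator p (x ∷ xs) = trans (cong (indicator (p x) ℕ.+_) (sum-indicator p xs)) (sym (count-∷ p x xs))

  -- The 0/1 incidence matrix is summed by rows and by columns; the induction adds one row.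
  double-count : ∀ (R : X → Y → Bool) xs ys →
    sum (map (λ x → count (R x) ys) xs) ≡ sum (map (λ y → count (λ x → R x y) xs) ys)
  double-count R [] ys = sym (sum-const (λ _ → 0) 0 ys (λ _ → refl))
  double-count R (x ∷ xs) ys = begin
    count (R x) ys ℕ.+ sum (map (λ x → count (R x) ys) xs)
      ≡⟨ cong₂ ℕ._+_ (sym (sum-indicator (R x) ys)) (double-count R xs ys) ⟩
    sum (map (indicator ∘ R x) ys) ℕ.+ sum (map (λ y → count (λ x → R x y) xs) ys)
      ≡⟨ sym (sum-+ (indicator ∘ R x) (λ y → count (λ x → R x y) xs) ys) ⟩
    sum (map (λ y → indicator (R x y) ℕ.+ count (λ x → R x y) xs) ys)
      ≡⟨ sum-cong _ _ ys (λ {y} _ → sym (count-∷ (λ x → R x y) x xs)) ⟩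
    sum (map (λ y → count (λ x → R x y) (x ∷ xs)) ys) ∎
    where open ≡-Reasoning

  -- A system of representatives for the classes of `P`. Lists of planes and lines hold one
  -- arbitrary vector or pair per class, so two lists for the same `P` agree in length without
  -- agreeing in any entry.
  record Transversal (_~_ : Rel Y 0ℓ) (P : Y → Set) (ys : List Y) : Set where
    field
      sound : ∀ {y} → y ∈ ys → P y
      apart : AllPairs (λ y z → ¬ (y ~ z)) ys
      cover : ∀ {y} → P y → ∃ λ z → z ∈ ys × y ~ z

  open Transversal

  apart-lookup : ∀ {_~_ : Rel Y 0ℓ} → Symmetric _~_ → ∀ {ys} → AllPairs (λ y z → ¬ (y ~ z)) ys →
    ∀ i j → lookup ys i ~ lookup ys j → i ≡ j
  apart-lookup sym~ (_ ∷ _)     zero    zero    _ = refl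
  apart-lookup sym~ (y≁ys ∷ _)  zero    (suc j) e = contradiction e (All.lookup y≁ys (∈-lookup j))
  apart-lookup sym~ (y≁ys ∷ _)  (suc i) zero    e = contradiction (sym~ e) (All.lookup y≁ys (∈-lookup i))
  apart-lookup sym~ (_ ∷ apart) (suc i) (suc j) e = cong suc (apart-lookup sym~ apart i j e)

  module _ {_~_ : Rel Y 0ℓ} (equiv : IsEquivalence _~_) where
    private module ~ = IsEquivalence equiv

    -- Pigeonhole: each index of `ys` goes to the index of a related entry of `zs`. Two indices with
    -- the same image have related entries, and entries of `ys` at different places are unrelated.
    transversal-≤ : ∀ {P ys zs} → Transversal _~_ P ys → Transversal _~_ P zs → length ys ≤ length zs
    transversal-≤ {P} {ys} {zs} 𝒴 𝒵 = Fin.injective⇒≤ {f = f} f-injective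
      where
      near : ∀ i → ∃ λ z → z ∈ zs × lookup ys i ~ z
      near i = cover 𝒵 (sound 𝒴 (∈-lookup i))
      f : Fin (length ys) → Fin (length zs)
      f i = index (proj₁ (proj₂ (near i)))
      near-f : ∀ i → lookup ys i ~ lookup zs (f i)
      near-f i = subst (lookup ys i ~_) (lookup-index (proj₁ (proj₂ (near i)))) (proj₂ (proj₂ (near i)))
      f-injective : ∀ {i j} → f i ≡ f j → i ≡ j
      f-injective {i} {j} fi≡fj = apart-lookup ~.sym (apart 𝒴) i j
        (~.trans (near-f i) (~.sym (subst (λ k → lookup ys j ~ lookup zs k) (sym fi≡fj) (near-f j))))

    transversal-length : ∀ {P ys zs} → Transversal _~_ P ys → Transversal _~_ P zs → length ys ≡ length zs
    transversal-length 𝒴 𝒵 = ℕ.≤-antisym (transversal-≤ 𝒴 𝒵) (transversal-≤ 𝒵 𝒴)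

    filter-transversal : ∀ {P ys} → Transversal _~_ P ys → (f : Y → Bool) →
      (∀ {y z} → P y → P z → y ~ z → T (f y) → T (f z)) →
      Transversal _~_ (λ y → P y × T (f y)) (filterᵇ f ys)
    filter-transversal 𝒴 f resp = record
      { sound = λ y∈ → let y∈ys , fy = ∈-filterᵇ⁻ f y∈ in sound 𝒴 y∈ys , fy
      ; apart = AllPairs.filter⁺ (T? ∘ f) (apart 𝒴)
      ; cover = λ (py , fy) → let z , z∈ys , y~z = cover 𝒴 py in
          z , ∈-filterᵇ⁺ f z∈ys (resp py (sound 𝒴 z∈ys) y~z fy) , y~z
      }

    map-transversal : ∀ {P : Y → Set} {xs : List X} → Unique xs → (g : X → Y) →
      (∀ {x} → x ∈ xs → P (g x)) →
      (∀ {x x′} → x ∈ xs → x′ ∈ xs → g x ~ g x′ → x ≡ x′) →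
      (∀ {y} → P y → ∃ λ x → x ∈ xs × y ~ g x) →
      Transversal _~_ P (map g xs)
    map-transversal {P = P} {xs = xs} unique g into injective onto = record
      { sound = λ y∈ → let x , x∈xs , y≡gx = ∈-map⁻ g y∈ in subst P (sym y≡gx) (into x∈xs)
      ; apart = AllPairs.map⁺ (go unique injective)
      ; cover = λ py → let x , x∈xs , y~gx = onto py in g x , ∈-map⁺ g x∈xs , y~gx
      }
      where
      go : ∀ {xs} → Unique xs → (∀ {x x′} → x ∈ xs → x′ ∈ xs → g x ~ g x′ → x ≡ x′) →
           AllPairs (λ x x′ → ¬ (g x ~ g x′)) xs
      go []               _         = []
      go (x∉xs ∷ unique)  injective =
        All.tabulate (λ x′∈xs e → All.lookup x∉xs x′∈xs (injective (here refl) (there x′∈xs) e))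
        ∷ go unique (λ x∈ x′∈ → injective (there x∈) (there x′∈))

    -- The common engine of all counts of lines and planes. The hypothesis that `f` accepts
    -- everything related to some `g x` serves twice: it puts `g x` itself in the counted set, and
    -- with surjectivity it makes `f` invariant under `~`.
    count-by : ∀ {P : Y → Set} {ys} → Transversal _~_ P ys → (f : Y → Bool) →
      {xs : List X} → Unique xs → (g : X → Y) →
      (∀ {x} → x ∈ xs → P (g x)) →
      (∀ {x y} → x ∈ xs → P y → y ~ g x → T (f y)) →
      (∀ {x x′} → x ∈ xs → x′ ∈ xs → g x ~ g x′ → x ≡ x′) →
      (∀ {y} → P y → T (f y) → ∃ λ x → x ∈ xs × y ~ g x) →
      count f ys ≡ length xs
    count-by 𝒴 f {xs} unique g into accepted injective onto =
      trans (transversal-length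
              (filter-transversal 𝒴 f (λ py pz y~z fy → let x , x∈xs , y~gx = onto py fy in
                accepted x∈xs pz (~.trans (~.sym y~z) y~gx)))
              (map-transversal unique g (λ x∈xs → into x∈xs , accepted x∈xs (into x∈xs) ~.refl)
                injective (λ (py , fy) → onto py fy)))
            (length-map g xs)

  deduplicate-transversal : ∀ (r : Y → Y → Bool) → IsEquivalence (λ y z → T (r y z)) →
    ∀ xs → Transversal (λ y z → T (r y z)) (_∈ xs) (deduplicateᵇ r xs)
  deduplicate-transversal r equiv [] = record { sound = id ; apart = [] ; cover = λ () }
  deduplicate-transversal {Y} r equiv (x ∷ xs) = record
    { sound = λ { (here y≡x) → here y≡x
                ; (there y∈) → there (sound rest (proj₁ (∈-filter⁻ _ y∈))) }
    ; apart = All.tabulate (λ y∈ → proj₂ (∈-filter⁻ (λ y → ¬? (T? (r x y))) {xs = deduplicateᵇ r xs} y∈))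
              ∷ AllPairs.filter⁺ _ (apart rest)
    ; cover = covered
    }
    where
    module ~ = IsEquivalence equiv
    rest = deduplicate-transversal r equiv xs
    covered : ∀ {y} → y ∈ x ∷ xs → ∃ λ z → z ∈ deduplicateᵇ r (x ∷ xs) × T (r y z)
    covered (here refl) = x , here refl , ~.refl
    covered (there y∈xs) with cover rest y∈xs
    -- The representative found in the tail survives the filtering unless it is related to the head,
    -- which then represents its class.
    ... | z , z∈ , y~z with T? (r x z)
    ...   | yes x~z = x , here refl , ~.trans y~z (~.sym x~z)
    ...   | no  x≁z = z , there (∈-filter⁺ _ z∈ x≁z) , y~z

  module _ {xs : List X} (complete : ∀ x → x ∈ xs) (unique : Unique xs) where

    complete-transversal : Transversal _≡_ (λ _ → ⊤) xs
    complete-transversal = record { sound = _ ; apart = unique ; cover = λ {x} _ → x , complete x , refl }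

    count-satisfying : (f : X → Bool) {ys : List X} → Unique ys →
      (∀ {y} → y ∈ ys → T (f y)) → (∀ {x} → T (f x) → x ∈ ys) → count f xs ≡ length ys
    count-satisfying f unique-ys accepted onto = count-by isEquivalence complete-transversal f unique-ys id
      _ (λ { y∈ _ refl → accepted y∈ }) (λ _ _ → id) (λ {x} _ fx → x , onto fx , refl)

    -- Putting `x` in front of the filtered list gives another duplicate-free enumeration of the
    -- whole type, so the two lengths agree.
    count-all-but-one : (x : X) (f : X → Bool) → ¬ T (f x) → (∀ {y} → ¬ T (f y) → y ≡ x) →
      count f xs ≡ length xs ℕ.∸ 1
    count-all-but-one x f ¬fx only-x = sym (cong (ℕ._∸ 1)
      (transversal-length isEquivalence complete-transversal (record
        { sound = _
        ; apart = All.tabulate (λ y∈ x≡y → ¬fx (subst (T ∘ f) (sym x≡y) (proj₂ (∈-filterᵇ⁻ f {xs = xs} y∈))))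
                  ∷ Unique.filter⁺ (T? ∘ f) unique
        ; cover = λ {y} _ → y , found y , refl })))
      where
      found : ∀ y → y ∈ x ∷ filterᵇ f xs
      found y with T? (f y)
      ... | yes fy = there (∈-filterᵇ⁺ f (complete y) fy)
      ... | no ¬fy = here (only-x ¬fy)

  length-product : ∀ (xs : List X) (ys : List Y) → length (cartesianProduct xs ys) ≡ length xs ℕ.* length ys
  length-product []       ys = refl
  length-product (x ∷ xs) ys = trans (length-++ (map (x ,_) ys))
    (cong₂ ℕ._+_ (length-map (x ,_) ys) (length-product xs ys))

  apart-∈ : ∀ {_~_ : Rel Y 0ℓ} → Symmetric _~_ → ∀ {ys} → AllPairs (λ y z → ¬ (y ~ z)) ys →
    ∀ {y z} → y ∈ ys → z ∈ ys → y ~ z → y ≡ z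
  apart-∈ {_~_ = _~_} sym~ {ys} apart {y} {z} y∈ z∈ y~z = trans (lookup-index y∈) (trans
    (cong (lookup ys) (apart-lookup (λ {u} {v} → sym~ {u} {v}) apart (index y∈) (index z∈) (subst₂ _~_ (lookup-index y∈) (lookup-index z∈) y~z)))
    (sym (lookup-index z∈)))

-- Inverses and cancellation in the field.

module FieldProperties (𝔽 : FiniteField) where
  open FiniteField 𝔽
  open FieldLemmas 𝔽 public
  open Solver using (Polynomial; solve; con; _:+_; _:*_; :-_; _:=_)
  open ≡-Reasoning

  -- Two and three are written as sums of ones, just as `2#` and `3#` are, so that their denotations
  -- agree with these by computation.
  :0 :1 :2 :3 : ∀ {n} → Polynomial n
  :0 = con (ℤ.+ 0)
  :1 = con (ℤ.+ 1)
  :2 = :1 :+ :1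
  :3 = :1 :+ :1 :+ :1

  1≢0 : 1# ≢ 0#
  1≢0 = 0≢1 ∘ sym

  ⁻¹-inverseˡ : ∀ {x} → x ≢ 0# → x ⁻¹ * x ≡ 1#
  ⁻¹-inverseˡ {x} x≢0 = trans (*-comm (x ⁻¹) x) (⁻¹-inverse x x≢0)

  *-zeroʳ : ∀ {x y} → y ≡ 0# → x * y ≡ 0#
  *-zeroʳ {x} refl = zeroʳ x

  cancel : ∀ {x y} → x ≢ 0# → x * y ≡ 0# → y ≡ 0#
  cancel {x} {y} x≢0 xy≡0 = begin
    y ≡⟨ sym (*-identityˡ y) ⟩
    1# * y ≡⟨ cong (_* y) (sym (⁻¹-inverseˡ x≢0)) ⟩
    x ⁻¹ * x * y ≡⟨ *-assoc (x ⁻¹) x y ⟩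
    x ⁻¹ * (x * y) ≡⟨ cong (x ⁻¹ *_) xy≡0 ⟩
    x ⁻¹ * 0# ≡⟨ zeroʳ (x ⁻¹) ⟩
    0# ∎

  *-nonzero : ∀ {x y} → x ≢ 0# → y ≢ 0# → x * y ≢ 0#
  *-nonzero x≢0 y≢0 xy≡0 = y≢0 (cancel x≢0 xy≡0)

  ⁻¹-nonzero : ∀ {x} → x ≢ 0# → x ⁻¹ ≢ 0#
  ⁻¹-nonzero {x} x≢0 x⁻¹≡0 = 1≢0 (trans (sym (⁻¹-inverse x x≢0)) (*-zeroʳ x⁻¹≡0))

  -‿nonzero : ∀ {x} → x ≢ 0# → - x ≢ 0#
  -‿nonzero {x} x≢0 -x≡0 = x≢0 (begin
    x ≡⟨ solve 1 (λ x → x := :- (:- x)) refl x ⟩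
    - (- x) ≡⟨ cong -_ -x≡0 ⟩
    - 0# ≡⟨ solve 0 (:- :0 := :0) refl ⟩
    0# ∎)

  difference-zero : ∀ {x y} → x + - y ≡ 0# → x ≡ y
  difference-zero {x} {y} x-y≡0 = begin
    x ≡⟨ solve 2 (λ x y → x := (x :+ :- y) :+ y) refl x y ⟩
    x + - y + y ≡⟨ cong (_+ y) x-y≡0 ⟩
    0# + y ≡⟨ +-identityˡ y ⟩
    y ∎

  cancelˡ : ∀ {x y z} → x ≢ 0# → x * y ≡ x * z → y ≡ z
  cancelˡ {x} {y} {z} x≢0 xy≡xz = difference-zero (cancel x≢0 (begin
    x * (y + - z) ≡⟨ solve 3 (λ x y z → x :* (y :+ :- z) := x :* y :+ :- (x :* z)) refl x y z ⟩
    x * y + - (x * z) ≡⟨ cong (_+ - (x * z)) xy≡xz ⟩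
    x * z + - (x * z) ≡⟨ -‿inverseʳ (x * z) ⟩
    0# ∎))

-- Planes, points and lines in homogeneous coordinates.

module Coordinates (𝔽 : FiniteField) where
  open FiniteField 𝔽
  open Geometry 𝔽
  open V4
  open FieldProperties 𝔽 public
  open Solver using (solve; _:+_; _:*_; :-_; _:=_)
  open Booleans

  ==⁻ : ∀ {x y} → T (x == y) → x ≡ y
  ==⁻ {x} {y} = does⁻ (x ≟ y)

  ==⁺ : ∀ {x y} → x ≡ y → T (x == y)
  ==⁺ {x} {y} = does⁺ (x ≟ y)

  vec≡ : ∀ {u v} → c0 u ≡ c0 v → c1 u ≡ c1 v → c2 u ≡ c2 v → c3 u ≡ c3 v → u ≡ v
  vec≡ refl refl refl refl = refl

  eqV⁻ : ∀ {u v} → T (eqV u v) → u ≡ v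
  eqV⁻ e = let e0 , e = ∧⁻ e ; e1 , e = ∧⁻ e ; e2 , e3 = ∧⁻ e in vec≡ (==⁻ e0) (==⁻ e1) (==⁻ e2) (==⁻ e3)

  eqV⁺ : ∀ {u v} → u ≡ v → T (eqV u v)
  eqV⁺ refl = ∧⁺ (==⁺ refl) (∧⁺ (==⁺ refl) (∧⁺ (==⁺ refl) (==⁺ refl)))

  nonzero⁻ : ∀ {v} → T (nonzero v) → v ≢ zeroV
  nonzero⁻ nz v≡0 = not⁻ nz (eqV⁺ v≡0)

  nonzero⁺ : ∀ {v} → v ≢ zeroV → T (nonzero v)
  nonzero⁺ v≢0 = not⁺ (v≢0 ∘ eqV⁻)

  scale-1 : ∀ v → scale 1# v ≡ v
  scale-1 v = vec≡ (*-identityˡ _) (*-identityˡ _) (*-identityˡ _) (*-identityˡ _)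

  scale-scale : ∀ a b v → scale a (scale b v) ≡ scale (a * b) v
  scale-scale a b v = vec≡ (sym (*-assoc _ _ _)) (sym (*-assoc _ _ _)) (sym (*-assoc _ _ _)) (sym (*-assoc _ _ _))

  scale-nonzero : ∀ {a v} → a ≢ 0# → v ≢ zeroV → scale a v ≢ zeroV
  scale-nonzero a≢0 v≢0 av≡0 = v≢0 (vec≡ (cancel a≢0 (cong c0 av≡0)) (cancel a≢0 (cong c1 av≡0))
                                         (cancel a≢0 (cong c2 av≡0)) (cancel a≢0 (cong c3 av≡0)))

  scale-inverse : ∀ {a u v} → a ≢ 0# → u ≡ scale a v → v ≡ scale (a ⁻¹) u
  scale-inverse {a} {u} {v} a≢0 refl =
    trans (sym (scale-1 v)) (trans (cong (λ c → scale c v) (sym (⁻¹-inverseˡ a≢0))) (sym (scale-scale (a ⁻¹) a v)))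

  infix 4 _∝_
  _∝_ : V4 → V4 → Set
  u ∝ v = T (proportional u v)

  ∝⁻ : ∀ {u v} → u ∝ v → ∃ λ a → a ≢ 0# × u ≡ scale a v
  ∝⁻ {u} {v} e with any-elim (λ a → not (a == 0#) ∧ eqV u (scale a v)) elements e
  ... | a , e′ = let a≢0 , u≡av = ∧⁻ e′ in a , (λ a≡0 → not⁻ a≢0 (==⁺ a≡0)) , eqV⁻ u≡av

  ∝⁺ : ∀ {u v} a → a ≢ 0# → u ≡ scale a v → u ∝ v
  ∝⁺ {u} {v} a a≢0 u≡av = any-intro (λ a → not (a == 0#) ∧ eqV u (scale a v)) (complete a)
    (∧⁺ (not⁺ (a≢0 ∘ ==⁻)) (eqV⁺ u≡av))

  ∝-isEquivalence : IsEquivalence _∝_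
  ∝-isEquivalence = record
    { refl  = λ {v} → ∝⁺ 1# 1≢0 (sym (scale-1 v))
    ; sym   = λ u∝v → let a , a≢0 , u≡av = ∝⁻ u∝v in ∝⁺ (a ⁻¹) (⁻¹-nonzero a≢0) (scale-inverse a≢0 u≡av)
    ; trans = λ u∝v v∝w → let a , a≢0 , u≡av = ∝⁻ u∝v ; b , b≢0 , v≡bw = ∝⁻ v∝w in
        ∝⁺ (a * b) (*-nonzero a≢0 b≢0) (trans u≡av (trans (cong (scale a) v≡bw) (scale-scale a b _)))
    }

  module ∝ = IsEquivalence ∝-isEquivalence

  dot : V4 → V4 → Carrier
  dot π x = c0 π * c0 x + c1 π * c1 x + c2 π * c2 x + c3 π * c3 x

  dot-scaleˡ : ∀ a π x → dot (scale a π) x ≡ a * dot π x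
  dot-scaleˡ a π x = solve 9 (λ a π0 π1 π2 π3 x0 x1 x2 x3 →
    (a :* π0) :* x0 :+ (a :* π1) :* x1 :+ (a :* π2) :* x2 :+ (a :* π3) :* x3
    := a :* (π0 :* x0 :+ π1 :* x1 :+ π2 :* x2 :+ π3 :* x3)) refl
    a (c0 π) (c1 π) (c2 π) (c3 π) (c0 x) (c1 x) (c2 x) (c3 x)

  dot-scaleʳ : ∀ a π x → dot π (scale a x) ≡ a * dot π x
  dot-scaleʳ a π x = solve 9 (λ a π0 π1 π2 π3 x0 x1 x2 x3 →
    π0 :* (a :* x0) :+ π1 :* (a :* x1) :+ π2 :* (a :* x2) :+ π3 :* (a :* x3)
    := a :* (π0 :* x0 :+ π1 :* x1 :+ π2 :* x2 :+ π3 :* x3)) refl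
    a (c0 π) (c1 π) (c2 π) (c3 π) (c0 x) (c1 x) (c2 x) (c3 x)

  dot-addʳ : ∀ π x y → dot π (addV x y) ≡ dot π x + dot π y
  dot-addʳ π x y = solve 12 (λ π0 π1 π2 π3 x0 x1 x2 x3 y0 y1 y2 y3 →
    π0 :* (x0 :+ y0) :+ π1 :* (x1 :+ y1) :+ π2 :* (x2 :+ y2) :+ π3 :* (x3 :+ y3)
    := (π0 :* x0 :+ π1 :* x1 :+ π2 :* x2 :+ π3 :* x3) :+ (π0 :* y0 :+ π1 :* y1 :+ π2 :* y2 :+ π3 :* y3)) refl
    (c0 π) (c1 π) (c2 π) (c3 π) (c0 x) (c1 x) (c2 x) (c3 x) (c0 y) (c1 y) (c2 y) (c3 y)

  comb : Carrier → V4 → Carrier → V4 → V4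
  comb a u b v = addV (scale a u) (scale b v)

  dot-comb : ∀ π a u b v → dot π (comb a u b v) ≡ a * dot π u + b * dot π v
  dot-comb π a u b v = trans (dot-addʳ π _ _) (cong₂ _+_ (dot-scaleʳ a π u) (dot-scaleʳ b π v))

  comb-comb : ∀ {a b a₁ b₁ a₂ b₂ u v x y} → u ≡ comb a₁ x b₁ y → v ≡ comb a₂ x b₂ y →
    comb a u b v ≡ comb (a * a₁ + b * a₂) x (a * b₁ + b * b₂) y
  comb-comb {a} {b} {a₁} {b₁} {a₂} {b₂} {x = x} {y} refl refl = vec≡ (s _ _) (s _ _) (s _ _) (s _ _)
    where
    s = λ x y → solve 8 (λ a b a₁ b₁ a₂ b₂ x y →
      a :* (a₁ :* x :+ b₁ :* y) :+ b :* (a₂ :* x :+ b₂ :* y)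
      := (a :* a₁ :+ b :* a₂) :* x :+ (a :* b₁ :+ b :* b₂) :* y) refl a b a₁ b₁ a₂ b₂ x y

  comb-1-0 : ∀ u v → u ≡ comb 1# u 0# v
  comb-1-0 u v = vec≡ (s _ _) (s _ _) (s _ _) (s _ _)
    where s = λ x y → solve 2 (λ x y → x := :1 :* x :+ :0 :* y) refl x y

  comb-0-1 : ∀ u v → v ≡ comb 0# u 1# v
  comb-0-1 u v = vec≡ (s _ _) (s _ _) (s _ _) (s _ _)
    where s = λ x y → solve 2 (λ x y → y := :0 :* x :+ :1 :* y) refl x y

  infix 4 _∈ˡ_ _≈_

  _∈ˡ_ : V4 → Line → Set
  w ∈ˡ (u , v) = ∃₂ λ a b → w ≡ comb a u b v

  onLine⁻ : ∀ L {w} → T (onLine L w) → w ∈ˡ L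
  onLine⁻ (u , v) {w} e =
    let a , e′ = any-elim (λ a → any (λ b → eqV w (comb a u b v)) elements) elements e
        b , e″ = any-elim (λ b → eqV w (comb a u b v)) elements e′
    in a , b , eqV⁻ e″
    where open import Data.Bool.ListAction using (any)

  onLine⁺ : ∀ L {w} → w ∈ˡ L → T (onLine L w)
  onLine⁺ (u , v) {w} (a , b , w≡) =
    any-intro (λ a → any (λ b → eqV w (comb a u b v)) elements) (complete a)
      (any-intro (λ b → eqV w (comb a u b v)) (complete b) (eqV⁺ w≡))
    where open import Data.Bool.ListAction using (any)

  _≈_ : Line → Line → Set
  L ≈ M = T (sameLine L M)

  sameLine⁻ : ∀ {L M} → L ≈ M → (proj₁ L ∈ˡ M × proj₂ L ∈ˡ M) × (proj₁ M ∈ˡ L × proj₂ M ∈ˡ L)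
  sameLine⁻ {L} {M} e = let e0 , e = ∧⁻ e ; e1 , e = ∧⁻ e ; e2 , e3 = ∧⁻ e in
    (onLine⁻ M e0 , onLine⁻ M e1) , (onLine⁻ L e2 , onLine⁻ L e3)

  sameLine⁺ : ∀ {L M} → proj₁ L ∈ˡ M → proj₂ L ∈ˡ M → proj₁ M ∈ˡ L → proj₂ M ∈ˡ L → L ≈ M
  sameLine⁺ {L} {M} e0 e1 e2 e3 = ∧⁺ (onLine⁺ M e0) (∧⁺ (onLine⁺ M e1) (∧⁺ (onLine⁺ L e2) (onLine⁺ L e3)))

  ∈ˡ-span : ∀ L M {w} → proj₁ L ∈ˡ M → proj₂ L ∈ˡ M → w ∈ˡ L → w ∈ˡ M
  ∈ˡ-span L M (a₁ , b₁ , u≡) (a₂ , b₂ , v≡) (a , b , refl) = _ , _ , comb-comb u≡ v≡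

  ∈ˡ-resp-≈ : ∀ {L M w} → L ≈ M → w ∈ˡ L → w ∈ˡ M
  ∈ˡ-resp-≈ {L} {M} e = let (e0 , e1) , _ = sameLine⁻ {L} {M} e in ∈ˡ-span L M e0 e1

  ∈ˡ-first : ∀ {u v} → u ∈ˡ (u , v)
  ∈ˡ-first {u} {v} = 1# , 0# , comb-1-0 u v

  ∈ˡ-second : ∀ {u v} → v ∈ˡ (u , v)
  ∈ˡ-second {u} {v} = 0# , 1# , comb-0-1 u v

  ≈-refl : ∀ {L} → L ≈ L
  ≈-refl {L} = sameLine⁺ {L} {L} ∈ˡ-first ∈ˡ-second ∈ˡ-first ∈ˡ-second

  ≈-sym : ∀ {L M} → L ≈ M → M ≈ L
  ≈-sym {L} {M} e = let (e0 , e1) , (e2 , e3) = sameLine⁻ {L} {M} e in sameLine⁺ {M} {L} e2 e3 e0 e1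

  ≈-trans : ∀ {L M N} → L ≈ M → M ≈ N → L ≈ N
  ≈-trans {L} {M} {N} e f =
    let (e0 , e1) , _ = sameLine⁻ {L} {M} e ; _ , (f2 , f3) = sameLine⁻ {M} {N} f
        e⁻¹ = ≈-sym {L} {M} e ; f⁻¹ = ≈-sym {M} {N} f in
    sameLine⁺ {L} {N} (∈ˡ-resp-≈ {M} {N} f e0) (∈ˡ-resp-≈ {M} {N} f e1)
                      (∈ˡ-resp-≈ {M} {L} e⁻¹ f2) (∈ˡ-resp-≈ {M} {L} e⁻¹ f3)

  ≈-isEquivalence : IsEquivalence _≈_
  ≈-isEquivalence = record
    { refl = λ {L} → ≈-refl {L} ; sym = λ {L} {M} → ≈-sym {L} {M} ; trans = λ {L} {M} {N} → ≈-trans {L} {M} {N} }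

  inPlane⁻ : ∀ {L π} → T (lineInPlane L π) → ∀ {w} → w ∈ˡ L → dot π w ≡ 0#
  inPlane⁻ {u , v} {π} e (a , b , refl) = let πu , πv = ∧⁻ e in begin
    dot π (comb a u b v) ≡⟨ dot-comb π a u b v ⟩
    a * dot π u + b * dot π v ≡⟨ cong₂ (λ x y → a * x + b * y) (==⁻ πu) (==⁻ πv) ⟩
    a * 0# + b * 0# ≡⟨ solve 2 (λ a b → a :* :0 :+ b :* :0 := :0) refl a b ⟩
    0# ∎
    where open ≡-Reasoning

  inPlane⁺ : ∀ {L π} → dot π (proj₁ L) ≡ 0# → dot π (proj₂ L) ≡ 0# → T (lineInPlane L π)
  inPlane⁺ πu πv = ∧⁺ (==⁺ πu) (==⁺ πv)

  inPlane-resp-≈ : ∀ {L M π} → L ≈ M → T (lineInPlane L π) → T (lineInPlane M π)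
  inPlane-resp-≈ {L} {M} {π} e L⊂π = let _ , (f0 , f1) = sameLine⁻ {L} {M} e in
    inPlane⁺ {M} {π} (inPlane⁻ {L} {π} L⊂π f0) (inPlane⁻ {L} {π} L⊂π f1)

  inPlane-resp-≈˘ : ∀ {L M π} → L ≈ M → T (lineInPlane M π) → T (lineInPlane L π)
  inPlane-resp-≈˘ {L} {M} {π} e = inPlane-resp-≈ {M} {L} {π} (≈-sym {L} {M} e)

  isLine⁻ : ∀ {u v} → T (isLine (u , v)) → u ≢ zeroV × (∀ a → v ≢ scale a u)
  isLine⁻ {u} {v} e = let nz , indep = ∧⁻ e in
    nonzero⁻ nz , λ a v≡au → not⁻ indep (any-intro (λ a → eqV v (scale a u)) (complete a) (eqV⁺ v≡au))

  isLine⁺ : ∀ {u v} → u ≢ zeroV → (∀ a → v ≢ scale a u) → T (isLine (u , v))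
  isLine⁺ {u} {v} u≢0 indep = ∧⁺ (nonzero⁺ u≢0)
    (not⁺ λ e → let a , e′ = any-elim (λ a → eqV v (scale a u)) elements e in indep a (eqV⁻ e′))

  -- The test `isLine` treats its two vectors differently; this symmetric form survives a swap, a
  -- change of basis and a change of frame.
  Independent : V4 → V4 → Set
  Independent u v = ∀ {x y} → comb x u y v ≡ zeroV → x ≡ 0# × y ≡ 0#

  independent⁻ : ∀ {u v} → T (isLine (u , v)) → Independent u v
  independent⁻ {u} {v} L {x} {y} e with isLine⁻ L | y ≟ 0#
  ... | u≢0 , _     | yes refl with x ≟ 0#
  ...   | yes x≡0 = x≡0 , refl
  ...   | no  x≢0 = contradiction (trans (vec≡ (s _ _) (s _ _) (s _ _) (s _ _)) e) (scale-nonzero x≢0 u≢0)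
    where s = λ u v → solve 3 (λ x u v → x :* u := x :* u :+ :0 :* v) refl x u v
  independent⁻ {u} {v} L {x} {y} e | _ , indep | no y≢0 = contradiction
    (vec≡ (s (cong c0 e)) (s (cong c1 e)) (s (cong c2 e)) (s (cong c3 e))) (indep (- x * y ⁻¹))
    where
    s : ∀ {u v} → x * u + y * v ≡ 0# → v ≡ - x * y ⁻¹ * u
    s {u} {v} e = cancelˡ y≢0 (difference-zero (begin
      y * v + - (y * (- x * y ⁻¹ * u)) ≡⟨ solve 5 (λ x y z u v → y :* v :+ :- (y :* (:- x :* z :* u)) := (y :* z) :* (x :* u) :+ y :* v) refl x y (y ⁻¹) u v ⟩
      y * y ⁻¹ * (x * u) + y * v ≡⟨ cong (λ z → z * (x * u) + y * v) (⁻¹-inverse y y≢0) ⟩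
      1# * (x * u) + y * v ≡⟨ cong (_+ y * v) (*-identityˡ _) ⟩
      x * u + y * v ≡⟨ e ⟩
      0# ∎))
      where open ≡-Reasoning

  independent⁺ : ∀ {u v} → Independent u v → T (isLine (u , v))
  independent⁺ {u} {v} indep = isLine⁺
    (λ u≡0 → 1≢0 (proj₁ (indep (trans (sym (comb-1-0 u v)) u≡0))))
    (λ { a refl → 1≢0 (proj₂ (indep {x = - a} {y = 1#} (vec≡ (s a _) (s a _) (s a _) (s a _)))) })
    where
    s : ∀ a u → - a * u + 1# * (a * u) ≡ 0#
    s = solve 2 (λ a u → :- a :* u :+ :1 :* (a :* u) := :0) refl

  swap-≈ : ∀ {u v} → (u , v) ≈ (v , u)
  swap-≈ {u} {v} = sameLine⁺ {u , v} {v , u} ∈ˡ-second ∈ˡ-first ∈ˡ-second ∈ˡ-first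

  swap-isLine : ∀ {u v} → T (isLine (u , v)) → T (isLine (v , u))
  swap-isLine L = independent⁺ λ e →
    let y≡0 , x≡0 = independent⁻ L (trans (vec≡ (+-comm _ _) (+-comm _ _) (+-comm _ _) (+-comm _ _)) e) in x≡0 , y≡0

  replace-≈ : ∀ {u v a b} → a ≢ 0# → (u , v) ≈ (comb a u b v , v)
  replace-≈ {u} {v} {a} {b} a≢0 = sameLine⁺ {u , v} {comb a u b v , v}
    (a ⁻¹ , - (a ⁻¹ * b) , vec≡ (s _ _) (s _ _) (s _ _) (s _ _)) ∈ˡ-second (a , b , refl) ∈ˡ-second
    where
    s : ∀ u v → u ≡ a ⁻¹ * (a * u + b * v) + - (a ⁻¹ * b) * v
    s u v = sym (begin
      a ⁻¹ * (a * u + b * v) + - (a ⁻¹ * b) * v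
        ≡⟨ solve 5 (λ a z b u v → z :* (a :* u :+ b :* v) :+ :- (z :* b) :* v := (z :* a) :* u) refl a (a ⁻¹) b u v ⟩
      a ⁻¹ * a * u ≡⟨ cong (_* u) (⁻¹-inverseˡ a≢0) ⟩
      1# * u ≡⟨ *-identityˡ u ⟩
      u ∎)
      where open ≡-Reasoning

  replace-isLine : ∀ {u v a b} → a ≢ 0# → T (isLine (u , v)) → T (isLine (comb a u b v , v))
  replace-isLine {u} {v} {a} {b} a≢0 L = independent⁺ λ {x} {y} e →
    let xa≡0 , xb+y≡0 = independent⁻ L (trans (sym (comb-comb {x} {y} refl (comb-0-1 u v))) e)
        x≡0 = cancel a≢0 (trans (solve 3 (λ a x y → a :* x := x :* a :+ y :* :0) refl a x y) xa≡0)
    in x≡0 , trans (solve 2 (λ b y → y := :0 :* b :+ y :* :1) refl b y)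
                   (trans (cong (λ x → x * b + y * 1#) (sym x≡0)) xb+y≡0)

  -- Steinitz exchange: a nonzero vector of the line has a nonzero coefficient on one of the basis
  -- vectors and can replace it.
  exchange : ∀ {L e} → T (isLine L) → e ≢ zeroV → e ∈ˡ L → ∃ λ w → L ≈ (e , w) × T (isLine (e , w))
  exchange {u , v} L e≢0 (a , b , refl) with a ≟ 0# | b ≟ 0#
  ... | no a≢0   | _        = v , replace-≈ a≢0 , replace-isLine a≢0 L
  ... | yes refl | yes refl = contradiction (vec≡ (s _ _) (s _ _) (s _ _) (s _ _)) e≢0
    where s = solve 2 (λ x y → :0 :* x :+ :0 :* y := :0) refl
  -- `replace-≈` exchanges the first basis vector, so the basis is swapped beforehand.
  ... | yes refl | no b≢0   = u , subst (λ e → (u , v) ≈ (e , u)) flip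
          (≈-trans {u , v} {v , u} {comb b v 0# u , u} swap-≈ (replace-≈ b≢0))
        , subst (λ e → T (isLine (e , u))) flip (replace-isLine b≢0 (swap-isLine L))
    where
    flip : comb b v 0# u ≡ comb 0# u b v
    flip = vec≡ (+-comm _ _) (+-comm _ _) (+-comm _ _) (+-comm _ _)

  -- With f the form of the plane, f(v) u - f(u) v is a zero of f, and it is nonzero by independence
  -- unless f(u) = 0, when u itself serves.
  meet : ∀ {L} → T (isLine L) → ∀ π → ∃ λ e → e ≢ zeroV × e ∈ˡ L × dot π e ≡ 0#
  meet {u , v} L π with dot π u ≟ 0#
  ... | yes πu≡0 = u , proj₁ (isLine⁻ L) , ∈ˡ-first , πu≡0
  ... | no  πu≢0 = comb (dot π v) u (- dot π u) v
      , (λ e → -‿nonzero πu≢0 (proj₂ (independent⁻ L e)))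
      , (_ , _ , refl)
      , trans (dot-comb π _ u _ v) (solve 2 (λ x y → y :* x :+ :- x :* y := :0) refl (dot π u) (dot π v))

-- Change of coordinates to the frame at a point of the cubic.

-- The frame at P(p) is the projectivity of G_q moving P(p) to P(∞); it moves any other
-- P(s) to P(κ), where κ = s if p = ∞ and κ = 1/(s − p) otherwise.
module Frames (𝔽 : FiniteField) where
  open FiniteField 𝔽
  open Geometry 𝔽
  open V4
  open Booleans
  open Coordinates 𝔽 public
  open Solver using (solve; _:+_; _:*_; :-_; _:=_)
  open ≡-Reasoning

  -- For finite t this is the substitution s = t + 1/κ on cubic monomials: (κ³, κ², κ, 1) goes to
  -- ((tκ + 1)³, (tκ + 1)²κ, (tκ + 1)κ², κ³).
  fromFrame : Param → V4 → V4
  fromFrame nothing  x = x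
  fromFrame (just t) ⟨ x0 , x1 , x2 , x3 ⟩ =
    ⟨ t * t * t * x0 + 3# * t * t * x1 + 3# * t * x2 + x3 , t * t * x0 + 2# * t * x1 + x2 , t * x0 + x1 , x0 ⟩

  toFrame : Param → V4 → V4
  toFrame nothing  x = x
  toFrame (just t) ⟨ v0 , v1 , v2 , v3 ⟩ =
    ⟨ v3 , v2 + - (t * v3) , v1 + - (2# * t * v2) + t * t * v3
    , v0 + - (3# * t * v1) + 3# * t * t * v2 + - (t * t * t * v3) ⟩

  -- The transpose of `fromFrame`. For finite t its entries are the Hasse derivatives at t of a x³ +
  -- b x² + c x + d, in increasing order, so no factorial is divided out in any characteristic.
  planeIn : Param → V4 → V4
  planeIn nothing  π = π
  planeIn (just t) ⟨ a , b , c , d ⟩ =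
    ⟨ a * (t * t * t) + b * (t * t) + c * t + d , a * (3# * t * t) + b * (2# * t) + c , a * (3# * t) + b , a ⟩

  planeFrom : Param → V4 → V4
  planeFrom nothing  σ = σ
  planeFrom (just t) ⟨ a , b , c , d ⟩ =
    ⟨ d , c + - (3# * t * d) , b + - (2# * t * c) + 3# * t * t * d , a + - (t * b) + t * t * c + - (t * t * t * d) ⟩

  fromFrame-toFrame : ∀ p v → fromFrame p (toFrame p v) ≡ v
  fromFrame-toFrame nothing v = refl
  fromFrame-toFrame (just t) ⟨ v0 , v1 , v2 , v3 ⟩ = vec≡
    (solve 5 (λ t v0 v1 v2 v3 → t :* t :* t :* v3 :+ :3 :* t :* t :* (v2 :+ :- (t :* v3))
        :+ :3 :* t :* (v1 :+ :- (:2 :* t :* v2) :+ t :* t :* v3)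
        :+ (v0 :+ :- (:3 :* t :* v1) :+ :3 :* t :* t :* v2 :+ :- (t :* t :* t :* v3)) := v0) refl t v0 v1 v2 v3)
    (solve 4 (λ t v1 v2 v3 → t :* t :* v3 :+ :2 :* t :* (v2 :+ :- (t :* v3))
        :+ (v1 :+ :- (:2 :* t :* v2) :+ t :* t :* v3) := v1) refl t v1 v2 v3)
    (solve 3 (λ t v2 v3 → t :* v3 :+ (v2 :+ :- (t :* v3)) := v2) refl t v2 v3)
    refl

  toFrame-fromFrame : ∀ p x → toFrame p (fromFrame p x) ≡ x
  toFrame-fromFrame nothing x = refl
  toFrame-fromFrame (just t) ⟨ x0 , x1 , x2 , x3 ⟩ = vec≡
    refl
    (solve 3 (λ t x0 x1 → t :* x0 :+ x1 :+ :- (t :* x0) := x1) refl t x0 x1)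
    (solve 4 (λ t x0 x1 x2 → t :* t :* x0 :+ :2 :* t :* x1 :+ x2 :+ :- (:2 :* t :* (t :* x0 :+ x1)) :+ t :* t :* x0 := x2)
      refl t x0 x1 x2)
    (solve 5 (λ t x0 x1 x2 x3 → t :* t :* t :* x0 :+ :3 :* t :* t :* x1 :+ :3 :* t :* x2 :+ x3
        :+ :- (:3 :* t :* (t :* t :* x0 :+ :2 :* t :* x1 :+ x2)) :+ :3 :* t :* t :* (t :* x0 :+ x1)
        :+ :- (t :* t :* t :* x0) := x3) refl t x0 x1 x2 x3)

  planeIn-planeFrom : ∀ p σ → planeIn p (planeFrom p σ) ≡ σ
  planeIn-planeFrom nothing σ = refl
  planeIn-planeFrom (just t) ⟨ a , b , c , d ⟩ = vec≡
    (solve 5 (λ t a b c d → d :* (t :* t :* t) :+ (c :+ :- (:3 :* t :* d)) :* (t :* t)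
        :+ (b :+ :- (:2 :* t :* c) :+ :3 :* t :* t :* d) :* t
        :+ (a :+ :- (t :* b) :+ t :* t :* c :+ :- (t :* t :* t :* d)) := a) refl t a b c d)
    (solve 4 (λ t b c d → d :* (:3 :* t :* t) :+ (c :+ :- (:3 :* t :* d)) :* (:2 :* t)
        :+ (b :+ :- (:2 :* t :* c) :+ :3 :* t :* t :* d) := b) refl t b c d)
    (solve 3 (λ t c d → d :* (:3 :* t) :+ (c :+ :- (:3 :* t :* d)) := c) refl t c d)
    refl

  planeFrom-planeIn : ∀ p π → planeFrom p (planeIn p π) ≡ π
  planeFrom-planeIn nothing π = refl
  planeFrom-planeIn (just t) ⟨ a , b , c , d ⟩ = vec≡
    refl
    (solve 3 (λ t a b → a :* (:3 :* t) :+ b :+ :- (:3 :* t :* a) := b) refl t a b)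
    (solve 4 (λ t a b c → a :* (:3 :* t :* t) :+ b :* (:2 :* t) :+ c :+ :- (:2 :* t :* (a :* (:3 :* t) :+ b))
        :+ :3 :* t :* t :* a := c) refl t a b c)
    (solve 5 (λ t a b c d → a :* (t :* t :* t) :+ b :* (t :* t) :+ c :* t :+ d
        :+ :- (t :* (a :* (:3 :* t :* t) :+ b :* (:2 :* t) :+ c)) :+ t :* t :* (a :* (:3 :* t) :+ b)
        :+ :- (t :* t :* t :* a) := d) refl t a b c d)

  fromFrame-comb : ∀ p a u b v → fromFrame p (comb a u b v) ≡ comb a (fromFrame p u) b (fromFrame p v)
  fromFrame-comb nothing  a u b v = refl
  fromFrame-comb (just t) a ⟨ u0 , u1 , u2 , u3 ⟩ b ⟨ v0 , v1 , v2 , v3 ⟩ = vec≡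
    (solve 11 (λ t a b u0 u1 u2 u3 v0 v1 v2 v3 →
        t :* t :* t :* (a :* u0 :+ b :* v0) :+ :3 :* t :* t :* (a :* u1 :+ b :* v1)
          :+ :3 :* t :* (a :* u2 :+ b :* v2) :+ (a :* u3 :+ b :* v3)
        := a :* (t :* t :* t :* u0 :+ :3 :* t :* t :* u1 :+ :3 :* t :* u2 :+ u3)
          :+ b :* (t :* t :* t :* v0 :+ :3 :* t :* t :* v1 :+ :3 :* t :* v2 :+ v3))
      refl t a b u0 u1 u2 u3 v0 v1 v2 v3)
    (solve 9 (λ t a b u0 u1 u2 v0 v1 v2 →
        t :* t :* (a :* u0 :+ b :* v0) :+ :2 :* t :* (a :* u1 :+ b :* v1) :+ (a :* u2 :+ b :* v2)
        := a :* (t :* t :* u0 :+ :2 :* t :* u1 :+ u2) :+ b :* (t :* t :* v0 :+ :2 :* t :* v1 :+ v2))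
      refl t a b u0 u1 u2 v0 v1 v2)
    (solve 7 (λ t a b u0 u1 v0 v1 → t :* (a :* u0 :+ b :* v0) :+ (a :* u1 :+ b :* v1)
        := a :* (t :* u0 :+ u1) :+ b :* (t :* v0 :+ v1)) refl t a b u0 u1 v0 v1)
    refl

  dot-planeIn : ∀ p π x → dot (planeIn p π) x ≡ dot π (fromFrame p x)
  dot-planeIn nothing  π x = refl
  dot-planeIn (just t) ⟨ a , b , c , d ⟩ ⟨ x0 , x1 , x2 , x3 ⟩ =
    solve 9 (λ t a b c d x0 x1 x2 x3 →
      (a :* (t :* t :* t) :+ b :* (t :* t) :+ c :* t :+ d) :* x0
        :+ (a :* (:3 :* t :* t) :+ b :* (:2 :* t) :+ c) :* x1 :+ (a :* (:3 :* t) :+ b) :* x2 :+ a :* x3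
      := a :* (t :* t :* t :* x0 :+ :3 :* t :* t :* x1 :+ :3 :* t :* x2 :+ x3)
        :+ b :* (t :* t :* x0 :+ :2 :* t :* x1 :+ x2) :+ c :* (t :* x0 :+ x1) :+ d :* x0)
      refl t a b c d x0 x1 x2 x3

  planeFrom-scale : ∀ p a σ → planeFrom p (scale a σ) ≡ scale a (planeFrom p σ)
  planeFrom-scale nothing  a σ = refl
  planeFrom-scale (just t) e ⟨ a , b , c , d ⟩ = vec≡
    refl
    (solve 4 (λ t e c d → e :* c :+ :- (:3 :* t :* (e :* d)) := e :* (c :+ :- (:3 :* t :* d))) refl t e c d)
    (solve 5 (λ t e b c d → e :* b :+ :- (:2 :* t :* (e :* c)) :+ :3 :* t :* t :* (e :* d)
        := e :* (b :+ :- (:2 :* t :* c) :+ :3 :* t :* t :* d)) refl t e b c d)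
    (solve 6 (λ t e a b c d → e :* a :+ :- (t :* (e :* b)) :+ t :* t :* (e :* c) :+ :- (t :* t :* t :* (e :* d))
        := e :* (a :+ :- (t :* b) :+ t :* t :* c :+ :- (t :* t :* t :* d))) refl t e a b c d)

  planeFrom-zero : ∀ p → planeFrom p zeroV ≡ zeroV
  planeFrom-zero nothing  = refl
  planeFrom-zero (just t) = vec≡ refl
    (solve 1 (λ t → :0 :+ :- (:3 :* t :* :0) := :0) refl t)
    (solve 1 (λ t → :0 :+ :- (:2 :* t :* :0) :+ :3 :* t :* t :* :0 := :0) refl t)
    (solve 1 (λ t → :0 :+ :- (t :* :0) :+ t :* t :* :0 :+ :- (t :* t :* t :* :0) := :0) refl t)

  fromFrame-zero : ∀ p → fromFrame p zeroV ≡ zeroV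
  fromFrame-zero nothing  = refl
  fromFrame-zero (just t) = vec≡
    (solve 1 (λ t → t :* t :* t :* :0 :+ :3 :* t :* t :* :0 :+ :3 :* t :* :0 :+ :0 := :0) refl t)
    (solve 1 (λ t → t :* t :* :0 :+ :2 :* t :* :0 :+ :0 := :0) refl t)
    (solve 1 (λ t → t :* :0 :+ :0 := :0) refl t)
    refl

  planeIn-∝ : ∀ p {π ρ a} → planeIn p π ≡ scale a (planeIn p ρ) → π ≡ scale a ρ
  planeIn-∝ p {π} {ρ} {a} e = begin
    π ≡⟨ sym (planeFrom-planeIn p π) ⟩
    planeFrom p (planeIn p π) ≡⟨ cong (planeFrom p) e ⟩
    planeFrom p (scale a (planeIn p ρ)) ≡⟨ planeFrom-scale p a _ ⟩
    scale a (planeFrom p (planeIn p ρ)) ≡⟨ cong (scale a) (planeFrom-planeIn p ρ) ⟩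
    scale a ρ ∎

  planeIn-nonzero : ∀ p {π} → π ≢ zeroV → planeIn p π ≢ zeroV
  planeIn-nonzero p {π} π≢0 e = π≢0 (trans (sym (planeFrom-planeIn p π)) (trans (cong (planeFrom p) e) (planeFrom-zero p)))

  planeFrom-nonzero : ∀ p {σ} → σ ≢ zeroV → planeFrom p σ ≢ zeroV
  planeFrom-nonzero p {σ} σ≢0 e = σ≢0 (begin
    σ ≡⟨ sym (planeIn-planeFrom p σ) ⟩
    planeIn p (planeFrom p σ) ≡⟨ cong (planeIn p) (trans e (sym (planeFrom-zero p))) ⟩
    planeIn p (planeFrom p zeroV) ≡⟨ planeIn-planeFrom p zeroV ⟩
    zeroV ∎)

  lineFrom : Param → Line → Line
  lineFrom p (u , v) = fromFrame p u , fromFrame p v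

  lineIn : Param → Line → Line
  lineIn p (u , v) = toFrame p u , toFrame p v

  lineFrom-lineIn : ∀ p L → lineFrom p (lineIn p L) ≡ L
  lineFrom-lineIn p (u , v) = cong₂ _,_ (fromFrame-toFrame p u) (fromFrame-toFrame p v)

  fromFrame-injective : ∀ p {x y} → fromFrame p x ≡ fromFrame p y → x ≡ y
  fromFrame-injective p {x} {y} e =
    trans (sym (toFrame-fromFrame p x)) (trans (cong (toFrame p) e) (toFrame-fromFrame p y))

  fromFrame-∈ˡ : ∀ p {M x} → x ∈ˡ M → fromFrame p x ∈ˡ lineFrom p M
  fromFrame-∈ˡ p {u , v} (a , b , refl) = a , b , fromFrame-comb p a u b v

  ∈ˡ-fromFrame : ∀ p {M x} → fromFrame p x ∈ˡ lineFrom p M → x ∈ˡ M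
  ∈ˡ-fromFrame p {u , v} (a , b , e) = a , b , fromFrame-injective p (trans e (sym (fromFrame-comb p a u b v)))

  lineFrom-≈⁺ : ∀ p {M N} → M ≈ N → lineFrom p M ≈ lineFrom p N
  lineFrom-≈⁺ p {M} {N} e = let (e0 , e1) , (e2 , e3) = sameLine⁻ {M} {N} e in
    sameLine⁺ {lineFrom p M} {lineFrom p N} (fromFrame-∈ˡ p {N} e0) (fromFrame-∈ˡ p {N} e1)
      (fromFrame-∈ˡ p {M} e2) (fromFrame-∈ˡ p {M} e3)

  lineFrom-≈⁻ : ∀ p {M N} → lineFrom p M ≈ lineFrom p N → M ≈ N
  lineFrom-≈⁻ p {M} {N} e = let (e0 , e1) , (e2 , e3) = sameLine⁻ {lineFrom p M} {lineFrom p N} e in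
    sameLine⁺ {M} {N} (∈ˡ-fromFrame p {N} e0) (∈ˡ-fromFrame p {N} e1) (∈ˡ-fromFrame p {M} e2) (∈ˡ-fromFrame p {M} e3)

  lineFrom-isLine⁺ : ∀ p {M} → T (isLine M) → T (isLine (lineFrom p M))
  lineFrom-isLine⁺ p {u , v} M = independent⁺ λ {x} {y} e → independent⁻ M
    (fromFrame-injective p (trans (fromFrame-comb p x u y v) (trans e (sym (fromFrame-zero p)))))

  lineFrom-isLine⁻ : ∀ p {M} → T (isLine (lineFrom p M)) → T (isLine M)
  lineFrom-isLine⁻ p {u , v} M = independent⁺ λ {x} {y} e → independent⁻ M
    (trans (sym (fromFrame-comb p x u y v)) (trans (cong (fromFrame p) e) (fromFrame-zero p)))

  lineFrom-inPlane⁺ : ∀ p {M π} → T (lineInPlane M (planeIn p π)) → T (lineInPlane (lineFrom p M) π)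
  lineFrom-inPlane⁺ p {u , v} {π} e = inPlane⁺ {lineFrom p (u , v)} {π}
    (trans (sym (dot-planeIn p π u)) (inPlane⁻ {u , v} e ∈ˡ-first))
    (trans (sym (dot-planeIn p π v)) (inPlane⁻ {u , v} e ∈ˡ-second))

  lineFrom-inPlane⁻ : ∀ p {M π} → T (lineInPlane (lineFrom p M) π) → T (lineInPlane M (planeIn p π))
  lineFrom-inPlane⁻ p {u , v} {π} e = inPlane⁺ {u , v} {planeIn p π}
    (trans (dot-planeIn p π u) (inPlane⁻ {lineFrom p (u , v)} {π} e ∈ˡ-first))
    (trans (dot-planeIn p π v) (inPlane⁻ {lineFrom p (u , v)} {π} e ∈ˡ-second))

  -- The values for `p = s` are fillers: the comparisons with the cubic below all assume `p ≢ s`. In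
  -- the frame at a finite point, P(∞) receives the value 0.
  chart : Param → Param → Carrier
  chart nothing  nothing  = 0#
  chart nothing  (just s) = s
  chart (just t) nothing  = 0#
  chart (just t) (just s) = (s + - t) ⁻¹

  unchart : Param → Carrier → Param
  unchart nothing  k = just k
  unchart (just t) k with k ≟ 0#
  ... | yes _ = nothing
  ... | no  _ = just (t + k ⁻¹)

  just-≢ : ∀ {t s} → just t ≢ just s → s + - t ≢ 0#
  just-≢ t≢s s-t≡0 = t≢s (cong just (sym (difference-zero s-t≡0)))

  ⁻¹-unique : ∀ {x y} → x * y ≡ 1# → y ≡ x ⁻¹
  ⁻¹-unique {x} {y} xy≡1 = cancelˡ x≢0 (trans xy≡1 (sym (⁻¹-inverse x x≢0)))
    where
    x≢0 : x ≢ 0#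
    x≢0 refl = 0≢1 (trans (sym (zeroˡ y)) xy≡1)

  unchart-≢ : ∀ p k → p ≢ unchart p k
  unchart-≢ nothing  k ()
  unchart-≢ (just t) k e with k ≟ 0#
  unchart-≢ (just t) k () | yes _
  unchart-≢ (just t) k e  | no k≢0 = ⁻¹-nonzero k≢0 (begin
    k ⁻¹ ≡⟨ solve 2 (λ t z → z := t :+ z :+ :- t) refl t (k ⁻¹) ⟩
    t + k ⁻¹ + - t ≡⟨ cong (_+ - t) (sym (just-injective e)) ⟩
    t + - t ≡⟨ -‿inverseʳ t ⟩
    0# ∎)

  chart-unchart : ∀ p k → chart p (unchart p k) ≡ k
  chart-unchart nothing  k = refl
  chart-unchart (just t) k with k ≟ 0#
  ... | yes k≡0 = sym k≡0
  ... | no  k≢0 = begin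
    (t + k ⁻¹ + - t) ⁻¹ ≡⟨ cong _⁻¹ (solve 2 (λ t z → t :+ z :+ :- t := z) refl t (k ⁻¹)) ⟩
    (k ⁻¹) ⁻¹ ≡⟨ sym (⁻¹-unique (⁻¹-inverseˡ k≢0)) ⟩
    k ∎

  chart-injective : ∀ p {s s′} → p ≢ s → p ≢ s′ → chart p s ≡ chart p s′ → s ≡ s′
  chart-injective nothing  {nothing} p≢s _ _ = contradiction refl p≢s
  chart-injective nothing  {just s} {nothing} _ p≢s′ _ = contradiction refl p≢s′
  chart-injective nothing  {just s} {just s′} _ _ e = cong just e
  chart-injective (just t) {nothing} {nothing} _ _ _ = refl
  chart-injective (just t) {nothing} {just s′} _ p≢s′ e = contradiction (sym e) (⁻¹-nonzero (just-≢ p≢s′))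
  chart-injective (just t) {just s} {nothing} p≢s _ e = contradiction e (⁻¹-nonzero (just-≢ p≢s))
  chart-injective (just t) {just s} {just s′} p≢s p≢s′ e = cong just (difference-zero (begin
    s + - s′ ≡⟨ solve 3 (λ s s′ t → s :+ :- s′ := (s :+ :- t) :+ :- (s′ :+ :- t)) refl s s′ t ⟩
    s + - t + - (s′ + - t) ≡⟨ cong (_+ - (s′ + - t)) same ⟩
    s′ + - t + - (s′ + - t) ≡⟨ -‿inverseʳ _ ⟩
    0# ∎))
    where
    same : s + - t ≡ s′ + - t
    same = trans (⁻¹-unique (⁻¹-inverseˡ (just-≢ p≢s)))
                 (trans (cong _⁻¹ e) (sym (⁻¹-unique (⁻¹-inverseˡ (just-≢ p≢s′)))))

  module _ {h k : Carrier} (hk≡1 : h * k ≡ 1#) where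

    powers³ : h * h * h * (k * k * k) ≡ 1#
    powers³ = trans (solve 2 (λ h k → h :* h :* h :* (k :* k :* k) := h :* k :* (h :* k) :* (h :* k)) refl h k)
      (trans (cong (λ x → x * x * x) hk≡1) (solve 0 (:1 :* :1 :* :1 := :1) refl))

    powers² : h * h * h * (k * k) ≡ h
    powers² = trans (solve 2 (λ h k → h :* h :* h :* (k :* k) := h :* k :* (h :* k) :* h) refl h k)
      (trans (cong (λ x → x * x * h) hk≡1) (solve 1 (λ h → :1 :* :1 :* h := h) refl h))

    powers¹ : h * h * h * k ≡ h * h
    powers¹ = trans (solve 2 (λ h k → h :* h :* h :* k := h :* k :* (h :* h)) refl h k)
      (trans (cong (λ x → x * (h * h)) hk≡1) (*-identityˡ _))

  point-self : ∀ p → cubicPt p ≡ fromFrame p (cubicPt nothing)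
  point-self nothing  = refl
  point-self (just t) = vec≡
    (solve 1 (λ t → t :* t :* t := t :* t :* t :* :1 :+ :3 :* t :* t :* :0 :+ :3 :* t :* :0 :+ :0) refl t)
    (solve 1 (λ t → t :* t := t :* t :* :1 :+ :2 :* t :* :0 :+ :0) refl t)
    (solve 1 (λ t → t := t :* :1 :+ :0) refl t)
    refl

  tangent-self : ∀ p → tangentDir p ≡ fromFrame p (tangentDir nothing)
  tangent-self nothing  = refl
  tangent-self (just t) = vec≡
    (solve 1 (λ t → :3 :* t :* t := t :* t :* t :* :0 :+ :3 :* t :* t :* :1 :+ :3 :* t :* :0 :+ :0) refl t)
    (solve 1 (λ t → :2 :* t := t :* t :* :0 :+ :2 :* t :* :1 :+ :0) refl t)
    (solve 1 (λ t → :1 := t :* :0 :+ :1) refl t)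
    refl

  osculating-self : ∀ p → planeIn p (oscPlane p) ≡ oscPlane nothing
  osculating-self nothing  = refl
  osculating-self (just t) = vec≡
    (solve 1 (λ t → :1 :* (t :* t :* t) :+ :- (:3 :* t) :* (t :* t) :+ :3 :* t :* t :* t :+ :- (t :* t :* t) := :0) refl t)
    (solve 1 (λ t → :1 :* (:3 :* t :* t) :+ :- (:3 :* t) :* (:2 :* t) :+ :3 :* t :* t := :0) refl t)
    (solve 1 (λ t → :1 :* (:3 :* t) :+ :- (:3 :* t) := :0) refl t)
    refl

  point-chart : ∀ {p s} → p ≢ s → ∃ λ a → a ≢ 0# × cubicPt s ≡ fromFrame p (scale a (cubicPt (just (chart p s))))
  point-chart {nothing} {nothing} p≢s = contradiction refl p≢s
  point-chart {nothing} {just s}  p≢s = 1# , 1≢0 , sym (scale-1 _)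
  point-chart {just t}  {nothing} p≢s = 1# , 1≢0 , trans ∞-image (cong (fromFrame (just t)) (sym (scale-1 _)))
    where
    ∞-image : cubicPt nothing ≡ fromFrame (just t) (cubicPt (just 0#))
    ∞-image = vec≡
      (solve 1 (λ t → :1 := t :* t :* t :* (:0 :* :0 :* :0) :+ :3 :* t :* t :* (:0 :* :0) :+ :3 :* t :* :0 :+ :1) refl t)
      (solve 1 (λ t → :0 := t :* t :* (:0 :* :0 :* :0) :+ :2 :* t :* (:0 :* :0) :+ :0) refl t)
      (solve 1 (λ t → :0 := t :* (:0 :* :0 :* :0) :+ (:0 :* :0)) refl t)
      (solve 0 (:0 := :0 :* :0 :* :0) refl)
  -- The scalar h³ clears the denominators of (k³, k², k, 1), k = 1/h, and leaves (1, h, h², h³),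
  -- the expansion of P(s) around t with h = s - t.
  point-chart {just t}  {just s}  p≢s = h * h * h , *-nonzero (*-nonzero h≢0 h≢0) h≢0
    , trans shifted (cong (fromFrame (just t)) (sym (vec≡ (powers³ hk≡1) (powers² hk≡1) (powers¹ hk≡1) (*-identityʳ _))))
    where
    h = s + - t
    h≢0 : h ≢ 0#
    h≢0 = just-≢ p≢s
    hk≡1 : h * h ⁻¹ ≡ 1#
    hk≡1 = ⁻¹-inverse h h≢0
    shifted : cubicPt (just s) ≡ fromFrame (just t) ⟨ 1# , h , h * h , h * h * h ⟩
    shifted = vec≡
      (solve 2 (λ s t → s :* s :* s := t :* t :* t :* :1 :+ :3 :* t :* t :* (s :+ :- t)
        :+ :3 :* t :* ((s :+ :- t) :* (s :+ :- t)) :+ (s :+ :- t) :* (s :+ :- t) :* (s :+ :- t)) refl s t)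
      (solve 2 (λ s t → s :* s := t :* t :* :1 :+ :2 :* t :* (s :+ :- t) :+ (s :+ :- t) :* (s :+ :- t)) refl s t)
      (solve 2 (λ s t → s := t :* :1 :+ (s :+ :- t)) refl s t)
      refl

  -- Only the tangent line is projectively invariant; its chosen direction vector may pick up a
  -- multiple of the point, which is why a second coefficient appears.
  tangent-chart : ∀ {p s} → p ≢ s → ∃₂ λ a b → a ≢ 0# ×
    tangentDir s ≡ fromFrame p (comb a (tangentDir (just (chart p s))) b (cubicPt (just (chart p s))))
  tangent-chart {nothing} {nothing} p≢s = contradiction refl p≢s
  tangent-chart {nothing} {just s}  p≢s = 1# , 0# , 1≢0 , comb-1-0 _ _
  -- The frame sends (0, 0, 1, 0) to (3t, 1, 0, 0) and (0, 0, 0, 1) to P(∞); the coefficient -3t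
  -- removes the surplus.
  tangent-chart {just t}  {nothing} p≢s = 1# , - (3# * t) , 1≢0 , vec≡
      (solve 1 (λ t → :0 := t :* t :* t :* (:1 :* (:3 :* :0 :* :0) :+ :- (:3 :* t) :* (:0 :* :0 :* :0))
        :+ :3 :* t :* t :* (:1 :* (:2 :* :0) :+ :- (:3 :* t) :* (:0 :* :0))
        :+ :3 :* t :* (:1 :* :1 :+ :- (:3 :* t) :* :0) :+ (:1 :* :0 :+ :- (:3 :* t) :* :1)) refl t)
      (solve 1 (λ t → :1 := t :* t :* (:1 :* (:3 :* :0 :* :0) :+ :- (:3 :* t) :* (:0 :* :0 :* :0))
        :+ :2 :* t :* (:1 :* (:2 :* :0) :+ :- (:3 :* t) :* (:0 :* :0))
        :+ (:1 :* :1 :+ :- (:3 :* t) :* :0)) refl t)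
      (solve 1 (λ t → :0 := t :* (:1 :* (:3 :* :0 :* :0) :+ :- (:3 :* t) :* (:0 :* :0 :* :0))
        :+ (:1 :* (:2 :* :0) :+ :- (:3 :* t) :* (:0 :* :0))) refl t)
      (solve 1 (λ t → :0 := :1 :* (:3 :* :0 :* :0) :+ :- (:3 :* t) :* (:0 :* :0 :* :0)) refl t)
  -- Chain rule for P(s) = h³ F(k), where F(k) is the frame image of (k³, k², k, 1): since k = 1/h
  -- has derivative -k², the two coefficients are -h³k² = -h and 3h² = 3kh³.
  tangent-chart {just t}  {just s}  p≢s = - h , 3# * k * (h * h * h) , -‿nonzero h≢0
    , trans shifted (cong (fromFrame (just t)) (sym (vec≡ e0 e1 e2 e3)))
    where
    h = s + - t
    k = h ⁻¹
    h≢0 : h ≢ 0#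
    h≢0 = just-≢ p≢s
    hk≡1 : h * k ≡ 1#
    hk≡1 = ⁻¹-inverse h h≢0
    e0 : - h * (3# * k * k) + 3# * k * (h * h * h) * (k * k * k) ≡ 0#
    e0 = trans (solve 2 (λ h k → :- h :* (:3 :* k :* k) :+ :3 :* k :* (h :* h :* h) :* (k :* k :* k)
           := :3 :* k :* (h :* h :* h :* (k :* k :* k) :+ :- (h :* k))) refl h k)
         (trans (cong₂ (λ x y → 3# * k * (x + - y)) (powers³ hk≡1) hk≡1)
           (solve 1 (λ k → :3 :* k :* (:1 :+ :- :1) := :0) refl k))
    e1 : - h * (2# * k) + 3# * k * (h * h * h) * (k * k) ≡ 1#
    e1 = trans (solve 2 (λ h k → :- h :* (:2 :* k) :+ :3 :* k :* (h :* h :* h) :* (k :* k)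
           := :3 :* (h :* h :* h :* (k :* k :* k)) :+ :- (:2 :* (h :* k))) refl h k)
         (trans (cong₂ (λ x y → 3# * x + - (2# * y)) (powers³ hk≡1) hk≡1)
           (solve 0 (:3 :* :1 :+ :- (:2 :* :1) := :1) refl))
    e2 : - h * 1# + 3# * k * (h * h * h) * k ≡ 2# * h
    e2 = trans (solve 2 (λ h k → :- h :* :1 :+ :3 :* k :* (h :* h :* h) :* k
           := :- h :+ :3 :* (h :* h :* h :* (k :* k))) refl h k)
         (trans (cong (λ x → - h + 3# * x) (powers² hk≡1))
           (solve 1 (λ h → :- h :+ :3 :* h := :2 :* h) refl h))
    e3 : - h * 0# + 3# * k * (h * h * h) * 1# ≡ 3# * (h * h)
    e3 = trans (solve 2 (λ h k → :- h :* :0 :+ :3 :* k :* (h :* h :* h) :* :1 := :3 :* (h :* h :* h :* k)) refl h k)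
         (cong (3# *_) (powers¹ hk≡1))
    shifted : tangentDir (just s) ≡ fromFrame (just t) ⟨ 0# , 1# , 2# * h , 3# * (h * h) ⟩
    shifted = vec≡
      (solve 2 (λ s t → :3 :* s :* s := t :* t :* t :* :0 :+ :3 :* t :* t :* :1
        :+ :3 :* t :* (:2 :* (s :+ :- t)) :+ :3 :* ((s :+ :- t) :* (s :+ :- t))) refl s t)
      (solve 2 (λ s t → :2 :* s := t :* t :* :0 :+ :2 :* t :* :1 :+ :2 :* (s :+ :- t)) refl s t)
      (solve 1 (λ t → :1 := t :* :0 :+ :1) refl t)
      refl

  osculating-chart : ∀ {p s} → p ≢ s → ∃ λ a → a ≢ 0# × planeIn p (oscPlane s) ≡ scale a (oscPlane (just (chart p s)))
  osculating-chart {nothing} {nothing} p≢s = contradiction refl p≢s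
  osculating-chart {nothing} {just s}  p≢s = 1# , 1≢0 , sym (scale-1 _)
  osculating-chart {just t}  {nothing} p≢s = 1# , 1≢0 , vec≡
    (solve 1 (λ t → :0 :* (t :* t :* t) :+ :0 :* (t :* t) :+ :0 :* t :+ :1 := :1 :* :1) refl t)
    (solve 1 (λ t → :0 :* (:3 :* t :* t) :+ :0 :* (:2 :* t) :+ :0 := :1 :* (:- (:3 :* :0))) refl t)
    (solve 1 (λ t → :0 :* (:3 :* t) :+ :0 := :1 :* (:3 :* :0 :* :0)) refl t)
    (solve 0 (:0 := :1 :* (:- (:0 :* :0 :* :0))) refl)
  -- Expanding (x - s)³ around t gives (-h³, 3h², -3h, 1), which is -h³ times the Γ-plane at k =
  -- 1/h.
  osculating-chart {just t}  {just s}  p≢s = - (h * h * h) , -‿nonzero (*-nonzero (*-nonzero h≢0 h≢0) h≢0)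
    , trans shifted (sym (vec≡ (solve 1 (λ x → :- x :* :1 := :- x) refl (h * h * h)) e1 e2 e3))
    where
    h = s + - t
    k = h ⁻¹
    h≢0 : h ≢ 0#
    h≢0 = just-≢ p≢s
    hk≡1 : h * k ≡ 1#
    hk≡1 = ⁻¹-inverse h h≢0
    e1 : - (h * h * h) * - (3# * k) ≡ 3# * (h * h)
    e1 = trans (solve 2 (λ h k → :- (h :* h :* h) :* :- (:3 :* k) := :3 :* (h :* h :* h :* k)) refl h k)
         (cong (3# *_) (powers¹ hk≡1))
    e2 : - (h * h * h) * (3# * k * k) ≡ - (3# * h)
    e2 = trans (solve 2 (λ h k → :- (h :* h :* h) :* (:3 :* k :* k) := :- (:3 :* (h :* h :* h :* (k :* k)))) refl h k)
         (cong (λ x → - (3# * x)) (powers² hk≡1))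
    e3 : - (h * h * h) * - (k * k * k) ≡ 1#
    e3 = trans (solve 2 (λ h k → :- (h :* h :* h) :* :- (k :* k :* k) := h :* h :* h :* (k :* k :* k)) refl h k)
         (powers³ hk≡1)
    shifted : planeIn (just t) (oscPlane (just s)) ≡ ⟨ - (h * h * h) , 3# * (h * h) , - (3# * h) , 1# ⟩
    shifted = vec≡
      (solve 2 (λ s t → :1 :* (t :* t :* t) :+ :- (:3 :* s) :* (t :* t) :+ :3 :* s :* s :* t :+ :- (s :* s :* s)
        := :- ((s :+ :- t) :* (s :+ :- t) :* (s :+ :- t))) refl s t)
      (solve 2 (λ s t → :1 :* (:3 :* t :* t) :+ :- (:3 :* s) :* (:2 :* t) :+ :3 :* s :* s
        := :3 :* ((s :+ :- t) :* (s :+ :- t))) refl s t)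
      (solve 2 (λ s t → :1 :* (:3 :* t) :+ :- (:3 :* s) := :- (:3 :* (s :+ :- t))) refl s t)
      refl

-- Planes as polynomials: roots, tangency and the number of points on the cubic.

module Planes (𝔽 : FiniteField) where
  open FiniteField 𝔽
  open Geometry 𝔽
  open V4
  open Booleans
  open Counting
  open Frames 𝔽 public
  open Solver using (solve; _:+_; _:*_; :-_; _:=_)
  open ≡-Reasoning

  infix 4 _≟ᴾ_
  _≟ᴾ_ : DecidableEquality Param
  _≟ᴾ_ = ≡-dec _≟_

  params-complete : ∀ p → p ∈ params
  params-complete nothing  = here refl
  params-complete (just t) = there (∈-map⁺ just (complete t))

  params-unique : Unique params
  params-unique = All.tabulate (λ { p∈ refl → case-nothing (∈-map⁻ just p∈) }) ∷ Unique.map⁺ just-injective unique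
    where
    case-nothing : ¬ (∃ λ t → t ∈ elements × nothing ≡ just t)
    case-nothing (_ , _ , ())

  allV4-complete : ∀ v → v ∈ allV4
  allV4-complete ⟨ a , b , c , d ⟩ =
    ∈-concatMap⁺ _ (lose (complete a) (∈-concatMap⁺ _ (lose (complete b) (∈-concatMap⁺ _ (lose (complete c)
      (∈-map⁺ _ (complete d)))))))

  allPlanes-transversal : Transversal _∝_ (T ∘ nonzero) allPlanes
  allPlanes-transversal = record
    { sound = λ π∈ → proj₂ (∈-filterᵇ⁻ nonzero {xs = allV4} (sound π∈))
    ; apart = apart
    ; cover = λ {π} nz → cover (∈-filterᵇ⁺ nonzero (allV4-complete π) nz)
    }
    where open Transversal (deduplicate-transversal proportional ∝-isEquivalence (filterᵇ nonzero allV4))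

  allLines-transversal : Transversal _≈_ (T ∘ isLine) allLines
  allLines-transversal = record
    { sound = λ L∈ → proj₂ (∈-filterᵇ⁻ isLine {xs = allPairs} (sound L∈))
    ; apart = apart
    ; cover = λ { {u , v} l → cover (∈-filterᵇ⁺ isLine
        (∈-concatMap⁺ _ (lose (allV4-complete u) (∈-map⁺ _ (allV4-complete v)))) l) }
    }
    where open Transversal (deduplicate-transversal sameLine ≈-isEquivalence (filterᵇ isLine allPairs))

  -- The second tests only the direction vector; the plane contains the tangent when both hold.
  Root Tangential : V4 → Param → Set
  Root       π s = dot π (cubicPt s) ≡ 0#
  Tangential π s = dot π (tangentDir s) ≡ 0#

  dot-e₀ : ∀ π → dot π (cubicPt nothing) ≡ c0 π
  dot-e₀ π = solve 4 (λ a b c d → a :* :1 :+ b :* :0 :+ c :* :0 :+ d :* :0 := a) refl (c0 π) (c1 π) (c2 π) (c3 π)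

  dot-e₁ : ∀ π → dot π (tangentDir nothing) ≡ c1 π
  dot-e₁ π = solve 4 (λ a b c d → a :* :0 :+ b :* :1 :+ c :* :0 :+ d :* :0 := b) refl (c0 π) (c1 π) (c2 π) (c3 π)

  dot-self : ∀ π p → dot π (cubicPt p) ≡ c0 (planeIn p π)
  dot-self π p = trans (cong (dot π) (point-self p)) (trans (sym (dot-planeIn p π _)) (dot-e₀ _))

  dot-tangent-self : ∀ π p → dot π (tangentDir p) ≡ c1 (planeIn p π)
  dot-tangent-self π p = trans (cong (dot π) (tangent-self p)) (trans (sym (dot-planeIn p π _)) (dot-e₁ _))

  module _ {π : V4} {p s : Param} (p≢s : p ≢ s) where
    private
      k = chart p s
      σ = planeIn p π

    dot-chart : ∃ λ a → a ≢ 0# × dot π (cubicPt s) ≡ a * dot σ (cubicPt (just k))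
    dot-chart = let a , a≢0 , e = point-chart p≢s in a , a≢0 ,
      trans (cong (dot π) e) (trans (sym (dot-planeIn p π _)) (dot-scaleʳ a σ _))

    root-chart⁻ : Root π s → dot σ (cubicPt (just k)) ≡ 0#
    root-chart⁻ root = let a , a≢0 , e = dot-chart in cancel a≢0 (trans (sym e) root)

    root-chart⁺ : dot σ (cubicPt (just k)) ≡ 0# → Root π s
    root-chart⁺ root = let a , a≢0 , e = dot-chart in trans e (*-zeroʳ root)

    -- At a root the component along the point, left over by `tangent-chart`, evaluates to zero.
    dot-tangent-chart : Root π s → ∃ λ a → a ≢ 0# × dot π (tangentDir s) ≡ a * dot σ (tangentDir (just k))
    dot-tangent-chart root = let a , b , a≢0 , e = tangent-chart p≢s in a , a≢0 , (begin
      dot π (tangentDir s)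
        ≡⟨ trans (cong (dot π) e) (sym (dot-planeIn p π _)) ⟩
      dot σ (comb a (tangentDir (just k)) b (cubicPt (just k)))
        ≡⟨ dot-comb σ a _ b _ ⟩
      a * dot σ (tangentDir (just k)) + b * dot σ (cubicPt (just k))
        ≡⟨ cong (λ x → a * dot σ (tangentDir (just k)) + b * x) (root-chart⁻ root) ⟩
      a * dot σ (tangentDir (just k)) + b * 0#
        ≡⟨ solve 2 (λ x b → x :+ b :* :0 := x) refl (a * dot σ (tangentDir (just k))) b ⟩
      a * dot σ (tangentDir (just k)) ∎)

  osculating-root : ∀ p → Root (oscPlane p) p
  osculating-root p = trans (dot-self (oscPlane p) p) (cong c0 (osculating-self p))

  -- In the frame at any other point the Γ-plane is a multiple of (κ - k)³, whose leading
  -- coefficient does not vanish.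
  osculating-root-unique : ∀ {p s} → Root (oscPlane s) p → p ≡ s
  osculating-root-unique {p} {s} root with p ≟ᴾ s
  ... | yes p≡s = p≡s
  ... | no  p≢s = let a , a≢0 , e = osculating-chart p≢s in
    contradiction (trans (sym (trans (dot-self (oscPlane s) p) (cong c0 e))) root) (*-nonzero a≢0 1≢0)

  root-∝ : ∀ {π ρ s} → π ∝ ρ → Root ρ s → Root π s
  root-∝ {π} {ρ} {s} π∝ρ root with ∝⁻ π∝ρ
  ... | a , _ , refl = trans (dot-scaleˡ a ρ (cubicPt s)) (*-zeroʳ root)

  module _ (π : V4) where

    roots : List Param
    roots = filterᵇ (λ t → onPlane π (cubicPt t)) params

    roots-unique : Unique roots
    roots-unique = Unique.filter⁺ (λ t → T? (onPlane π (cubicPt t))) params-unique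

    ∈-roots⁻ : ∀ {s} → s ∈ roots → Root π s
    ∈-roots⁻ s∈ = ==⁻ (proj₂ (∈-filterᵇ⁻ (λ t → onPlane π (cubicPt t)) {xs = params} s∈))

    ∈-roots⁺ : ∀ {s} → Root π s → s ∈ roots
    ∈-roots⁺ {s} root = ∈-filterᵇ⁺ (λ t → onPlane π (cubicPt t)) (params-complete s) (==⁺ root)

  nCPlane-length : ∀ {π rs} → Unique rs → (∀ {s} → s ∈ rs → Root π s) → (∀ {s} → Root π s → s ∈ rs) →
    nCPlane π ≡ length rs
  nCPlane-length {π} unique-rs into onto = count-satisfying params-complete params-unique
    (λ t → onPlane π (cubicPt t)) unique-rs (==⁺ ∘ into) (onto ∘ ==⁻)

  isΓPlane⁻ : ∀ {π} → T (isΓPlane π) → ∃ λ t → π ∝ oscPlane t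
  isΓPlane⁻ {π} e = any-elim (λ t → proportional π (oscPlane t)) params e

  isΓPlane⁺ : ∀ {π t} → π ∝ oscPlane t → T (isΓPlane π)
  isΓPlane⁺ {π} {t} e = any-intro (λ t → proportional π (oscPlane t)) (params-complete t) e

  Γ-nCPlane : ∀ {π t} → π ∝ oscPlane t → nCPlane π ≡ 1
  Γ-nCPlane {π} {t} π∝Γ = nCPlane-length {rs = t ∷ []} ([] ∷ [])
    (λ { (here refl) → root-∝ {π} {oscPlane t} {t} π∝Γ (osculating-root t) })
    (λ {s} root → here (osculating-root-unique {s} {t} (root-∝ {oscPlane t} {π} {s} (∝.sym {π} {oscPlane t} π∝Γ) root)))

  -- In the frame at a root, a plane other than the Γ-plane is the linear form κ − r if the root is
  -- multiple, and otherwise a quadratic, which is (κ − r)(κ − r′) as soon as it has a root r.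
  linear : Carrier → V4
  linear r = ⟨ 0# , 0# , 1# , - r ⟩

  split : Carrier → Carrier → V4
  split r r′ = ⟨ 0# , 1# , - (r + r′) , r * r′ ⟩

  linear-value : ∀ r k → dot (linear r) (cubicPt (just k)) ≡ k + - r
  linear-value = solve 2 (λ r k → :0 :* (k :* k :* k) :+ :0 :* (k :* k) :+ :1 :* k :+ :- r :* :1 := k :+ :- r) refl

  -- Slope 1 means that the root of a linear form is simple: the second point of such a plane is not
  -- a point of tangency.
  linear-slope : ∀ r k → dot (linear r) (tangentDir (just k)) ≡ 1#
  linear-slope = solve 2 (λ r k → :0 :* (:3 :* k :* k) :+ :0 :* (:2 :* k) :+ :1 :* :1 :+ :- r :* :0 := :1) refl

  split-value : ∀ r r′ k → dot (split r r′) (cubicPt (just k)) ≡ (k + - r) * (k + - r′)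
  split-value = solve 3 (λ r r′ k → :0 :* (k :* k :* k) :+ :1 :* (k :* k) :+ :- (r :+ r′) :* k :+ r :* r′ :* :1
    := (k :+ :- r) :* (k :+ :- r′)) refl

  -- At one root the slope is the difference to the other root, so it vanishes when the two
  -- coincide.
  split-slope : ∀ r k → dot (split r k) (tangentDir (just k)) ≡ k + - r
  split-slope = solve 2 (λ r k → :0 :* (:3 :* k :* k) :+ :1 :* (:2 :* k) :+ :- (r :+ k) :* :1 :+ r :* k :* :0
    := k :+ :- r) refl

  module _ {π : V4} {p : Param} {a : Carrier} {σ : V4} (frame : planeIn p π ≡ scale a σ) (a≢0 : a ≢ 0#) where

    root-scaled⁺ : ∀ {s} → p ≢ s → dot σ (cubicPt (just (chart p s))) ≡ 0# → Root π s
    root-scaled⁺ {s} p≢s e = root-chart⁺ {π} p≢s (trans (cong (λ ρ → dot ρ _) frame)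
      (trans (dot-scaleˡ a σ _) (*-zeroʳ e)))

    root-scaled⁻ : ∀ {s} → p ≢ s → Root π s → dot σ (cubicPt (just (chart p s))) ≡ 0#
    root-scaled⁻ {s} p≢s root = cancel a≢0 (trans (sym (dot-scaleˡ a σ _))
      (trans (cong (λ ρ → dot ρ _) (sym frame)) (root-chart⁻ {π} p≢s root)))

    slope-scaled : ∀ {s} → p ≢ s → Root π s → ∃ λ b → b ≢ 0# ×
      dot π (tangentDir s) ≡ b * dot σ (tangentDir (just (chart p s)))
    slope-scaled {s} p≢s root = let b , b≢0 , e = dot-tangent-chart {π} p≢s root in
      b * a , *-nonzero b≢0 a≢0 , trans e (trans (cong (λ ρ → b * dot ρ _) frame)
        (trans (cong (b *_) (dot-scaleˡ a σ _)) (sym (*-assoc b a _))))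

  unchart-chart : ∀ {p s} → p ≢ s → unchart p (chart p s) ≡ s
  unchart-chart {p} {s} p≢s = chart-injective p (unchart-≢ p _) p≢s (chart-unchart p _)

  root-unchart : ∀ {π p a σ k} → planeIn p π ≡ scale a σ → a ≢ 0# → dot σ (cubicPt (just k)) ≡ 0# → Root π (unchart p k)
  root-unchart {π} {p} {σ = σ} {k} frame a≢0 e = root-scaled⁺ {π} {p} {σ = σ} frame a≢0 {unchart p k} (unchart-≢ p k)
    (subst (λ k → dot σ (cubicPt (just k)) ≡ 0#) (sym (chart-unchart p k)) e)

  frame-root : ∀ {π p} → c0 (planeIn p π) ≡ 0# → Root π p
  frame-root {π} {p} e = trans (dot-self π p) e

  -- Only C κ + D is left; C = 0 leaves a constant, which is the Γ-plane at P(p).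
  linear-frame : ∀ {π p} → π ≢ zeroV → Root π p → Tangential π p →
    π ∝ oscPlane p ⊎ ∃₂ λ a r → a ≢ 0# × planeIn p π ≡ scale a (linear r)
  linear-frame {π} {p} π≢0 root tangential with c2 (planeIn p π) ≟ 0#
  ... | yes c≡0 = inj₁ (∝⁺ d d≢0 (planeIn-∝ p (trans σ≡ (cong (scale d) (sym (osculating-self p))))))
    where
    d = c3 (planeIn p π)
    a≡0 : c0 (planeIn p π) ≡ 0#
    a≡0 = trans (sym (dot-self π p)) root
    b≡0 : c1 (planeIn p π) ≡ 0#
    b≡0 = trans (sym (dot-tangent-self π p)) tangential
    σ≡ : planeIn p π ≡ scale d (oscPlane nothing)
    σ≡ = vec≡ (trans a≡0 (sym (zeroʳ d))) (trans b≡0 (sym (zeroʳ d))) (trans c≡0 (sym (zeroʳ d))) (sym (*-identityʳ d))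
    d≢0 : d ≢ 0#
    d≢0 d≡0 = planeIn-nonzero p π≢0 (vec≡ a≡0 b≡0 c≡0 d≡0)
  -- The root of C κ + D is -D/C.
  ... | no c≢0 = inj₂ (c , - (c ⁻¹ * d) , c≢0 , vec≡
      (trans (trans (sym (dot-self π p)) root) (sym (zeroʳ c)))
      (trans (trans (sym (dot-tangent-self π p)) tangential) (sym (zeroʳ c)))
      (sym (*-identityʳ c))
      (sym (begin
        c * - - (c ⁻¹ * d) ≡⟨ solve 3 (λ c z d → c :* (:- (:- (z :* d))) := c :* z :* d) refl c (c ⁻¹) d ⟩
        c * c ⁻¹ * d ≡⟨ cong (_* d) (⁻¹-inverse c c≢0) ⟩
        1# * d ≡⟨ *-identityˡ d ⟩
        d ∎)))
    where
    c = c2 (planeIn p π)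
    d = c3 (planeIn p π)

  quadratic-frame : ∀ {π p} → Root π p → ¬ Tangential π p → ∃₂ λ a y → ∃ λ d → a ≢ 0# ×
    planeIn p π ≡ scale a ⟨ 0# , 1# , y , d ⟩
  quadratic-frame {π} {p} root ¬tangential = b , b ⁻¹ * c2 σ , b ⁻¹ * c3 σ , b≢0 , vec≡
    (trans (trans (sym (dot-self π p)) root) (sym (zeroʳ b))) (sym (*-identityʳ b)) (divided (c2 σ)) (divided (c3 σ))
    where
    σ = planeIn p π
    b = c1 σ
    b≢0 : b ≢ 0#
    b≢0 = ¬tangential ∘ trans (dot-tangent-self π p)
    divided : ∀ x → x ≡ b * (b ⁻¹ * x)
    divided x = sym (trans (sym (*-assoc b (b ⁻¹) x)) (trans (cong (_* x) (⁻¹-inverse b b≢0)) (*-identityˡ x)))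

  split-frame : ∀ {π p s} → Root π p → ¬ Tangential π p → p ≢ s → Root π s →
    ∃₂ λ a r′ → a ≢ 0# × planeIn p π ≡ scale a (split (chart p s) r′)
  split-frame {π} {p} {s} root ¬tangential p≢s root-s with quadratic-frame {π} {p} root ¬tangential
  ... | a , y , d , a≢0 , e = a , r′ , a≢0 , trans e (cong (scale a) (vec≡ refl refl
      (solve 2 (λ r y → y := :- (r :+ (:- y :+ :- r))) refl r y)
      (difference-zero (trans (solve 3 (λ r y d → d :+ :- (r :* (:- y :+ :- r))
          := :0 :* (r :* r :* r) :+ :1 :* (r :* r) :+ y :* r :+ d :* :1) refl r y d)
        (root-scaled⁻ {π} {p} e a≢0 {s} p≢s root-s)))))
    where
    r = chart p s
    -- Vieta: the sum of the roots fixes the second one; the constant term then matches because r is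
    -- a root.
    r′ = - y + - r

  linear-nCPlane : ∀ {π p a r} → a ≢ 0# → planeIn p π ≡ scale a (linear r) → nCPlane π ≡ 2
  linear-nCPlane {π} {p} {a} {r} a≢0 e = nCPlane-length {rs = p ∷ unchart p r ∷ []}
    ((unchart-≢ p r ∷ []) ∷ ([] ∷ []))
    (λ { (here refl) → frame-root {π} {p} (trans (cong c0 e) (zeroʳ a))
       ; (there (here refl)) → root-unchart {π} {p} {a} {linear r} {r} e a≢0 (trans (linear-value r r) (-‿inverseʳ r)) })
    onto
    where
    onto : ∀ {s} → Root π s → s ∈ p ∷ unchart p r ∷ []
    onto {s} root with p ≟ᴾ s
    ... | yes p≡s = here (sym p≡s)
    ... | no  p≢s = there (here (trans (sym (unchart-chart p≢s)) (cong (unchart p)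
      (difference-zero (trans (sym (linear-value r _)) (root-scaled⁻ {π} {p} e a≢0 {s} p≢s root))))))

  -- No assumption that the two roots differ, so the bound serves the planes with two points as well
  -- as those with three.
  split-roots : ∀ {π p a r r′} → a ≢ 0# → planeIn p π ≡ scale a (split r r′) →
    ∀ {s} → Root π s → s ∈ p ∷ unchart p r ∷ unchart p r′ ∷ []
  split-roots {π} {p} {a} {r} {r′} a≢0 e {s} root with p ≟ᴾ s | chart p s ≟ r
  ... | yes p≡s | _ = here (sym p≡s)
  ... | no  p≢s | yes k≡r = there (here (trans (sym (unchart-chart p≢s)) (cong (unchart p) k≡r)))
  ... | no  p≢s | no  k≢r = there (there (here (trans (sym (unchart-chart p≢s)) (cong (unchart p)
      (difference-zero (cancel (k≢r ∘ difference-zero)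
        (trans (sym (split-value r r′ _)) (root-scaled⁻ {π} {p} e a≢0 {s} p≢s root))))))))

  split-root₁ : ∀ r r′ → dot (split r r′) (cubicPt (just r)) ≡ 0#
  split-root₁ r r′ = trans (split-value r r′ r) (trans (cong (_* (r + - r′)) (-‿inverseʳ r)) (zeroˡ _))

  split-root₂ : ∀ r r′ → dot (split r r′) (cubicPt (just r′)) ≡ 0#
  split-root₂ r r′ = trans (split-value r r′ r′) (*-zeroʳ (-‿inverseʳ r′))

  unchart-injective : ∀ p {k k′} → unchart p k ≡ unchart p k′ → k ≡ k′
  unchart-injective p {k} {k′} e = trans (sym (chart-unchart p k)) (trans (cong (chart p) e) (chart-unchart p k′))

  split-nCPlane : ∀ {π p a r r′} → a ≢ 0# → planeIn p π ≡ scale a (split r r′) → r ≢ r′ → nCPlane π ≡ 3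
  split-nCPlane {π} {p} {a} {r} {r′} a≢0 e r≢r′ = nCPlane-length {rs = p ∷ unchart p r ∷ unchart p r′ ∷ []}
    ((unchart-≢ p r ∷ unchart-≢ p r′ ∷ []) ∷ ((r≢r′ ∘ unchart-injective p) ∷ []) ∷ [] ∷ [])
    (λ { (here refl) → frame-root {π} {p} (trans (cong c0 e) (zeroʳ a))
       ; (there (here refl)) → root-unchart {π} {p} {a} {split r r′} {r} e a≢0 (split-root₁ r r′)
       ; (there (there (here refl))) → root-unchart {π} {p} {a} {split r r′} {r′} e a≢0 (split-root₂ r r′) })
    (λ {s} → split-roots {π} {p} {a} {r} {r′} a≢0 e {s})

  square-nCPlane : ∀ {π p a r} → a ≢ 0# → planeIn p π ≡ scale a (split r r) → nCPlane π ≡ 2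
  square-nCPlane {π} {p} {a} {r} a≢0 e = nCPlane-length {rs = p ∷ unchart p r ∷ []}
    ((unchart-≢ p r ∷ []) ∷ ([] ∷ []))
    (λ { (here refl) → frame-root {π} {p} (trans (cong c0 e) (zeroʳ a))
       ; (there (here refl)) → root-unchart {π} {p} {a} {split r r} {r} e a≢0 (split-root₁ r r) })
    (λ {s} root → merge (split-roots {π} {p} {a} {r} {r} a≢0 e {s} root))
    where
    merge : ∀ {A : Set} {x y z : A} → x ∈ y ∷ z ∷ z ∷ [] → x ∈ y ∷ z ∷ []
    merge (here e) = here e
    merge (there (here e)) = there (here e)
    merge (there (there (here e))) = there (here e)

  -- Apart from Γ_p, a plane through the tangent at P(p) is a linear form, and its root is the one
  -- further point.
  nonΓ-tangential : ∀ {π p} → π ≢ zeroV → Root π p → Tangential π p → ¬ T (isΓPlane π) → nCPlane π ≡ 2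
  nonΓ-tangential {π} {p} π≢0 root tangential ¬Γ with linear-frame {π} {p} π≢0 root tangential
  ... | inj₁ π∝Γ = contradiction (isΓPlane⁺ {π} {p} π∝Γ) ¬Γ
  ... | inj₂ (a , r , a≢0 , e) = linear-nCPlane {π} {p} {a} {r} a≢0 e

  lone-root : ∀ {π p} → Root π p → (∀ {s} → Root π s → p ≡ s) → nCPlane π ≡ 1
  lone-root {π} {p} root only = nCPlane-length {π} {p ∷ []} ([] ∷ []) (λ { (here refl) → root }) (λ root-s → here (sym (only root-s)))

  simple-nCPlane : ∀ {π p s} → Root π p → ¬ Tangential π p → p ≢ s → Root π s → nCPlane π ≡ 2 ⊎ nCPlane π ≡ 3
  simple-nCPlane {π} {p} {s} root ¬tangential p≢s root-s = cases (chart p s ≟ r′)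
    where
    frame = split-frame {π} {p} {s} root ¬tangential p≢s root-s
    a = proj₁ frame
    r′ = proj₁ (proj₂ frame)
    a≢0 = proj₁ (proj₂ (proj₂ frame))
    e = proj₂ (proj₂ (proj₂ frame))
    cases : Dec (chart p s ≡ r′) → nCPlane π ≡ 2 ⊎ nCPlane π ≡ 3
    cases (yes r≡r′) = inj₁ (square-nCPlane {π} {p} {a} {r′} a≢0 (subst (λ r → planeIn p π ≡ scale a (split r r′)) r≡r′ e))
    cases (no  r≢r′) = inj₂ (split-nCPlane {π} {p} {a} {chart p s} {r′} a≢0 e r≢r′)

  -- Used to sort the planes through a UΓ-line by type. Tangency gives two points, a second root of
  -- a non-tangential plane gives two or three, and otherwise P(p) is alone.
  nonΓ-nCPlane : ∀ {π p} → π ≢ zeroV → Root π p → ¬ T (isΓPlane π) →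
    nCPlane π ≡ 1 ⊎ nCPlane π ≡ 2 ⊎ nCPlane π ≡ 3
  nonΓ-nCPlane {π} {p} π≢0 root ¬Γ = cases (dot π (tangentDir p) ≟ 0#)
    (Any.any? (λ s → ¬? (p ≟ᴾ s) ×-dec (dot π (cubicPt s) ≟ 0#)) params)
    where
    cases : Dec (Tangential π p) → Dec (Any.Any (λ s → p ≢ s × Root π s) params) →
      nCPlane π ≡ 1 ⊎ nCPlane π ≡ 2 ⊎ nCPlane π ≡ 3
    cases (yes tangential) _ = inj₂ (inj₁ (nonΓ-tangential {π} {p} π≢0 root tangential ¬Γ))
    cases (no ¬tangential) (yes other) = let s , p≢s , root-s = Any.satisfied other in
      inj₂ (simple-nCPlane {π} {p} {s} root ¬tangential p≢s root-s)
    cases (no ¬tangential) (no none) = inj₁ (lone-root {π} {p} root (λ {s} root-s →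
      decidable-stable (p ≟ᴾ s) (λ p≢s → none (lose (params-complete s) (p≢s , root-s)))))

  -- The form (κ − d)²(κ − s), seen from both of its points.
  record DoubleSimple (π : V4) (d s : Param) : Set where
    field
      distinct     : d ≢ s
      root-cases   : ∀ {p} → Root π p → p ≡ d ⊎ p ≡ s
      aᵈ aˢ        : Carrier
      aᵈ≢0         : aᵈ ≢ 0#
      aˢ≢0         : aˢ ≢ 0#
      double-frame : planeIn d π ≡ scale aᵈ (linear (chart d s))
      simple-frame : planeIn s π ≡ scale aˢ (split (chart s d) (chart s d))

    root-double : Root π d
    root-double = frame-root {π} {d} (trans (cong c0 double-frame) (zeroʳ aᵈ))

    root-simple : Root π s
    root-simple = frame-root {π} {s} (trans (cong c0 simple-frame) (zeroʳ aˢ))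

    tangential-double : Tangential π d
    tangential-double = trans (dot-tangent-self π d) (trans (cong c1 double-frame) (zeroʳ aᵈ))

    ¬tangential-simple : ¬ Tangential π s
    ¬tangential-simple e = *-nonzero aˢ≢0 1≢0
      (trans (sym (cong c1 simple-frame)) (trans (sym (dot-tangent-self π s)) e))

  module _ {π : V4} {a b : Param} (π≢0 : π ≢ zeroV) (nC : nCPlane π ≡ 2) (a≢b : a ≢ b) (root-a : Root π a) (root-b : Root π b)
           (cases : ∀ {p} → Root π p → p ≡ a ⊎ p ≡ b) where

    -- The quadratic has the root of b; a different second root would be a third point of the plane.
    simple-root : ¬ Tangential π a →
      ∃ λ c → c ≢ 0# × planeIn a π ≡ scale c (split (chart a b) (chart a b))
    simple-root ¬tangential = c , c≢0 , subst (λ r → planeIn a π ≡ scale c (split (chart a b) r)) r′≡r e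
      where
      frame = split-frame {π} {a} {b} root-a ¬tangential a≢b root-b
      c = proj₁ frame
      r′ = proj₁ (proj₂ frame)
      c≢0 = proj₁ (proj₂ (proj₂ frame))
      e = proj₂ (proj₂ (proj₂ frame))
      r′≡r : r′ ≡ chart a b
      r′≡r = sym (decidable-stable (chart a b ≟ r′)
        (λ r≢r′ → 2≢3 (trans (sym nC) (split-nCPlane {π} {a} {c} {chart a b} {r′} c≢0 e r≢r′))))
        where
        2≢3 : 2 ≢ 3
        2≢3 ()

    -- A Γ-plane has one point only, so the form is linear, and its root can only be that of b.
    double-root : Tangential π a → ∃ λ c → c ≢ 0# × planeIn a π ≡ scale c (linear (chart a b))
    double-root tangential = linear-at (linear-frame {π} {a} π≢0 root-a tangential)
      where
      1≢2 : 1 ≢ 2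
      1≢2 ()
      linear-at : (π ∝ oscPlane a ⊎ ∃₂ λ c r → c ≢ 0# × planeIn a π ≡ scale c (linear r)) →
        ∃ λ c → c ≢ 0# × planeIn a π ≡ scale c (linear (chart a b))
      linear-at (inj₁ π∝Γ) = contradiction (trans (sym (Γ-nCPlane {π} {a} π∝Γ)) nC) 1≢2
      linear-at (inj₂ (c , r , c≢0 , e)) = c , c≢0 , subst (λ r → planeIn a π ≡ scale c (linear r))
        (sym (difference-zero (trans (sym (linear-value r (chart a b))) (root-scaled⁻ {π} {a} {c} {linear r} e c≢0 {b} a≢b root-b)))) e

    -- Seen from a simple root the form is a square, which has slope zero at its root. Together with
    -- the converse case below, exactly one of the two points is a point of tangency.
    simple⇒tangential : ¬ Tangential π a → Tangential π b
    simple⇒tangential ¬tangential =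
      let c , c≢0 , e = simple-root ¬tangential
          x , _ , e′ = slope-scaled {π} {a} {c} {split r r} e c≢0 {b} a≢b root-b
      in trans e′ (*-zeroʳ (trans (split-slope r r) (-‿inverseʳ r)))
      where r = chart a b

    double⇒¬tangential : Tangential π a → ¬ Tangential π b
    double⇒¬tangential tangential tangential-b =
      let c , c≢0 , e = double-root tangential
          x , x≢0 , e′ = slope-scaled {π} {a} {c} {linear r} e c≢0 {b} a≢b root-b
      in *-nonzero x≢0 1≢0 (trans (cong (x *_) (sym (linear-slope r r))) (trans (sym e′) tangential-b))
      where r = chart a b

  two-elements : ∀ {A : Set} (xs : List A) → length xs ≡ 2 → Unique xs →
    ∃₂ λ x y → x ≢ y × xs ≡ x ∷ y ∷ []
  two-elements (x ∷ y ∷ []) refl ((x≢y ∷ []) ∷ _) = x , y , x≢y , refl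

  private
    ∈-pair : ∀ {A : Set} {x y z : A} → z ∈ x ∷ y ∷ [] → z ≡ x ⊎ z ≡ y
    ∈-pair (here e) = inj₁ e
    ∈-pair (there (here e)) = inj₂ e

  -- Testing tangency at either one of the two points decides which of them is the double one.
  double-simple : ∀ {π} → π ≢ zeroV → nCPlane π ≡ 2 → ∃₂ (DoubleSimple π)
  double-simple {π} π≢0 nC = result (dot π (tangentDir a) ≟ 0#)
    where
    two = two-elements (roots π) nC (roots-unique π)
    a = proj₁ two
    b = proj₁ (proj₂ two)
    a≢b : a ≢ b
    a≢b = proj₁ (proj₂ (proj₂ two))
    roots≡ : roots π ≡ a ∷ b ∷ []
    roots≡ = proj₂ (proj₂ (proj₂ two))
    root-a : Root π a
    root-a = ∈-roots⁻ π {a} (subst (a ∈_) (sym roots≡) (here refl))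
    root-b : Root π b
    root-b = ∈-roots⁻ π {b} (subst (b ∈_) (sym roots≡) (there (here refl)))
    cases : ∀ {p} → Root π p → p ≡ a ⊎ p ≡ b
    cases {p} root = ∈-pair (subst (p ∈_) roots≡ (∈-roots⁺ π {p} root))
    build : ∀ {d s} → d ≢ s → Root π d → Root π s → (∀ {p} → Root π p → p ≡ d ⊎ p ≡ s) →
            Tangential π d → ¬ Tangential π s → DoubleSimple π d s
    build {d} {s} d≢s root-d root-s cases tangential ¬tangential =
      let aᵈ , aᵈ≢0 , double = double-root {π} {d} {s} π≢0 nC d≢s root-d root-s (λ {p} → cases {p}) tangential
          aˢ , aˢ≢0 , simple = simple-root {π} {s} {d} π≢0 nC (d≢s ∘ sym) root-s root-d (λ {p} root → swap (cases {p} root)) ¬tangential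
      in record { distinct = d≢s ; root-cases = λ {p} → cases {p} ; aᵈ≢0 = aᵈ≢0 ; aˢ≢0 = aˢ≢0
                ; double-frame = double ; simple-frame = simple }
    result : Dec (Tangential π a) → ∃₂ (DoubleSimple π)
    result (yes tangential) = a , b , build {a} {b} a≢b root-a root-b (λ {p} → cases {p}) tangential
      (double⇒¬tangential {π} {a} {b} π≢0 nC a≢b root-a root-b (λ {p} → cases {p}) tangential)
    result (no ¬tangential) = b , a , build {b} {a} (a≢b ∘ sym) root-b root-a (λ {p} root → swap (cases {p} root))
      (simple⇒tangential {π} {a} {b} π≢0 nC a≢b root-a root-b (λ {p} → cases {p}) ¬tangential) ¬tangential

-- Tangents and the parametrisation of UΓ- and UnΓ-lines.

module Lines (𝔽 : FiniteField) where
  open FiniteField 𝔽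
  open Geometry 𝔽
  open V4
  open Booleans
  open Counting
  open Planes 𝔽 public
  open Solver using (solve; _:+_; _:*_; :-_; _:=_)
  open ≡-Reasoning

  _passes_ : Line → Param → Set
  L passes s = cubicPt s ∈ˡ L

  unisecant⁺ : ∀ {L p} → L passes p → (∀ {s} → L passes s → p ≡ s) → T (isUnisecant L)
  unisecant⁺ {L} {p} passes only = ℕ.≡⇒≡ᵇ _ 1 (count-satisfying params-complete params-unique
    (λ t → onLine L (cubicPt t)) {p ∷ []} ([] ∷ []) (λ { (here refl) → onLine⁺ L passes })
    (λ {s} t → here (sym (only {s} (onLine⁻ L t)))))

  one-element : ∀ {A : Set} (xs : List A) → length xs ≡ 1 → ∃ λ x → xs ≡ x ∷ []
  one-element (x ∷ []) refl = x , refl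

  unisecant⁻ : ∀ {L} → T (isUnisecant L) → ∃ λ p → L passes p × (∀ {s} → L passes s → p ≡ s)
  unisecant⁻ {L} t = p
    , onLine⁻ L {cubicPt p} (proj₂ (∈-filterᵇ⁻ (λ t → onLine L (cubicPt t)) {p} {params} (subst (p ∈_) (sym (proj₂ one)) (here refl))))
    , λ {s} passes → only {s} (subst (s ∈_) (proj₂ one)
        (∈-filterᵇ⁺ (λ t → onLine L (cubicPt t)) (params-complete s) (onLine⁺ L passes)))
    where
    one = one-element (filterᵇ (λ t → onLine L (cubicPt t)) params) (ℕ.≡ᵇ⇒≡ (nCLine L) 1 t)
    p = proj₁ one
    only : ∀ {s} → s ∈ p ∷ [] → p ≡ s
    only (here e) = sym e

  external⁺ : ∀ {L} → (∀ s → ¬ L passes s) → T (isExternal L)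
  external⁺ {L} none = ℕ.≡⇒≡ᵇ _ 0 (count-satisfying params-complete params-unique
    (λ t → onLine L (cubicPt t)) {[]} [] (λ ()) (λ {s} t → contradiction (onLine⁻ L t) (none s)))

  external⁻ : ∀ {L} → T (isExternal L) → ∀ s → ¬ L passes s
  external⁻ {L} t s passes = empty (filterᵇ (λ t → onLine L (cubicPt t)) params) (ℕ.≡ᵇ⇒≡ (nCLine L) 0 t)
    (∈-filterᵇ⁺ (λ t → onLine L (cubicPt t)) (params-complete s) (onLine⁺ L passes))
    where
    empty : ∀ (xs : List Param) → length xs ≡ 0 → ¬ s ∈ xs
    empty [] _ ()

  isTangent⁻ : ∀ {L} → T (isTangent L) → ∃ λ t → L ≈ tangentLine t
  isTangent⁻ {L} = any-elim (λ t → sameLine L (tangentLine t)) params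

  isTangent⁺ : ∀ {L} t → L ≈ tangentLine t → T (isTangent L)
  isTangent⁺ {L} t = any-intro (λ t → sameLine L (tangentLine t)) (params-complete t)

  inSomeΓ⁻ : ∀ {L} → T (inSomeΓ L) → ∃ λ t → T (lineInPlane L (oscPlane t))
  inSomeΓ⁻ {L} = any-elim (λ t → lineInPlane L (oscPlane t)) params

  inSomeΓ⁺ : ∀ {L} t → T (lineInPlane L (oscPlane t)) → T (inSomeΓ L)
  inSomeΓ⁺ {L} t = any-intro (λ t → lineInPlane L (oscPlane t)) (params-complete t)

  isRealAxis⁻ : ∀ {L} → T (isRealAxis L) → ∃₂ λ s t → ¬ (oscPlane s ∝ oscPlane t) ×
    T (lineInPlane L (oscPlane s)) × T (lineInPlane L (oscPlane t))
  isRealAxis⁻ {L} e =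
    let s , e′ = any-elim (λ s → any (λ t → pair s t) params) params e
        t , e″ = any-elim (λ t → pair s t) params e′
        distinct , e‴ = ∧⁻ e″
    in s , t , not⁻ distinct , ∧⁻ e‴
    where
    pair = λ s t → not (proportional (oscPlane s) (oscPlane t)) ∧ lineInPlane L (oscPlane s) ∧ lineInPlane L (oscPlane t)

  isRealAxis⁺ : ∀ {L} s t → ¬ (oscPlane s ∝ oscPlane t) →
    T (lineInPlane L (oscPlane s)) → T (lineInPlane L (oscPlane t)) → T (isRealAxis L)
  isRealAxis⁺ {L} s t distinct in-s in-t = any-intro (λ s → any (λ t → pair s t) params) (params-complete s)
    (any-intro (λ t → pair s t) (params-complete t) (∧⁺ (not⁺ distinct) (∧⁺ in-s in-t)))
    where
    pair = λ s t → not (proportional (oscPlane s) (oscPlane t)) ∧ lineInPlane L (oscPlane s) ∧ lineInPlane L (oscPlane t)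

  passes-resp-≈ : ∀ {L M s} → L ≈ M → L passes s → M passes s
  passes-resp-≈ {L} {M} = ∈ˡ-resp-≈ {L} {M}

  inΓ-passes : ∀ {L p s} → T (lineInPlane L (oscPlane p)) → L passes s → s ≡ p
  inΓ-passes {L} {p} {s} L⊂Γ passes = osculating-root-unique {s} {p} (inPlane⁻ {L} {oscPlane p} L⊂Γ passes)

  e₀ e₁ : V4
  e₀ = cubicPt nothing
  e₁ = tangentDir nothing

  tangentLine-frame : ∀ p → tangentLine p ≡ lineFrom p (e₀ , e₁)
  tangentLine-frame p = cong₂ _,_ (point-self p) (tangent-self p)

  -- Projection from e₀: on a line through e₀ the first coordinate is free, so membership is
  -- proportionality of the other three.
  ∈-through⁻ : ∀ {v w} → w ∈ˡ (e₀ , v) → ∃ λ b → c1 w ≡ b * c1 v × c2 w ≡ b * c2 v × c3 w ≡ b * c3 v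
  ∈-through⁻ {v} (a , b , refl) = b , s (c1 v) , s (c2 v) , s (c3 v)
    where
    s : ∀ x → a * 0# + b * x ≡ b * x
    s x = solve 3 (λ a b x → a :* :0 :+ b :* x := b :* x) refl a b x

  ∈-through⁺ : ∀ {v w} b → c1 w ≡ b * c1 v → c2 w ≡ b * c2 v → c3 w ≡ b * c3 v → w ∈ˡ (e₀ , v)
  ∈-through⁺ {v} {w} b e1 e2 e3 = c0 w + - (b * c0 v) , b , vec≡
    (solve 2 (λ x y → x := (x :+ :- y) :* :1 :+ y) refl (c0 w) (b * c0 v))
    (s e1) (s e2) (s e3)
    where
    s : ∀ {x y} → x ≡ b * y → x ≡ (c0 w + - (b * c0 v)) * 0# + b * y
    s {x} {y} e = trans e (solve 3 (λ a b y → b :* y := a :* :0 :+ b :* y) refl (c0 w + - (b * c0 v)) b y)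

  normalise : ∀ {w c} → c ≢ 0# → (e₀ , w) ≈ (e₀ , ⟨ 0# , c * c1 w , c * c2 w , c * c3 w ⟩)
  normalise {w} {c} c≢0 = sameLine⁺ {e₀ , w} {e₀ , v} (∈ˡ-first {e₀} {v})
    (∈-through⁺ {v} {w} (c ⁻¹) (s (c1 w)) (s (c2 w)) (s (c3 w)))
    (∈ˡ-first {e₀} {w}) (∈-through⁺ {w} {v} c refl refl refl)
    where
    v = ⟨ 0# , c * c1 w , c * c2 w , c * c3 w ⟩
    s : ∀ x → x ≡ c ⁻¹ * (c * x)
    s x = sym (trans (sym (*-assoc (c ⁻¹) c x)) (trans (cong (_* x) (⁻¹-inverseˡ c≢0)) (*-identityˡ x)))

  ¬parallel-e₀ : ∀ {w} → T (isLine (e₀ , w)) → ¬ (c1 w ≡ 0# × c2 w ≡ 0# × c3 w ≡ 0#)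
  ¬parallel-e₀ {w} l (z1 , z2 , z3) = proj₂ (isLine⁻ {e₀} {w} l) (c0 w) (vec≡ (sym (*-identityʳ _))
    (trans z1 (sym (zeroʳ _))) (trans z2 (sym (zeroʳ _))) (trans z3 (sym (zeroʳ _))))

  isLine-through : ∀ {w} → ¬ (c1 w ≡ 0# × c2 w ≡ 0# × c3 w ≡ 0#) → T (isLine (e₀ , w))
  isLine-through {w} ¬parallel = isLine⁺ {e₀} {w} (λ e → 1≢0 (cong c0 e))
    (λ a e → ¬parallel (trans (cong c1 e) (zeroʳ a) , trans (cong c2 e) (zeroʳ a) , trans (cong c3 e) (zeroʳ a)))

  dot-Γ∞ : ∀ w → dot (oscPlane nothing) w ≡ c3 w
  dot-Γ∞ w = solve 4 (λ x y z w → :0 :* x :+ :0 :* y :+ :0 :* z :+ :1 :* w := w) refl (c0 w) (c1 w) (c2 w) (c3 w)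

  inΓ-self⁻ : ∀ {p M} → T (lineInPlane (lineFrom p M) (oscPlane p)) → ∀ {w} → w ∈ˡ M → c3 w ≡ 0#
  inΓ-self⁻ {p} {M} e {w} w∈M = trans (sym (dot-Γ∞ w))
    (inPlane⁻ {M} {oscPlane nothing} (subst (λ σ → T (lineInPlane M σ)) (osculating-self p) (lineFrom-inPlane⁻ p {M} {oscPlane p} e)) w∈M)

  inΓ-self⁺ : ∀ {p u v} → c3 u ≡ 0# → c3 v ≡ 0# → T (lineInPlane (lineFrom p (u , v)) (oscPlane p))
  inΓ-self⁺ {p} {u} {v} u3 v3 = lineFrom-inPlane⁺ p {u , v} {oscPlane p} (subst (λ σ → T (lineInPlane (u , v) σ)) (sym (osculating-self p))
    (inPlane⁺ {u , v} {oscPlane nothing} (trans (dot-Γ∞ u) u3) (trans (dot-Γ∞ v) v3)))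

  passes-self⁺ : ∀ {p M} → e₀ ∈ˡ M → lineFrom p M passes p
  passes-self⁺ {p} {M} e = subst (_∈ˡ lineFrom p M) (sym (point-self p)) (fromFrame-∈ˡ p {M} {e₀} e)

  passes-self⁻ : ∀ {p M} → lineFrom p M passes p → e₀ ∈ˡ M
  passes-self⁻ {p} {M} e = ∈ˡ-fromFrame p {M} {e₀} (subst (_∈ˡ lineFrom p M) (point-self p) e)

  ∈ˡ-scale : ∀ {L w} c → w ∈ˡ L → scale c w ∈ˡ L
  ∈ˡ-scale {u , v} c (a , b , refl) = c * a , c * b , vec≡ (s _ _) (s _ _) (s _ _) (s _ _)
    where
    s : ∀ x y → c * (a * x + b * y) ≡ c * a * x + c * b * y
    s x y = solve 5 (λ c a b x y → c :* (a :* x :+ b :* y) := c :* a :* x :+ c :* b :* y) refl c a b x y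

  passes-chart⁻ : ∀ {p M s} → p ≢ s → lineFrom p M passes s → cubicPt (just (chart p s)) ∈ˡ M
  passes-chart⁻ {p} {M} {s} p≢s passes = let a , a≢0 , e = point-chart {p} {s} p≢s in
    subst (_∈ˡ M) (sym (scale-inverse {a} a≢0 refl)) (∈ˡ-scale {M} (a ⁻¹)
      (∈ˡ-fromFrame p {M} (subst (_∈ˡ lineFrom p M) e passes)))

  passes-chart⁺ : ∀ {p M s} → p ≢ s → cubicPt (just (chart p s)) ∈ˡ M → lineFrom p M passes s
  passes-chart⁺ {p} {M} {s} p≢s passes = let a , a≢0 , e = point-chart {p} {s} p≢s in
    subst (_∈ˡ lineFrom p M) (sym e) (fromFrame-∈ˡ p {M} (∈ˡ-scale {M} a passes))

  inΓ-chart⁻ : ∀ {p M s} → p ≢ s → T (lineInPlane (lineFrom p M) (oscPlane s)) →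
    ∀ {w} → w ∈ˡ M → dot (oscPlane (just (chart p s))) w ≡ 0#
  inΓ-chart⁻ {p} {M} {s} p≢s e {w} w∈M = let a , a≢0 , e′ = osculating-chart {p} {s} p≢s in
    cancel a≢0 (trans (sym (dot-scaleˡ a (oscPlane (just (chart p s))) w)) (trans (cong (λ σ → dot σ w) (sym e′))
      (inPlane⁻ {M} {planeIn p (oscPlane s)} (lineFrom-inPlane⁻ p {M} {oscPlane s} e) w∈M)))

  inΓ-chart⁺ : ∀ {p u v s} → p ≢ s → dot (oscPlane (just (chart p s))) u ≡ 0# →
    dot (oscPlane (just (chart p s))) v ≡ 0# → T (lineInPlane (lineFrom p (u , v)) (oscPlane s))
  inΓ-chart⁺ {p} {u} {v} {s} p≢s u0 v0 = lineFrom-inPlane⁺ p {u , v} {oscPlane s}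
    (inPlane⁺ {u , v} {planeIn p (oscPlane s)} (lift u u0) (lift v v0))
    where
    lift : ∀ w → dot (oscPlane (just (chart p s))) w ≡ 0# → dot (planeIn p (oscPlane s)) w ≡ 0#
    lift w w0 = let a , a≢0 , e′ = osculating-chart {p} {s} p≢s in trans (cong (λ σ → dot σ w) e′)
      (trans (dot-scaleˡ a (oscPlane (just (chart p s))) w) (*-zeroʳ w0))

  through-frame : ∀ {L p} → T (isLine L) → L passes p → ∃ λ w → L ≈ lineFrom p (e₀ , w) × T (isLine (e₀ , w))
  through-frame {L} {p} l passes = let w , M≈ , l′ = exchange {M} {e₀} (lineFrom-isLine⁻ p {M} (subst (T ∘ isLine) (sym (lineFrom-lineIn p L)) l))
                                                       (λ e → 1≢0 (cong c0 e))
                                                       (passes-self⁻ {p} {M} (subst (_passes p) (sym (lineFrom-lineIn p L)) passes))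
    in w , subst (_≈ lineFrom p (e₀ , w)) (lineFrom-lineIn p L) (lineFrom-≈⁺ p {M} {e₀ , w} M≈) , l′
    where M = lineIn p L

  normal-form : ∀ {L p w v c} → c ≢ 0# → L ≈ lineFrom p (e₀ , w) → ⟨ 0# , c * c1 w , c * c2 w , c * c3 w ⟩ ≡ v →
    L ≈ lineFrom p (e₀ , v)
  normal-form {L} {p} {w} {v} {c} c≢0 L≈ refl = ≈-trans {L} {lineFrom p (e₀ , w)} {lineFrom p (e₀ , v)} L≈
    (lineFrom-≈⁺ p {e₀ , w} {e₀ , v} (normalise {w} c≢0))

  -- The lines through P(p) in Γ_p other than the tangent, in the frame at P(p).
  uΓDir : Carrier → V4
  uΓDir y = ⟨ 0# , y , 1# , 0# ⟩

  uΓ : Carrier → Line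
  uΓ y = e₀ , uΓDir y

  uΓ-isLine : ∀ p y → T (isLine (lineFrom p (uΓ y)))
  uΓ-isLine p y = lineFrom-isLine⁺ p {uΓ y} (isLine-through (λ (_ , z , _) → 1≢0 z))

  uΓ-inΓ : ∀ p y → T (lineInPlane (lineFrom p (uΓ y)) (oscPlane p))
  uΓ-inΓ p y = inΓ-self⁺ {p} {e₀} {uΓDir y} refl refl

  uΓ-passes : ∀ p y → lineFrom p (uΓ y) passes p
  uΓ-passes p y = passes-self⁺ {p} {uΓ y} (∈ˡ-first {e₀} {uΓDir y})

  uΓ-only : ∀ {p y s} → lineFrom p (uΓ y) passes s → s ≡ p
  uΓ-only {p} {y} = inΓ-passes {lineFrom p (uΓ y)} {p} (uΓ-inΓ p y)

  -- P(p) lies on a line inside Γ_p′, whose only point of the cubic is P(p′); then y is a ratio of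
  -- coordinates that e₀ does not affect.
  uΓ-injective : ∀ {p y p′ y′} → lineFrom p (uΓ y) ≈ lineFrom p′ (uΓ y′) → p ≡ p′ × y ≡ y′
  uΓ-injective {p} {y} {p′} {y′} e = p≡p′ , y≡y′ (subst (λ p′ → lineFrom p (uΓ y) ≈ lineFrom p′ (uΓ y′)) (sym p≡p′) e)
    where
    p≡p′ : p ≡ p′
    p≡p′ = uΓ-only {p′} {y′} (passes-resp-≈ {lineFrom p (uΓ y)} {lineFrom p′ (uΓ y′)} {p} e (uΓ-passes p y))
    y≡y′ : lineFrom p (uΓ y) ≈ lineFrom p (uΓ y′) → y ≡ y′
    y≡y′ e =
      let b , y≡by′ , 1≡b , _ = ∈-through⁻ (∈ˡ-resp-≈ {uΓ y} {uΓ y′} (lineFrom-≈⁻ p {uΓ y} {uΓ y′} e) (∈ˡ-second {e₀} {uΓDir y}))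
      in trans y≡by′ (trans (cong (_* y′) (trans (sym (*-identityʳ b)) (sym 1≡b))) (*-identityˡ y′))

  uΓ-¬tangent : ∀ {p y} → ¬ (lineFrom p (uΓ y) ≈ tangentLine p)
  uΓ-¬tangent {p} {y} e =
    let b , _ , 0≡b1 , _ = ∈-through⁻ (∈ˡ-resp-≈ {uΓ y} {e₀ , e₁} (lineFrom-≈⁻ p {uΓ y} {e₀ , e₁}
          (subst (lineFrom p (uΓ y) ≈_) (tangentLine-frame p) e)) (∈ˡ-second {e₀} {uΓDir y}))
    in 1≢0 (trans 0≡b1 (zeroʳ b))

  tangent-passes : ∀ p → tangentLine p passes p
  tangent-passes p = ∈ˡ-first {cubicPt p} {tangentDir p}

  tangent-inΓ : ∀ p → T (lineInPlane (tangentLine p) (oscPlane p))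
  tangent-inΓ p = subst (λ L → T (lineInPlane L (oscPlane p))) (sym (tangentLine-frame p)) (inΓ-self⁺ {p} {e₀} {e₁} refl refl)

  tangent-isLine : ∀ p → T (isLine (tangentLine p))
  tangent-isLine p = subst (T ∘ isLine) (sym (tangentLine-frame p)) (lineFrom-isLine⁺ p {e₀ , e₁} (isLine-through (λ (z , _) → 1≢0 z)))

  -- The tangent at P(p′) lies in Γ_p′, which meets the cubic only in P(p′).
  tangent-injective : ∀ {p p′} → tangentLine p ≈ tangentLine p′ → p ≡ p′
  tangent-injective {p} {p′} e = inΓ-passes {tangentLine p′} {p′} {p} (tangent-inΓ p′)
    (passes-resp-≈ {tangentLine p} {tangentLine p′} {p} e (tangent-passes p))

  uΓ-unisecant-¬tangent : ∀ {L p y} → L ≈ lineFrom p (uΓ y) → T (isUnisecant L) × T (not (isTangent L))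
  uΓ-unisecant-¬tangent {L} {p} {y} e =
      unisecant⁺ {L} {p} (passes-resp-≈ {M} {L} {p} M≈L (uΓ-passes p y))
        (λ {s} passes → sym (uΓ-only {p} {y} {s} (passes-resp-≈ {L} {M} {s} e passes)))
    , not⁺ (λ t → let s , L≈T = isTangent⁻ {L} t
                      M≈T = ≈-trans {M} {L} {tangentLine s} M≈L L≈T
                      s≡p = uΓ-only {p} {y} {s} (passes-resp-≈ {tangentLine s} {M} {s} (≈-sym {M} {tangentLine s} M≈T) (tangent-passes s))
                  in uΓ-¬tangent {p} {y} (subst (λ s → M ≈ tangentLine s) s≡p M≈T))
    where
    M = lineFrom p (uΓ y)
    M≈L : M ≈ L
    M≈L = ≈-sym {L} {M} e

  isUΓ⁺ : ∀ {L p y} → L ≈ lineFrom p (uΓ y) → T (isUΓ L)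
  isUΓ⁺ {L} {p} {y} e = let unisecant , ¬tangent = uΓ-unisecant-¬tangent {L} {p} {y} e in
    ∧⁺ unisecant (∧⁺ ¬tangent (inSomeΓ⁺ {L} p
      (inPlane-resp-≈˘ {L} {lineFrom p (uΓ y)} {oscPlane p} e (uΓ-inΓ p y))))

  isUΓ⁻ : ∀ {L} → T (isLine L) → T (isUΓ L) → ∃₂ λ p y → L ≈ lineFrom p (uΓ y)
  isUΓ⁻ {L} l e = p , y , normal-form {L} {p} {w} (⁻¹-nonzero w2≢0) L≈
      (vec≡ refl refl (⁻¹-inverseˡ w2≢0) (*-zeroʳ w3≡0))
    where
    parts = ∧⁻ e
    parts₂ = ∧⁻ (proj₂ parts)
    secant = unisecant⁻ {L} (proj₁ parts)
    inside = inSomeΓ⁻ {L} (proj₂ parts₂)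
    p = proj₁ secant
    p≡s : p ≡ proj₁ inside
    p≡s = inΓ-passes {L} {proj₁ inside} {p} (proj₂ inside) (proj₁ (proj₂ secant))
    L⊂Γ : T (lineInPlane L (oscPlane p))
    L⊂Γ = subst (λ s → T (lineInPlane L (oscPlane s))) (sym p≡s) (proj₂ inside)
    frame = through-frame {L} {p} l (proj₁ (proj₂ secant))
    w = proj₁ frame
    L≈ : L ≈ lineFrom p (e₀ , w)
    L≈ = proj₁ (proj₂ frame)
    w3≡0 : c3 w ≡ 0#
    w3≡0 = inΓ-self⁻ {p} {e₀ , w} (inPlane-resp-≈ {L} {lineFrom p (e₀ , w)} {oscPlane p} L≈ L⊂Γ) (∈ˡ-second {e₀} {w})
    w2≢0 : c2 w ≢ 0#
    -- With the last two coordinates zero, the line is spanned by e₀ and e₁ and is the tangent.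
    w2≢0 w2≡0 = not⁻ (proj₁ parts₂) (isTangent⁺ {L} p (subst (L ≈_) (sym (tangentLine-frame p))
      (normal-form {L} {p} {w} (⁻¹-nonzero w1≢0) L≈ (vec≡ refl (⁻¹-inverseˡ w1≢0)
        (*-zeroʳ w2≡0) (*-zeroʳ w3≡0)))))
      where
      w1≢0 : c1 w ≢ 0#
      w1≢0 w1≡0 = ¬parallel-e₀ {w} (proj₂ (proj₂ frame)) (w1≡0 , w2≡0 , w3≡0)
    y = c2 w ⁻¹ * c1 w

  -- The lines through P(p) outside Γ_p; w = 0 gives the chord to the point with chart value z.
  unΓDir : Carrier → Carrier → V4
  unΓDir z w = ⟨ 0# , z * z + w , z , 1# ⟩

  unΓ : Carrier → Carrier → Line
  unΓ z w = e₀ , unΓDir z w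

  unΓ-isLine : ∀ p z w → T (isLine (lineFrom p (unΓ z w)))
  unΓ-isLine p z w = lineFrom-isLine⁺ p {unΓ z w} (isLine-through (λ (_ , _ , z) → 1≢0 z))

  unΓ-passes : ∀ p z w → lineFrom p (unΓ z w) passes p
  unΓ-passes p z w = passes-self⁺ {p} {unΓ z w} (∈ˡ-first {e₀} {unΓDir z w})

  cancel-square : ∀ {z w} → z * z ≡ z * z + w → w ≡ 0#
  cancel-square {z} {w} e = begin
    w ≡⟨ solve 2 (λ z w → w := (z :* z :+ w) :+ :- (z :* z)) refl z w ⟩
    z * z + w + - (z * z) ≡⟨ cong (_+ - (z * z)) (sym e) ⟩
    z * z + - (z * z) ≡⟨ -‿inverseʳ _ ⟩
    0# ∎

  unΓ-coordinates : ∀ {x y z w} → ⟨ 0# , x , y , 1# ⟩ ∈ˡ unΓ z w → x ≡ z * z + w × y ≡ z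
  unΓ-coordinates {x} {y} {z} {w} m =
    let b , e1 , e2 , e3 = ∈-through⁻ {unΓDir z w} {⟨ 0# , x , y , 1# ⟩} m
        b≡1 = trans (sym (*-identityʳ b)) (sym e3)
    in trans e1 (trans (cong (_* (z * z + w)) b≡1) (*-identityˡ _)) , trans e2 (trans (cong (_* z) b≡1) (*-identityˡ z))

  -- A second point, of chart value k, would satisfy (k², k) = (z² + w, z), which forces w = 0.
  unΓ-only : ∀ {p z w s} → w ≢ 0# → lineFrom p (unΓ z w) passes s → p ≡ s
  unΓ-only {p} {z} {w} {s} w≢0 passes = decidable-stable (p ≟ᴾ s) λ p≢s →
    let k = chart p s
        b , e1 , e2 , e3 = ∈-through⁻ {unΓDir z w} (passes-chart⁻ {p} {unΓ z w} {s} p≢s passes)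
        x≡ , y≡ = unΓ-coordinates {k * k} {k} {z} {w} (∈-through⁺ {unΓDir z w} {⟨ 0# , k * k , k , 1# ⟩} b e1 e2 e3)
    in w≢0 (cancel-square {z} (trans (cong (λ z → z * z) (sym y≡)) x≡))

  unΓ-injective : ∀ {p z w p′ z′ w′} → w′ ≢ 0# → lineFrom p (unΓ z w) ≈ lineFrom p′ (unΓ z′ w′) → p ≡ p′ × z ≡ z′ × w ≡ w′
  unΓ-injective {p} {z} {w} {p′} {z′} {w′} w′≢0 e = p≡p′ , coordinates (subst (λ p′ → lineFrom p (unΓ z w) ≈ lineFrom p′ (unΓ z′ w′)) (sym p≡p′) e)
    where
    p≡p′ : p ≡ p′
    p≡p′ = sym (unΓ-only {p′} {z′} {w′} {p} w′≢0 (passes-resp-≈ {lineFrom p (unΓ z w)} {lineFrom p′ (unΓ z′ w′)} {p} e (unΓ-passes p z w)))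
    coordinates : lineFrom p (unΓ z w) ≈ lineFrom p (unΓ z′ w′) → z ≡ z′ × w ≡ w′
    coordinates e =
      let x≡ , y≡ = unΓ-coordinates {z * z + w} {z} {z′} {w′} (∈ˡ-resp-≈ {unΓ z w} {unΓ z′ w′}
                      (lineFrom-≈⁻ p {unΓ z w} {unΓ z′ w′} e) (∈ˡ-second {e₀} {unΓDir z w}))
      in y≡ , (begin
        w ≡⟨ solve 2 (λ z w → w := z :* z :+ w :+ :- (z :* z)) refl z w ⟩
        z * z + w + - (z * z) ≡⟨ cong₂ (λ x y → x + - (y * y)) x≡ y≡ ⟩
        z′ * z′ + w′ + - (z′ * z′) ≡⟨ solve 2 (λ z w → z :* z :+ w :+ :- (z :* z) := w) refl z′ w′ ⟩
        w′ ∎)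

  isUnΓ⁺ : ∀ {L p z w} → w ≢ 0# → L ≈ lineFrom p (unΓ z w) → T (isUnΓ L)
  isUnΓ⁺ {L} {p} {z} {w} w≢0 e = ∧⁺
    (unisecant⁺ {L} {p} L-passes (λ {s} passes → unΓ-only {p} {z} {w} {s} w≢0 (passes-resp-≈ {L} {M} {s} e passes)))
    (not⁺ (λ t → let s , L⊂Γ = inSomeΓ⁻ {L} t
                     p≡s = inΓ-passes {L} {s} {p} L⊂Γ L-passes
                     M⊂Γ = inPlane-resp-≈ {L} {M} {oscPlane p} e (subst (λ s → T (lineInPlane L (oscPlane s))) (sym p≡s) L⊂Γ)
                 in 1≢0 (inΓ-self⁻ {p} {unΓ z w} M⊂Γ (∈ˡ-second {e₀} {unΓDir z w}))))
    where
    M = lineFrom p (unΓ z w)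
    L-passes : L passes p
    L-passes = passes-resp-≈ {M} {L} {p} (≈-sym {L} {M} e) (unΓ-passes p z w)

  isUnΓ⁻ : ∀ {L} → T (isLine L) → T (isUnΓ L) → ∃ λ p → ∃₂ λ z w → w ≢ 0# × L ≈ lineFrom p (unΓ z w)
  isUnΓ⁻ {L} l e = p , z , w , w≢0 , L≈unΓ
    where
    parts = ∧⁻ e
    secant = unisecant⁻ {L} (proj₁ parts)
    p = proj₁ secant
    frame = through-frame {L} {p} l (proj₁ (proj₂ secant))
    v = proj₁ frame
    L≈ : L ≈ lineFrom p (e₀ , v)
    L≈ = proj₁ (proj₂ frame)
    v3≢0 : c3 v ≢ 0#
    v3≢0 v3≡0 = not⁻ (proj₂ parts) (inSomeΓ⁺ {L} p (inPlane-resp-≈˘ {L} {lineFrom p (e₀ , v)} {oscPlane p} L≈ (inΓ-self⁺ {p} {e₀} {v} refl v3≡0)))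
    z = c3 v ⁻¹ * c2 v
    w = c3 v ⁻¹ * c1 v + - (z * z)
    L≈unΓ : L ≈ lineFrom p (unΓ z w)
    L≈unΓ = normal-form {L} {p} {v} (⁻¹-nonzero v3≢0) L≈ (vec≡ refl
      (solve 2 (λ x z → x := z :* z :+ (x :+ :- (z :* z))) refl (c3 v ⁻¹ * c1 v) z) refl (⁻¹-inverseˡ v3≢0))
    w≢0 : w ≢ 0#
    -- For w = 0 the point of chart value z would be a second point of the unisecant.
    w≢0 w≡0 = unchart-≢ p z (proj₂ (proj₂ secant) {unchart p z} (passes-resp-≈ {lineFrom p (unΓ z w)} {L} {unchart p z}
      (≈-sym {L} {lineFrom p (unΓ z w)} L≈unΓ) (passes-chart⁺ {p} {unΓ z w} {unchart p z} (unchart-≢ p z)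
        (subst (λ k → cubicPt (just k) ∈ˡ unΓ z w) (sym (chart-unchart p z))
          (∈-through⁺ {unΓDir z w} {cubicPt (just z)} 1#
            (trans (solve 1 (λ z → z :* z := :1 :* (z :* z :+ :0)) refl z) (cong (λ w → 1# * (z * z + w)) (sym w≡0)))
            (sym (*-identityˡ z)) (sym (*-identityˡ 1#)))))))

-- EΓ-lines when 3 is invertible.

module ExternalLines (𝔽 : FiniteField) (3≢0 : Geometry.3# 𝔽 ≢ FiniteField.0# 𝔽) where
  open FiniteField 𝔽
  open Geometry 𝔽
  open V4
  open Booleans
  open Counting
  open Lines 𝔽
  open Solver using (solve; _:+_; _:*_; :-_; _:=_)
  open ≡-Reasoning

  third : Carrier → Carrier
  third x = 3# ⁻¹ * x

  3-third : ∀ x → 3# * third x ≡ x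
  3-third x = trans (sym (*-assoc 3# (3# ⁻¹) x)) (trans (cong (_* x) (⁻¹-inverse 3# 3≢0)) (*-identityˡ x))

  third-3 : ∀ x → third (3# * x) ≡ x
  third-3 x = cancelˡ 3≢0 (3-third (3# * x))

  axisDir₁ axisDir₂ : Carrier → V4
  axisDir₁ a = ⟨ a , 1# , 0# , 0# ⟩
  axisDir₂ b = ⟨ b , 0# , 1# , 0# ⟩

  -- The line x₀ = a x₁ + b x₂ of the plane x₃ = 0; every line of that plane missing e₀ has this
  -- form.
  axis : Carrier → Carrier → Line
  axis a b = axisDir₁ a , axisDir₂ b

  -- The lines of Γ_p missing P(p), in the frame at P(p); w = 0 gives the real axis with the
  -- Γ-plane at the point of chart value a / 3.
  eΓ : Carrier → Carrier → Line
  eΓ a w = axis a (third (w + - (a * a)))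

  eΓ-coefficient : ∀ a w → 3# * third (w + - (a * a)) + a * a ≡ w
  eΓ-coefficient a w = trans (cong (_+ a * a) (3-third _)) (solve 2 (λ a w → w :+ :- (a :* a) :+ a :* a := w) refl a w)

  axis-∈⁻ : ∀ {a b v} → v ∈ˡ (axis a b) → c0 v ≡ c1 v * a + c2 v * b
  axis-∈⁻ {a} {b} (x , y , refl) =
    solve 4 (λ a b x y → x :* a :+ y :* b := (x :* :1 :+ y :* :0) :* a :+ (x :* :0 :+ y :* :1) :* b) refl a b x y

  axis-∈⁺ : ∀ {a b v} → c0 v ≡ c1 v * a + c2 v * b → c3 v ≡ 0# → v ∈ˡ (axis a b)
  axis-∈⁺ {a} {b} {v} v0 v3 = c1 v , c2 v , vec≡ v0
    (solve 2 (λ x y → x := x :* :1 :+ y :* :0) refl (c1 v) (c2 v))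
    (solve 2 (λ x y → y := x :* :0 :+ y :* :1) refl (c1 v) (c2 v))
    (trans v3 (solve 2 (λ x y → :0 := x :* :0 :+ y :* :0) refl (c1 v) (c2 v)))

  eΓ-isLine : ∀ p a w → T (isLine (lineFrom p (eΓ a w)))
  eΓ-isLine p a w = lineFrom-isLine⁺ p {eΓ a w} (independent⁺ {axisDir₁ a} {axisDir₂ (third (w + - (a * a)))} (λ {x} {y} e →
    trans (solve 2 (λ x y → x := x :* :1 :+ y :* :0) refl x y) (cong c1 e) ,
    trans (solve 2 (λ x y → y := x :* :0 :+ y :* :1) refl x y) (cong c2 e)))

  eΓ-inΓ : ∀ p a w → T (lineInPlane (lineFrom p (eΓ a w)) (oscPlane p))
  eΓ-inΓ p a w = inΓ-self⁺ {p} {axisDir₁ a} {axisDir₂ (third (w + - (a * a)))} refl refl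

  eΓ-external : ∀ {p a w s} → ¬ lineFrom p (eΓ a w) passes s
  eΓ-external {p} {a} {w} {s} passes = 1≢0 (trans
    (axis-∈⁻ (passes-self⁻ {p} {eΓ a w} (subst (lineFrom p (eΓ a w) passes_) (inΓ-passes {lineFrom p (eΓ a w)} {p} {s} (eΓ-inΓ p a w) passes) passes)))
    (solve 2 (λ a b → :0 :* a :+ :0 :* b := :0) refl a (third (w + - (a * a)))))

  dot-osculating₁ : ∀ a k → dot (oscPlane (just k)) (axisDir₁ a) ≡ a + - (3# * k)
  dot-osculating₁ = solve 2 (λ a k → :1 :* a :+ :- (:3 :* k) :* :1 :+ :3 :* k :* k :* :0 :+ :- (k :* k :* k) :* :0
    := a :+ :- (:3 :* k)) refl

  dot-osculating₂ : ∀ b k → dot (oscPlane (just k)) (axisDir₂ b) ≡ b + 3# * k * k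
  dot-osculating₂ = solve 2 (λ b k → :1 :* b :+ :- (:3 :* k) :* :0 :+ :3 :* k :* k :* :1 :+ :- (k :* k :* k) :* :0
    := b :+ :3 :* k :* k) refl

  -- Lying in the Γ-plane of chart value k means a = 3k and b = -3k²; eliminating k gives w = 3b +
  -- a² = 0.
  eΓ-onlyΓ : ∀ {p a w s} → w ≢ 0# → T (lineInPlane (lineFrom p (eΓ a w)) (oscPlane s)) → p ≡ s
  eΓ-onlyΓ {p} {a} {w} {s} w≢0 L⊂Γ = decidable-stable (p ≟ᴾ s) λ p≢s →
    let k = chart p s
        b = third (w + - (a * a))
        on₁ : a + - (3# * k) ≡ 0#
        on₁ = trans (sym (dot-osculating₁ a k)) (inΓ-chart⁻ {p} {eΓ a w} {s} p≢s L⊂Γ (∈ˡ-first {axisDir₁ a} {axisDir₂ b}))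
        on₂ : b + 3# * k * k ≡ 0#
        on₂ = trans (sym (dot-osculating₂ b k)) (inΓ-chart⁻ {p} {eΓ a w} {s} p≢s L⊂Γ (∈ˡ-second {axisDir₁ a} {axisDir₂ b}))
    in w≢0 (begin
      w ≡⟨ sym (eΓ-coefficient a w) ⟩
      3# * b + a * a
        ≡⟨ solve 3 (λ a b k → :3 :* b :+ a :* a := :3 :* (b :+ :3 :* k :* k) :+ (a :+ :- (:3 :* k)) :* (a :+ :3 :* k)) refl a b k ⟩
      3# * (b + 3# * k * k) + (a + - (3# * k)) * (a + 3# * k) ≡⟨ cong₂ (λ x y → 3# * x + y * (a + 3# * k)) on₂ on₁ ⟩
      3# * 0# + 0# * (a + 3# * k) ≡⟨ solve 1 (λ x → :3 :* :0 :+ :0 :* x := :0) refl (a + 3# * k) ⟩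
      0# ∎)

  eΓ-injective : ∀ {p a w p′ a′ w′} → w′ ≢ 0# → lineFrom p (eΓ a w) ≈ lineFrom p′ (eΓ a′ w′) → p ≡ p′ × a ≡ a′ × w ≡ w′
  eΓ-injective {p} {a} {w} {p′} {a′} {w′} w′≢0 e = sym p′≡p
    , coordinates (subst (λ p′ → lineFrom p (eΓ a w) ≈ lineFrom p′ (eΓ a′ w′)) p′≡p e)
    where
    p′≡p : p′ ≡ p
    p′≡p = eΓ-onlyΓ {p′} {a′} {w′} {p} w′≢0 (inPlane-resp-≈ {lineFrom p (eΓ a w)} {lineFrom p′ (eΓ a′ w′)} {oscPlane p} e (eΓ-inΓ p a w))
    coordinates : lineFrom p (eΓ a w) ≈ lineFrom p (eΓ a′ w′) → a ≡ a′ × w ≡ w′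
    coordinates e = a≡a′ , (begin
      w ≡⟨ sym (eΓ-coefficient a w) ⟩
      3# * b + a * a ≡⟨ cong₂ (λ a b → 3# * b + a * a) a≡a′ b≡b′ ⟩
      3# * b′ + a′ * a′ ≡⟨ eΓ-coefficient a′ w′ ⟩
      w′ ∎)
      where
      b = third (w + - (a * a))
      b′ = third (w′ + - (a′ * a′))
      e′ : eΓ a w ≈ eΓ a′ w′
      e′ = lineFrom-≈⁻ p {eΓ a w} {eΓ a′ w′} e
      a≡a′ : a ≡ a′
      a≡a′ = trans (axis-∈⁻ (∈ˡ-resp-≈ {eΓ a w} {eΓ a′ w′} e′ (∈ˡ-first {axisDir₁ a} {axisDir₂ b})))
        (solve 2 (λ a b → :1 :* a :+ :0 :* b := a) refl a′ b′)
      b≡b′ : b ≡ b′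
      b≡b′ = trans (axis-∈⁻ (∈ˡ-resp-≈ {eΓ a w} {eΓ a′ w′} e′ (∈ˡ-second {axisDir₁ a} {axisDir₂ b})))
        (solve 2 (λ a b → :0 :* a :+ :1 :* b := b) refl a′ b′)

  isEΓ⁺ : ∀ {L p a w} → w ≢ 0# → L ≈ lineFrom p (eΓ a w) → T (isEΓ L)
  isEΓ⁺ {L} {p} {a} {w} w≢0 e = ∧⁺
    (external⁺ {L} (λ s passes → eΓ-external {p} {a} {w} {s} (passes-resp-≈ {L} {M} {s} e passes)))
    (∧⁺ (inSomeΓ⁺ {L} p (inPlane-resp-≈˘ {L} {M} {oscPlane p} e (eΓ-inΓ p a w)))
        -- A real axis lies in two distinct Γ-planes, while w ≠ 0 leaves only Γ_p.
        (not⁺ (λ t → let s , s′ , distinct , in-s , in-s′ = isRealAxis⁻ {L} t in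
          distinct (subst (λ r → oscPlane s ∝ oscPlane r) (trans (sym (only s in-s)) (only s′ in-s′)) (∝.refl {oscPlane s})))))
    where
    M = lineFrom p (eΓ a w)
    only : ∀ s → T (lineInPlane L (oscPlane s)) → p ≡ s
    only s L⊂Γ = eΓ-onlyΓ {p} {a} {w} {s} w≢0 (inPlane-resp-≈ {L} {M} {oscPlane s} e L⊂Γ)

  isEΓ⁻ : ∀ {L} → T (isLine L) → T (isEΓ L) → ∃ λ p → ∃₂ λ a w → w ≢ 0# × L ≈ lineFrom p (eΓ a w)
  isEΓ⁻ {L} l e = p , a , w , w≢0 , subst (λ b → L ≈ lineFrom p (axis a b)) b≡ L≈
    where
    parts = ∧⁻ e
    parts₂ = ∧⁻ (proj₂ parts)
    p = proj₁ (inSomeΓ⁻ {L} (proj₁ parts₂))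
    L⊂Γ = proj₂ (inSomeΓ⁻ {L} (proj₁ parts₂))
    M = lineIn p L
    m : T (isLine M)
    m = lineFrom-isLine⁻ p {M} (subst (T ∘ isLine) (sym (lineFrom-lineIn p L)) l)
    third-zero : ∀ {v} → v ∈ˡ M → c3 v ≡ 0#
    third-zero {v} = inΓ-self⁻ {p} {M} (subst (λ L → T (lineInPlane L (oscPlane p))) (sym (lineFrom-lineIn p L)) L⊂Γ) {v}
    misses : ¬ (e₀ ∈ˡ M)
    misses e₀∈M = external⁻ {L} (proj₁ parts) p (subst (_passes p) (lineFrom-lineIn p L) (passes-self⁺ {p} {M} e₀∈M))
    -- The last coordinate vanishes on all of M, so such a vector is a multiple of e₀; M misses e₀,
    -- hence it is zero.
    e₀-part : ∀ {v} → v ∈ˡ M → c1 v ≡ 0# → c2 v ≡ 0# → c0 v ≡ 0#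
    e₀-part {v} v∈M v1 v2 = decidable-stable (c0 v ≟ 0#) λ v0≢0 → misses (subst (_∈ˡ M)
      (vec≡ (⁻¹-inverseˡ v0≢0) (*-zeroʳ v1) (*-zeroʳ v2)
        (*-zeroʳ (third-zero v∈M)))
      (∈ˡ-scale {M} (c0 v ⁻¹) v∈M))
    -- Cutting M with x₂ = 0, and later with x₁ = 0, yields the two basis vectors of `axis` up to
    -- scale; `e₀-part` keeps the coordinates to be inverted from vanishing.
    meet₁ = meet {M} m ⟨ 0# , 0# , 1# , 0# ⟩
    f = proj₁ meet₁
    f≢0 = proj₁ (proj₂ meet₁)
    f∈M = proj₁ (proj₂ (proj₂ meet₁))
    f2≡0 : c2 f ≡ 0#
    f2≡0 = trans (solve 4 (λ x y z w → z := :0 :* x :+ :0 :* y :+ :1 :* z :+ :0 :* w) refl (c0 f) (c1 f) (c2 f) (c3 f))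
      (proj₂ (proj₂ (proj₂ meet₁)))
    f1≢0 : c1 f ≢ 0#
    f1≢0 f1≡0 = f≢0 (vec≡ (e₀-part f∈M f1≡0 f2≡0) f1≡0 f2≡0 (third-zero f∈M))
    meet₂ = meet {M} m ⟨ 0# , 1# , 0# , 0# ⟩
    g = proj₁ meet₂
    g≢0 = proj₁ (proj₂ meet₂)
    g∈M = proj₁ (proj₂ (proj₂ meet₂))
    g1≡0 : c1 g ≡ 0#
    g1≡0 = trans (solve 4 (λ x y z w → y := :0 :* x :+ :1 :* y :+ :0 :* z :+ :0 :* w) refl (c0 g) (c1 g) (c2 g) (c3 g))
      (proj₂ (proj₂ (proj₂ meet₂)))
    g2≢0 : c2 g ≢ 0#
    g2≢0 g2≡0 = g≢0 (vec≡ (e₀-part g∈M g1≡0 g2≡0) g1≡0 g2≡0 (third-zero g∈M))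
    a = c1 f ⁻¹ * c0 f
    b = c2 g ⁻¹ * c0 g
    w = 3# * b + a * a
    A∈M : axisDir₁ a ∈ˡ M
    A∈M = subst (_∈ˡ M) (vec≡ refl (⁻¹-inverseˡ f1≢0) (*-zeroʳ f2≡0)
      (*-zeroʳ (third-zero f∈M))) (∈ˡ-scale {M} (c1 f ⁻¹) f∈M)
    B∈M : axisDir₂ b ∈ˡ M
    B∈M = subst (_∈ˡ M) (vec≡ refl (*-zeroʳ g1≡0) (⁻¹-inverseˡ g2≢0)
      (*-zeroʳ (third-zero g∈M))) (∈ˡ-scale {M} (c2 g ⁻¹) g∈M)
    spanned : ∀ {v} → v ∈ˡ M → v ∈ˡ (axis a b)
    -- Subtracting from v its combination of the two basis vectors leaves x₁ = x₂ = 0, hence x₀ = 0.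
    spanned {v} v∈M = axis-∈⁺ (difference-zero (trans
        (solve 5 (λ x y z a b → x :+ :- (y :* a :+ z :* b) := :1 :* x :+ :- :1 :* (y :* a :+ z :* b)) refl (c0 v) (c1 v) (c2 v) a b)
        (e₀-part (∈ˡ-span (v , r) M v∈M r∈M (1# , - 1# , refl))
          (solve 2 (λ y z → :1 :* y :+ :- :1 :* (y :* :1 :+ z :* :0) := :0) refl (c1 v) (c2 v))
          (solve 2 (λ y z → :1 :* z :+ :- :1 :* (y :* :0 :+ z :* :1) := :0) refl (c1 v) (c2 v)))))
      (third-zero v∈M)
      where
      r = comb (c1 v) (axisDir₁ a) (c2 v) (axisDir₂ b)
      r∈M : r ∈ˡ M
      r∈M = ∈ˡ-span (axis a b) M A∈M B∈M (c1 v , c2 v , refl)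
    L≈ : L ≈ lineFrom p (axis a b)
    L≈ = subst (_≈ lineFrom p (axis a b)) (lineFrom-lineIn p L) (lineFrom-≈⁺ p {M} {axis a b}
      (sameLine⁺ {M} {axis a b} (spanned (∈ˡ-first {proj₁ M} {proj₂ M})) (spanned (∈ˡ-second {proj₁ M} {proj₂ M})) A∈M B∈M))
    b≡ : b ≡ third (w + - (a * a))
    b≡ = trans (sym (third-3 b)) (cong third (solve 2 (λ x a → x := x :+ a :* a :+ :- (a :* a)) refl (3# * b) a))
    w≢0 : w ≢ 0#
    w≢0 w≡0 = not⁻ (proj₂ parts₂) (isRealAxis⁺ {L} s p distinct
      (inPlane-resp-≈˘ {L} {lineFrom p (axis a b)} {oscPlane s} L≈
        (inΓ-chart⁺ {p} {axisDir₁ a} {axisDir₂ b} {s} p≢s (on (axisDir₁ a) on₁) (on (axisDir₂ b) on₂)))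
      L⊂Γ)
      where
      -- A second Γ-plane through the line must have a = 3k; w = 0 supplies the other condition b =
      -- -3k².
      k = third a
      s = unchart p k
      p≢s : p ≢ s
      p≢s = unchart-≢ p k
      on : ∀ v → dot (oscPlane (just k)) v ≡ 0# → dot (oscPlane (just (chart p s))) v ≡ 0#
      on v = subst (λ k → dot (oscPlane (just k)) v ≡ 0#) (sym (chart-unchart p k))
      on₁ : dot (oscPlane (just k)) (axisDir₁ a) ≡ 0#
      on₁ = trans (dot-osculating₁ a k) (trans (cong (λ x → a + - x) (3-third a)) (-‿inverseʳ a))
      on₂ : dot (oscPlane (just k)) (axisDir₂ b) ≡ 0#
      on₂ = trans (dot-osculating₂ b k) (cancel 3≢0 (begin
        3# * (b + 3# * k * k) ≡⟨ solve 2 (λ b k → :3 :* (b :+ :3 :* k :* k) := :3 :* b :+ (:3 :* k) :* (:3 :* k)) refl b k ⟩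
        3# * b + (3# * k) * (3# * k) ≡⟨ cong (λ x → 3# * b + x * x) (3-third a) ⟩
        w ≡⟨ w≡0 ⟩
        0# ∎))
      distinct : ¬ (oscPlane s ∝ oscPlane p)
      distinct s∝p = p≢s (osculating-root-unique {p} {s} (root-∝ {oscPlane s} {oscPlane p} {p} s∝p (osculating-root p)))

-- Vanishing of 3 in the field and divisibility of q by 3.

module Characteristic (𝔽 : FiniteField) where
  open FiniteField 𝔽
  open Geometry 𝔽
  open Booleans
  open Counting
  open Coordinates 𝔽
  open Solver using (solve; _:+_; _:*_; :-_; _:=_)
  open ≡-Reasoning

  -- If 3 = 0 then the cosets of {0, 1, 2} partition the field.
  module _ (3≡0 : 3# ≡ 0#) where

    shifts : List Carrier
    shifts = 0# ∷ 1# ∷ 2# ∷ []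

    1+2≡0 : 1# + 2# ≡ 0#
    1+2≡0 = trans (solve 0 (:1 :+ :2 := :3) refl) 3≡0

    2≢0 : 2# ≢ 0#
    2≢0 2≡0 = 1≢0 (trans (sym (+-identityʳ 1#)) (trans (cong (1# +_) (sym 2≡0)) 1+2≡0))

    1≢2 : 1# ≢ 2#
    1≢2 1≡2 = 1≢0 (trans (solve 0 (:1 := :2 :+ :- :1) refl) (trans (cong (_+ - 1#) (sym 1≡2)) (-‿inverseʳ 1#)))

    shifts-unique : Unique shifts
    shifts-unique = (0≢1 ∷ (2≢0 ∘ sym) ∷ []) ∷ (1≢2 ∷ []) ∷ [] ∷ []

    shifts-neg : ∀ {i} → i ∈ shifts → - i ∈ shifts
    shifts-neg (here refl) = here (solve 0 (:- :0 := :0) refl)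
    shifts-neg (there (here refl)) = there (there (here (difference-zero (trans (solve 0 (:- :1 :+ :- :2 := :- :3) refl)
      (trans (cong -_ 3≡0) (solve 0 (:- :0 := :0) refl))))))
    shifts-neg (there (there (here refl))) = there (here (difference-zero (trans (solve 0 (:- :2 :+ :- :1 := :- :3) refl)
      (trans (cong -_ 3≡0) (solve 0 (:- :0 := :0) refl)))))

    shifts-+ : ∀ {i j} → i ∈ shifts → j ∈ shifts → i + j ∈ shifts
    shifts-+ {j = j} (here refl) j∈ = subst (_∈ shifts) (sym (+-identityˡ j)) j∈
    shifts-+ {i = i} i∈ (here refl) = subst (_∈ shifts) (sym (+-identityʳ i)) i∈
    shifts-+ (there (here refl)) (there (here refl)) = there (there (here refl))
    shifts-+ (there (here refl)) (there (there (here refl))) = here 1+2≡0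
    shifts-+ (there (there (here refl))) (there (here refl)) = here (trans (+-comm 2# 1#) 1+2≡0)
    shifts-+ (there (there (here refl))) (there (there (here refl))) = there (here (difference-zero
      (trans (solve 0 (:2 :+ :2 :+ :- :1 := :3) refl) 3≡0)))

    congruent : Carrier → Carrier → Bool
    congruent x y = any (λ i → y == (x + i)) shifts

    congruent⁻ : ∀ {x y} → T (congruent x y) → ∃ λ i → i ∈ shifts × y ≡ x + i
    congruent⁻ {x} {y} t = let i , i∈ , e = find (any⁻ (λ i → y == (x + i)) shifts t) in i , i∈ , ==⁻ e

    congruent⁺ : ∀ {x y i} → i ∈ shifts → y ≡ x + i → T (congruent x y)
    congruent⁺ {x} {y} i∈ e = any-intro (λ i → y == (x + i)) i∈ (==⁺ e)

    congruent-isEquivalence : IsEquivalence (λ x y → T (congruent x y))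
    congruent-isEquivalence = record
      { refl  = λ {x} → congruent⁺ {x} {x} (here refl) (sym (+-identityʳ x))
      ; sym   = λ {x} {y} t → let i , i∈ , e = congruent⁻ {x} {y} t in congruent⁺ {y} {x} (shifts-neg i∈)
          (trans (solve 2 (λ x i → x := x :+ i :+ :- i) refl x i) (cong (_+ - i) (sym e)))
      ; trans = λ {x} {y} {z} t u → let i , i∈ , e = congruent⁻ {x} {y} t ; j , j∈ , f = congruent⁻ {y} {z} u in
          congruent⁺ {x} {z} (shifts-+ i∈ j∈) (trans f (trans (cong (_+ j) e) (+-assoc x i j)))
      }

    -- Every element is a coset representative plus one of three shifts in exactly one way. The
    -- contrapositive turns the hypothesis on q into 3 ≠ 0 in the field.
    3∣q : 3 ∣ q
    3∣q = divides (length representatives) (trans (transversal-length isEquivalence (complete-transversal complete unique) sums)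
      (trans (length-map _ (cartesianProduct representatives shifts)) (length-product representatives shifts)))
      where
      representatives : List Carrier
      representatives = deduplicateᵇ congruent elements
      module R = Transversal (deduplicate-transversal congruent congruent-isEquivalence elements)
      module C = IsEquivalence congruent-isEquivalence
      sum-of : Carrier × Carrier → Carrier
      sum-of (x , i) = x + i
      same : ∀ {x i x′ i′} → x ∈ representatives → i ∈ shifts → x′ ∈ representatives → i′ ∈ shifts →
        x + i ≡ x′ + i′ → (x , i) ≡ (x′ , i′)
      same {x} {i} {x′} {i′} x∈ i∈ x′∈ i′∈ e = cong₂ _,_ x≡x′ (difference-zero (begin
        i + - i′ ≡⟨ solve 4 (λ x i x′ i′ → i :+ :- i′ := (x :+ i) :+ :- (x′ :+ i′) :+ (x′ :+ :- x)) refl x i x′ i′ ⟩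
        x + i + - (x′ + i′) + (x′ + - x) ≡⟨ cong₂ (λ a b → a + - (x′ + i′) + (x′ + - b)) e x≡x′ ⟩
        x′ + i′ + - (x′ + i′) + (x′ + - x′) ≡⟨ solve 2 (λ x i → x :+ i :+ :- (x :+ i) :+ (x :+ :- x) := :0) refl x′ i′ ⟩
        0# ∎))
        where
        x≡x′ : x ≡ x′
        -- Here x′ = x + (i - i′), and the shifts are closed under differences, so both
        -- representatives lie in one coset.
        x≡x′ = apart-∈ (λ {x} {y} → C.sym {x} {y}) R.apart x∈ x′∈ (congruent⁺ {x} {x′} (shifts-+ i∈ (shifts-neg i′∈))
          (trans (solve 2 (λ x i → x := x :+ i :+ :- i) refl x′ i′)
            (trans (cong (_+ - i′) (sym e)) (+-assoc x i (- i′)))))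
      sums : Transversal _≡_ (λ _ → ⊤) (map sum-of (cartesianProduct representatives shifts))
      sums = map-transversal isEquivalence
        (Unique.cartesianProduct⁺ (AllPairs.map (λ {x} ¬c x≡y → ¬c (subst (λ y → T (congruent x y)) x≡y (C.refl {x}))) R.apart) shifts-unique)
        sum-of _
        (λ p∈ p′∈ e → let x∈ , i∈ = ∈-cartesianProduct⁻ representatives shifts p∈
                          x′∈ , i′∈ = ∈-cartesianProduct⁻ representatives shifts p′∈ in same x∈ i∈ x′∈ i′∈ e)
        (λ {y} _ → let x , x∈ , t = R.cover (complete y)
                       i , i∈ , e = congruent⁻ {x} {y} (C.sym {y} {x} t)
                   in (x , i) , ∈-cartesianProduct⁺ x∈ i∈ , e)

-- Numbers of lines of each type, in space and in a given plane.

module LineCounts (𝔽 : FiniteField) where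
  open FiniteField 𝔽
  open Geometry 𝔽
  open V4
  open Booleans
  open Counting
  open Lines 𝔽 public
  open Solver using (solve; _:+_; _:*_; :-_; _:=_)
  open ≡-Reasoning

  others : Carrier → List Carrier
  others r = filterᵇ (λ x → not (x == r)) elements

  others-unique : ∀ r → Unique (others r)
  others-unique r = Unique.filter⁺ (λ x → T? (not (x == r))) unique

  ∈-others⁺ : ∀ {r x} → x ≢ r → x ∈ others r
  ∈-others⁺ {r} {x} x≢r = ∈-filterᵇ⁺ (λ x → not (x == r)) (complete x) (not⁺ (x≢r ∘ ==⁻))

  ∈-others⁻ : ∀ {r x} → x ∈ others r → x ≢ r
  ∈-others⁻ {r} {x} x∈ x≡r = not⁻ (proj₂ (∈-filterᵇ⁻ (λ x → not (x == r)) {xs = elements} x∈)) (==⁺ x≡r)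

  length-others : ∀ r → length (others r) ≡ q ℕ.∸ 1
  length-others r = count-all-but-one complete unique r (λ x → not (x == r)) (λ t → not⁻ t (==⁺ refl))
    (λ {y} ¬t → decidable-stable (y ≟ r) (λ y≢r → ¬t (not⁺ (y≢r ∘ ==⁻))))

  length-params : length params ≡ suc q
  length-params = cong suc (length-map just elements)

  count-lines : ∀ {X : Set} (f : Line → Bool) {xs : List X} → Unique xs → (g : X → Line) →
    (∀ {x} → x ∈ xs → T (isLine (g x))) →
    (∀ {x L} → x ∈ xs → T (isLine L) → L ≈ g x → T (f L)) →
    (∀ {x x′} → x ∈ xs → x′ ∈ xs → g x ≈ g x′ → x ≡ x′) →
    (∀ {L} → T (isLine L) → T (f L) → ∃ λ x → x ∈ xs × L ≈ g x) →
    nLines f ≡ length xs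
  count-lines = count-by ≈-isEquivalence allLines-transversal

  count-planes : ∀ {X : Set} (f : V4 → Bool) {xs : List X} → Unique xs → (g : X → V4) →
    (∀ {x} → x ∈ xs → T (nonzero (g x))) →
    (∀ {x π} → x ∈ xs → T (nonzero π) → π ∝ g x → T (f π)) →
    (∀ {x x′} → x ∈ xs → x′ ∈ xs → g x ∝ g x′ → x ≡ x′) →
    (∀ {π} → T (nonzero π) → T (f π) → ∃ λ x → x ∈ xs × π ∝ g x) →
    count f allPlanes ≡ length xs
  count-planes = count-by ∝-isEquivalence allPlanes-transversal

  nTangent : nLines isTangent ≡ suc q
  nTangent = trans (count-lines isTangent params-unique tangentLine
    (λ {p} _ → tangent-isLine p)
    (λ {p} {L} _ _ e → isTangent⁺ {L} p e)
    (λ {p} {p′} _ _ e → tangent-injective {p} {p′} e)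
    (λ {L} _ t → let p , e = isTangent⁻ {L} t in p , params-complete p , e)) length-params

  nUΓ : nLines isUΓ ≡ suc q ℕ.* q
  nUΓ = trans (count-lines isUΓ (Unique.cartesianProduct⁺ params-unique unique) line
    (λ { {p , y} _ → uΓ-isLine p y })
    (λ { {p , y} {L} _ _ e → isUΓ⁺ {L} {p} {y} e })
    (λ { {p , y} {p′ , y′} _ _ e → let p≡ , y≡ = uΓ-injective {p} {y} {p′} {y′} e in cong₂ _,_ p≡ y≡ })
    (λ {L} l t → let p , y , e = isUΓ⁻ {L} l t in (p , y) , ∈-cartesianProduct⁺ (params-complete p) (complete y) , e))
    (trans (length-product params elements) (cong (ℕ._* q) length-params))
    where
    line : Param × Carrier → Line
    line (p , y) = lineFrom p (uΓ y)

  Triple : Set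
  Triple = Param × Carrier × Carrier

  triples : List Triple
  triples = cartesianProduct params (cartesianProduct elements (others 0#))

  triples-unique : Unique triples
  triples-unique = Unique.cartesianProduct⁺ params-unique (Unique.cartesianProduct⁺ unique (others-unique 0#))

  ∈-triples⁺ : ∀ p z {w} → w ≢ 0# → (p , z , w) ∈ triples
  ∈-triples⁺ p z w≢0 = ∈-cartesianProduct⁺ (params-complete p) (∈-cartesianProduct⁺ (complete z) (∈-others⁺ w≢0))

  ∈-triples⁻ : ∀ {p z w} → (p , z , w) ∈ triples → w ≢ 0#
  ∈-triples⁻ t∈ = ∈-others⁻ (proj₂ (∈-cartesianProduct⁻ elements (others 0#)
    (proj₂ (∈-cartesianProduct⁻ params (cartesianProduct elements (others 0#)) t∈))))

  length-triples : length triples ≡ suc q ℕ.* (q ℕ.* (q ℕ.∸ 1))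
  length-triples = trans (length-product params (cartesianProduct elements (others 0#)))
    (cong₂ ℕ._*_ length-params (trans (length-product elements (others 0#)) (cong (q ℕ.*_) (length-others 0#))))

  nUnΓ : nLines isUnΓ ≡ suc q ℕ.* (q ℕ.* (q ℕ.∸ 1))
  nUnΓ = trans (count-lines isUnΓ triples-unique line
    (λ { {p , z , w} _ → unΓ-isLine p z w })
    (λ { {p , z , w} {L} t∈ _ e → isUnΓ⁺ {L} {p} {z} {w} (∈-triples⁻ t∈) e })
    (λ { {p , z , w} {p′ , z′ , w′} _ t∈ e →
         let p≡ , z≡ , w≡ = unΓ-injective {p} {z} {w} {p′} {z′} {w′} (∈-triples⁻ t∈) e in cong₂ _,_ p≡ (cong₂ _,_ z≡ w≡) })
    (λ {L} l t → let p , z , w , w≢0 , e = isUnΓ⁻ {L} l t in (p , z , w) , ∈-triples⁺ p z w≢0 , e))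
    length-triples
    where
    line : Triple → Line
    line (p , z , w) = lineFrom p (unΓ z w)

  dot-e₀-frame : ∀ {π p M} → e₀ ∈ˡ M → T (lineInPlane (lineFrom p M) π) → c0 (planeIn p π) ≡ 0#
  dot-e₀-frame {π} {p} {M} e₀∈M L⊂π = trans (sym (dot-e₀ (planeIn p π)))
    (inPlane⁻ {M} {planeIn p π} (lineFrom-inPlane⁻ p {M} {π} L⊂π) e₀∈M)

  dot-uΓ : ∀ σ y → dot σ (uΓDir y) ≡ c1 σ * y + c2 σ
  dot-uΓ σ y = solve 5 (λ a b c d y → a :* :0 :+ b :* y :+ c :* :1 :+ d :* :0 := b :* y :+ c) refl (c0 σ) (c1 σ) (c2 σ) (c3 σ) y

  uΓ-inPlane⁻ : ∀ {π p y} → T (lineInPlane (lineFrom p (uΓ y)) π) →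
    Root π p × c1 (planeIn p π) * y + c2 (planeIn p π) ≡ 0#
  uΓ-inPlane⁻ {π} {p} {y} L⊂π = frame-root {π} {p} (dot-e₀-frame {π} {p} {uΓ y} (∈ˡ-first {e₀} {v}) L⊂π)
    , trans (sym (dot-uΓ (planeIn p π) y)) (inPlane⁻ {uΓ y} {planeIn p π} (lineFrom-inPlane⁻ p {uΓ y} {π} L⊂π) (∈ˡ-second {e₀} {v}))
    where v = uΓDir y

  uΓ-inPlane⁺ : ∀ {π p y} → Root π p → c1 (planeIn p π) * y + c2 (planeIn p π) ≡ 0# →
    T (lineInPlane (lineFrom p (uΓ y)) π)
  uΓ-inPlane⁺ {π} {p} {y} root e = lineFrom-inPlane⁺ p {uΓ y} {π} (inPlane⁺ {uΓ y} {planeIn p π}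
    (trans (dot-e₀ (planeIn p π)) (trans (sym (dot-self π p)) root)) (trans (dot-uΓ (planeIn p π) y) e))

  -- Tangency means B = 0; containing the direction (0, y, 1, 0), which is B y + C = 0, would then
  -- force C = 0 and make the plane Γ_p.
  uΓ-¬tangential : ∀ {π p y} → π ≢ zeroV → ¬ T (isΓPlane π) → T (lineInPlane (lineFrom p (uΓ y)) π) → ¬ Tangential π p
  uΓ-¬tangential {π} {p} {y} π≢0 ¬Γ L⊂π tangential =
    cases (linear-frame {π} {p} π≢0 (proj₁ in-plane) tangential)
    where
    in-plane = uΓ-inPlane⁻ {π} {p} {y} L⊂π
    cases : ¬ (π ∝ oscPlane p ⊎ ∃₂ λ a r → a ≢ 0# × planeIn p π ≡ scale a (linear r))
    cases (inj₁ π∝Γ) = ¬Γ (isΓPlane⁺ {π} {p} π∝Γ)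
    cases (inj₂ (a , r , a≢0 , e)) = a≢0 (trans (solve 2 (λ a y → a := a :* :0 :* y :+ a :* :1) refl a y)
      (trans (cong (λ σ → c1 σ * y + c2 σ) (sym e)) (proj₂ in-plane)))

  -- The parameter y of the UΓ-line in which the plane meets Γ_p, solving B y + C = 0; it has this
  -- meaning where B ≠ 0.
  slope : V4 → Param → Carrier
  slope π p = - (c1 (planeIn p π) ⁻¹ * c2 (planeIn p π))

  slope-solves : ∀ {π p} → ¬ Tangential π p → c1 (planeIn p π) * slope π p + c2 (planeIn p π) ≡ 0#
  slope-solves {π} {p} ¬tangential = begin
    b * - (b ⁻¹ * c) + c ≡⟨ solve 3 (λ b z c → b :* :- (z :* c) :+ c := :- (b :* z) :* c :+ c) refl b (b ⁻¹) c ⟩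
    - (b * b ⁻¹) * c + c ≡⟨ cong (λ x → - x * c + c) (⁻¹-inverse b (¬tangential ∘ trans (dot-tangent-self π p))) ⟩
    - 1# * c + c ≡⟨ solve 1 (λ c → :- :1 :* c :+ c := :0) refl c ⟩
    0# ∎
    where
    b = c1 (planeIn p π)
    c = c2 (planeIn p π)

  slope-unique : ∀ {π p y} → ¬ Tangential π p → c1 (planeIn p π) * y + c2 (planeIn p π) ≡ 0# → y ≡ slope π p
  slope-unique {π} {p} {y} ¬tangential e = cancelˡ (¬tangential ∘ trans (dot-tangent-self π p)) (begin
    b * y ≡⟨ solve 2 (λ x c → x := x :+ c :+ :- c) refl (b * y) c ⟩
    b * y + c + - c ≡⟨ cong (_+ - c) (trans e (sym (slope-solves {π} {p} ¬tangential))) ⟩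
    b * slope π p + c + - c ≡⟨ solve 2 (λ x c → x :+ c :+ :- c := x) refl (b * slope π p) c ⟩
    b * slope π p ∎)
    where
    b = c1 (planeIn p π)
    c = c2 (planeIn p π)

  -- A non-Γ-plane through P(p) meets Γ_p in one line through P(p): the tangent if p is a point of
  -- tangency, and a UΓ-line otherwise. So the simple roots count the UΓ-lines.
  Λ-UΓ : ∀ {π rs} → π ≢ zeroV → ¬ T (isΓPlane π) → Unique rs →
    (∀ {p} → p ∈ rs → Root π p × ¬ Tangential π p) → (∀ {p} → Root π p → ¬ Tangential π p → p ∈ rs) →
    Λ isUΓ π ≡ length rs
  Λ-UΓ {π} {rs} π≢0 ¬Γ rs-unique simple onto = count-lines (λ L → isUΓ L ∧ lineInPlane L π) rs-unique line
    (λ {p} _ → uΓ-isLine p (slope π p))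
    (λ {p} {L} p∈ _ e → ∧⁺ (isUΓ⁺ {L} {p} {slope π p} e) (inPlane-resp-≈˘ {L} {line p} {π} e
      (uΓ-inPlane⁺ {π} {p} {slope π p} (proj₁ (simple p∈)) (slope-solves {π} {p} (proj₂ (simple p∈))))))
    (λ {p} {p′} _ _ e → proj₁ (uΓ-injective {p} {slope π p} {p′} {slope π p′} e))
    back
    where
    line : Param → Line
    line p = lineFrom p (uΓ (slope π p))
    back : ∀ {L} → T (isLine L) → T (isUΓ L ∧ lineInPlane L π) → ∃ λ p → p ∈ rs × L ≈ line p
    back {L} l t =
      let t′ = ∧⁻ {isUΓ L} {lineInPlane L π} t
          p , y , e = isUΓ⁻ {L} l (proj₁ t′)
          M⊂π = inPlane-resp-≈ {L} {lineFrom p (uΓ y)} {π} e (proj₂ t′)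
          root , e′ = uΓ-inPlane⁻ {π} {p} {y} M⊂π
          ¬tangential = uΓ-¬tangential {π} {p} {y} π≢0 ¬Γ M⊂π
      in p , onto root ¬tangential , subst (λ y → L ≈ lineFrom p (uΓ y)) (slope-unique {π} {p} {y} ¬tangential e′) e

  Λ-tangent : ∀ {π rs} → Unique rs →
    (∀ {p} → p ∈ rs → Root π p × Tangential π p) → (∀ {p} → Root π p → Tangential π p → p ∈ rs) →
    Λ isTangent π ≡ length rs
  Λ-tangent {π} {rs} rs-unique double onto = count-lines (λ L → isTangent L ∧ lineInPlane L π) rs-unique tangentLine
    (λ {p} _ → tangent-isLine p)
    (λ {p} {L} p∈ _ e → ∧⁺ (isTangent⁺ {L} p e) (inPlane-resp-≈˘ {L} {tangentLine p} {π} e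
      (inPlane⁺ {tangentLine p} {π} (proj₁ (double p∈)) (proj₂ (double p∈)))))
    (λ {p} {p′} _ _ e → tangent-injective {p} {p′} e)
    (λ {L} _ t → let t′ = ∧⁻ {isTangent L} {lineInPlane L π} t
                     p , e = isTangent⁻ {L} (proj₁ t′)
                     T⊂π = inPlane-resp-≈ {L} {tangentLine p} {π} e (proj₂ t′)
                 in p , onto (inPlane⁻ {tangentLine p} {π} T⊂π (∈ˡ-first {cubicPt p} {tangentDir p}))
                             (inPlane⁻ {tangentLine p} {π} T⊂π (∈ˡ-second {cubicPt p} {tangentDir p})) , e)

  module _ {π : V4} {d s : Param} (π≢0 : π ≢ zeroV) (D : DoubleSimple π d s) where
    open DoubleSimple D

    double-simple-¬Γ : ¬ T (isΓPlane π)
    double-simple-¬Γ Γ = let t , π∝Γ = isΓPlane⁻ {π} Γ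
                             only : ∀ {p} → Root π p → p ≡ t
                             only {p} root = osculating-root-unique {p} {t} (root-∝ {oscPlane t} {π} {p} (∝.sym {π} {oscPlane t} π∝Γ) root)
                         in distinct (trans (only {d} root-double) (sym (only {s} root-simple)))

    double-simple-Λ-UΓ : Λ isUΓ π ≡ 1
    double-simple-Λ-UΓ = Λ-UΓ {π} {s ∷ []} π≢0 double-simple-¬Γ ([] ∷ [])
      (λ { (here refl) → root-simple , ¬tangential-simple })
      (λ {p} root ¬tangential → case {p} ¬tangential (root-cases {p} root))
      where
      case : ∀ {p} → ¬ Tangential π p → p ≡ d ⊎ p ≡ s → p ∈ s ∷ []
      case ¬tangential (inj₁ refl) = contradiction tangential-double ¬tangential
      case _ (inj₂ p≡s) = here p≡s

    double-simple-Λ-tangent : Λ isTangent π ≡ 1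
    double-simple-Λ-tangent = Λ-tangent {π} {d ∷ []} ([] ∷ [])
      (λ { (here refl) → root-double , tangential-double })
      (λ {p} root tangential → case {p} tangential (root-cases {p} root))
      where
      case : ∀ {p} → Tangential π p → p ≡ d ⊎ p ≡ s → p ∈ d ∷ []
      case _ (inj₁ p≡d) = here p≡d
      case tangential (inj₂ refl) = contradiction tangential ¬tangential-simple

    dot-unΓ : ∀ σ z w → dot σ (unΓDir z w) ≡ c1 σ * (z * z + w) + c2 σ * z + c3 σ
    dot-unΓ σ z w = solve 6 (λ a b c d z w → a :* :0 :+ b :* (z :* z :+ w) :+ c :* z :+ d :* :1
      := b :* (z :* z :+ w) :+ c :* z :+ d) refl (c0 σ) (c1 σ) (c2 σ) (c3 σ) z w

    unΓ-inPlane⁻ : ∀ {p z w} → T (lineInPlane (lineFrom p (unΓ z w)) π) →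
      Root π p × dot (planeIn p π) (unΓDir z w) ≡ 0#
    unΓ-inPlane⁻ {p} {z} {w} L⊂π = frame-root {π} {p} (dot-e₀-frame {π} {p} {unΓ z w} (∈ˡ-first {e₀} {v}) L⊂π)
      , inPlane⁻ {unΓ z w} {planeIn p π} (lineFrom-inPlane⁻ p {unΓ z w} {π} L⊂π) (∈ˡ-second {e₀} {v})
      where v = unΓDir z w

    unΓ-inPlane⁺ : ∀ {p z w} → Root π p → dot (planeIn p π) (unΓDir z w) ≡ 0# →
      T (lineInPlane (lineFrom p (unΓ z w)) π)
    unΓ-inPlane⁺ {p} {z} {w} root e = lineFrom-inPlane⁺ p {unΓ z w} {π} (inPlane⁺ {unΓ z w} {planeIn p π}
      (trans (dot-e₀ (planeIn p π)) (trans (sym (dot-self π p)) root)) e)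

    private
      k r : Carrier
      k = chart d s
      r = chart s d

    dot-double : ∀ z w → dot (planeIn d π) (unΓDir z w) ≡ aᵈ * (z + - k)
    dot-double z w = trans (cong (λ σ → dot σ (unΓDir z w)) double-frame)
      (trans (dot-scaleˡ aᵈ (linear k) _) (cong (aᵈ *_) (trans (dot-unΓ (linear k) z w)
        (solve 3 (λ z w k → :0 :* (z :* z :+ w) :+ :1 :* z :+ :- k := z :+ :- k) refl z w k))))

    dot-simple : ∀ z w → dot (planeIn s π) (unΓDir z w) ≡ aˢ * (w + (z + - r) * (z + - r))
    dot-simple z w = trans (cong (λ σ → dot σ (unΓDir z w)) simple-frame)
      (trans (dot-scaleˡ aˢ (split r r) _) (cong (aˢ *_) (trans (dot-unΓ (split r r) z w)
        (solve 3 (λ z w r → :1 :* (z :* z :+ w) :+ :- (r :+ r) :* z :+ r :* r := w :+ (z :+ :- r) :* (z :+ :- r)) refl z w r))))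

    double-simple-Λ-UnΓ : Λ isUnΓ π ≡ 2 ℕ.* (q ℕ.∸ 1)
    double-simple-Λ-UnΓ = trans (count-lines (λ L → isUnΓ L ∧ lineInPlane L π) (Unique.cartesianProduct⁺ bools-unique (others-unique 0#)) line
      (λ { {false , u} _ → unΓ-isLine s (r + u) (- (u * u)) ; {true , w} _ → unΓ-isLine d k w })
      (λ { {false , u} {L} u∈ _ e → accept {L} {s} {r + u} { - (u * u)} (-‿nonzero (*-nonzero (∈⁻ u∈) (∈⁻ u∈))) e root-simple
             (trans (dot-simple (r + u) (- (u * u))) (trans (cong (aˢ *_)
               (solve 2 (λ r u → :- (u :* u) :+ (r :+ u :+ :- r) :* (r :+ u :+ :- r) := :0) refl r u)) (zeroʳ aˢ)))
         ; {true , w} {L} w∈ _ e → accept {L} {d} {k} {w} (∈⁻ w∈) e root-double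
             (trans (dot-double k w) (*-zeroʳ (-‿inverseʳ k))) })
      (λ { {false , u} {false , u′} _ u′∈ e → cong (false ,_) (cancel-shift (proj₁ (proj₂
             (unΓ-injective {s} {r + u} {_} {s} {r + u′} (-‿nonzero (*-nonzero (∈⁻ u′∈) (∈⁻ u′∈))) e))))
         ; {false , u} {true , w′} _ w′∈ e → contradiction (sym (proj₁ (unΓ-injective {s} {r + u} { - (u * u)} {d} {k} {w′} (∈⁻ w′∈) e))) distinct
         ; {true , w} {false , u′} _ u′∈ e → contradiction (proj₁
             (unΓ-injective {d} {k} {w} {s} {r + u′} { - (u′ * u′)} (-‿nonzero (*-nonzero (∈⁻ u′∈) (∈⁻ u′∈))) e)) distinct
         ; {true , w} {true , w′} _ w′∈ e → cong (true ,_) (proj₂ (proj₂ (unΓ-injective {d} {k} {w} {d} {k} {w′} (∈⁻ w′∈) e))) })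
      back)
      (trans (length-product (true ∷ false ∷ []) (others 0#)) (cong (2 ℕ.*_) (length-others 0#)))
      where
      bools-unique : Unique (true ∷ false ∷ [])
      bools-unique = ((λ ()) ∷ []) ∷ [] ∷ []
      -- At the double point the linear form forces z = k and leaves w free; at the simple point the
      -- square forces w = -(z - r)², so z = r + u is free. The excluded values w = 0 and u = 0 give
      -- the chord of the two points.
      line : Bool × Carrier → Line
      line (false , u) = lineFrom s (unΓ (r + u) (- (u * u)))
      line (true  , w) = lineFrom d (unΓ k w)
      ∈⁻ : ∀ {b u} → (b , u) ∈ cartesianProduct (true ∷ false ∷ []) (others 0#) → u ≢ 0#
      ∈⁻ bu∈ = ∈-others⁻ (proj₂ (∈-cartesianProduct⁻ (true ∷ false ∷ []) (others 0#) bu∈))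
      cancel-shift : ∀ {u u′} → r + u ≡ r + u′ → u ≡ u′
      cancel-shift {u} {u′} e = trans (solve 2 (λ r u → u := r :+ u :+ :- r) refl r u)
        (trans (cong (_+ - r) e) (solve 2 (λ r u → r :+ u :+ :- r := u) refl r u′))
      accept : ∀ {L p z w} → w ≢ 0# → L ≈ lineFrom p (unΓ z w) → Root π p →
        dot (planeIn p π) (unΓDir z w) ≡ 0# → T (isUnΓ L ∧ lineInPlane L π)
      accept {L} {p} {z} {w} w≢0 e root on = ∧⁺ (isUnΓ⁺ {L} {p} {z} {w} w≢0 e)
        (inPlane-resp-≈˘ {L} {lineFrom p (unΓ z w)} {π} e (unΓ-inPlane⁺ {p} {z} {w} root on))
      found : ∀ {L p z w} → w ≢ 0# → L ≈ lineFrom p (unΓ z w) → dot (planeIn p π) (unΓDir z w) ≡ 0# → p ≡ d ⊎ p ≡ s →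
        ∃ λ x → x ∈ cartesianProduct (true ∷ false ∷ []) (others 0#) × L ≈ line x
      found {L} {z = z} {w} w≢0 e on (inj₁ refl) = (true , w) , ∈-cartesianProduct⁺ {xs = true ∷ false ∷ []} {others 0#} (here refl) (∈-others⁺ w≢0)
        , subst (λ z → L ≈ lineFrom d (unΓ z w)) (difference-zero (cancel aᵈ≢0 (trans (sym (dot-double z w)) on))) e
      found {L} {z = z} {w} w≢0 e on (inj₂ refl) = (false , u) , ∈-cartesianProduct⁺ {xs = true ∷ false ∷ []} {others 0#} (there (here refl)) (∈-others⁺ u≢0)
        , subst₂ (λ z w → L ≈ lineFrom s (unΓ z w)) (solve 2 (λ z r → z := r :+ (z :+ :- r)) refl z r) w≡ e
        where
        u = z + - r
        w≡ : w ≡ - (u * u)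
        w≡ = difference-zero (trans (solve 2 (λ w u → w :+ :- (:- (u :* u)) := w :+ u :* u) refl w u)
          (cancel aˢ≢0 (trans (sym (dot-simple z w)) on)))
        u≢0 : u ≢ 0#
        u≢0 u≡0 = w≢0 (trans w≡ (trans (cong (λ u → - (u * u)) u≡0) (solve 0 (:- (:0 :* :0) := :0) refl)))
      back : ∀ {L} → T (isLine L) → T (isUnΓ L ∧ lineInPlane L π) →
        ∃ λ x → x ∈ cartesianProduct (true ∷ false ∷ []) (others 0#) × L ≈ line x
      back {L} l t =
        let t′ = ∧⁻ {isUnΓ L} {lineInPlane L π} t
            p , z , w , w≢0 , e = isUnΓ⁻ {L} l (proj₁ t′)
            root , on = unΓ-inPlane⁻ {p} {z} {w} (inPlane-resp-≈ {L} {lineFrom p (unΓ z w)} {π} e (proj₂ t′))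
        in found {L} {p} {z} {w} w≢0 e on (root-cases {p} root)

    module _ (3≢0 : 3# ≢ 0#) where
      open ExternalLines 𝔽 3≢0

      eΓ-inPlane⁻ : ∀ {p a b} → T (lineInPlane (lineFrom p (axis a b)) π) →
        c0 (planeIn p π) * a + c1 (planeIn p π) ≡ 0# × c0 (planeIn p π) * b + c2 (planeIn p π) ≡ 0#
      eΓ-inPlane⁻ {p} {a} {b} L⊂π = trans (sym (dot₁ a)) (on (∈ˡ-first {axisDir₁ a} {axisDir₂ b})) , trans (sym (dot₂ b)) (on (∈ˡ-second {axisDir₁ a} {axisDir₂ b}))
        where
        σ = planeIn p π
        on : ∀ {v} → v ∈ˡ (axis a b) → dot σ v ≡ 0#
        on = inPlane⁻ {axis a b} {σ} (lineFrom-inPlane⁻ p {axis a b} {π} L⊂π)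
        dot₁ : ∀ a → dot σ (axisDir₁ a) ≡ c0 σ * a + c1 σ
        dot₁ a = solve 5 (λ x y z w a → x :* a :+ y :* :1 :+ z :* :0 :+ w :* :0 := x :* a :+ y) refl (c0 σ) (c1 σ) (c2 σ) (c3 σ) a
        dot₂ : ∀ b → dot σ (axisDir₂ b) ≡ c0 σ * b + c2 σ
        dot₂ b = solve 5 (λ x y z w b → x :* b :+ y :* :0 :+ z :* :1 :+ w :* :0 := x :* b :+ z) refl (c0 σ) (c1 σ) (c2 σ) (c3 σ) b

      module _ {p : Param} (p≢d : p ≢ d) (p≢s : p ≢ s) where
        private
          -- From a point off the plane the form is A (κ - x)²(κ - y), so Γ_p meets it in the line
          -- with a = -B/A = 2x + y and b = -C/A = -(x² + 2xy). Then 3b + a² = (x - y)², which is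
          -- nonzero: the section is never a real axis.
          x y a₀ b₀ w₀ : Carrier
          x  = chart p d
          y  = chart p s
          a₀ = 2# * x + y
          w₀ = (x + - y) * (x + - y)
          b₀ = - (x * x + 2# * x * y)

        x≢y : x ≢ y
        x≢y x≡y = distinct (chart-injective p p≢d p≢s x≡y)

        w₀≢0 : w₀ ≢ 0#
        w₀≢0 = *-nonzero (x≢y ∘ difference-zero) (x≢y ∘ difference-zero)

        third-b₀ : third (w₀ + - (a₀ * a₀)) ≡ b₀
        third-b₀ = trans (cong third (solve 2 (λ x y → (x :+ :- y) :* (x :+ :- y) :+ :- ((:2 :* x :+ y) :* (:2 :* x :+ y))
          := :3 :* (:- (x :* x :+ :2 :* x :* y))) refl x y)) (third-3 b₀)

        private
          σ : V4
          σ = planeIn p π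
          A B C E : Carrier
          A = c0 σ
          B = c1 σ
          C = c2 σ
          E = c3 σ

        -- Tangency at `d`, read at a finite chart value: f′(x) = 0 for f = A κ³ + B κ² + C κ + E.
        cubic-slope : A * (3# * x * x) + B * (2# * x) + C ≡ 0#
        cubic-slope = let a , a≢0 , e = dot-tangent-chart {π} {p} {d} p≢d root-double in
          trans (solve 5 (λ A B C E x → A :* (:3 :* x :* x) :+ B :* (:2 :* x) :+ C
              := A :* (:3 :* x :* x) :+ B :* (:2 :* x) :+ C :* :1 :+ E :* :0) refl A B C E x)
            (cancel a≢0 (trans (sym e) tangential-double))

        -- f(y) − f(x) − (y − x) f′(x) = (y − x)² (B + A (2 x + y)) for f = A κ³ + B κ² + C κ + E.
        B-formula : A * a₀ + B ≡ 0#
        B-formula = cancel w₀≢0 (begin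
          w₀ * (A * a₀ + B)
            ≡⟨ solve 6 (λ A B C E x y → (x :+ :- y) :* (x :+ :- y) :* (A :* (:2 :* x :+ y) :+ B)
                 := (A :* (y :* y :* y) :+ B :* (y :* y) :+ C :* y :+ E :* :1)
                    :+ :- (A :* (x :* x :* x) :+ B :* (x :* x) :+ C :* x :+ E :* :1)
                    :+ (x :+ :- y) :* (A :* (:3 :* x :* x) :+ B :* (:2 :* x) :+ C)) refl A B C E x y ⟩
          dot σ (cubicPt (just y)) + - dot σ (cubicPt (just x)) + (x + - y) * (A * (3# * x * x) + B * (2# * x) + C)
            ≡⟨ cong₂ (λ u v → u + - v + (x + - y) * (A * (3# * x * x) + B * (2# * x) + C))
                 (root-chart⁻ {π} {p} {s} p≢s root-simple) (root-chart⁻ {π} {p} {d} p≢d root-double) ⟩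
          0# + - 0# + (x + - y) * (A * (3# * x * x) + B * (2# * x) + C)
            ≡⟨ cong (λ u → 0# + - 0# + (x + - y) * u) cubic-slope ⟩
          0# + - 0# + (x + - y) * 0#
            ≡⟨ solve 2 (λ x y → :0 :+ :- :0 :+ (x :+ :- y) :* :0 := :0) refl x y ⟩
          0# ∎)

        -- The left side is f′(x) minus 2x times the left side of `B-formula`.
        C-formula : A * b₀ + C ≡ 0#
        C-formula = begin
          A * b₀ + C
            ≡⟨ solve 5 (λ A B C x y → A :* (:- (x :* x :+ :2 :* x :* y)) :+ C
                 := (A :* (:3 :* x :* x) :+ B :* (:2 :* x) :+ C) :+ :- (:2 :* x :* (A :* (:2 :* x :+ y) :+ B))) refl A B C x y ⟩
          (A * (3# * x * x) + B * (2# * x) + C) + - (2# * x * (A * a₀ + B))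
            ≡⟨ cong₂ (λ u v → u + - (2# * x * v)) cubic-slope B-formula ⟩
          0# + - (2# * x * 0#)
            ≡⟨ solve 1 (λ x → :0 :+ :- (:2 :* x :* :0) := :0) refl x ⟩
          0# ∎

        A≢0 : A ≢ 0#
        A≢0 A≡0 = cases (root-cases {p} (frame-root {π} {p} A≡0))
          where
          cases : ¬ (p ≡ d ⊎ p ≡ s)
          cases (inj₁ e) = p≢d e
          cases (inj₂ e) = p≢s e

        eΓ-section : Line
        eΓ-section = lineFrom p (eΓ a₀ w₀)

        eΓ-section-inPlane : T (lineInPlane eΓ-section π)
        eΓ-section-inPlane = subst (λ b → T (lineInPlane (lineFrom p (axisDir₁ a₀ , axisDir₂ b)) π)) (sym third-b₀)
          (lineFrom-inPlane⁺ p {axis a₀ b₀} {π} (inPlane⁺ {axis a₀ b₀} {σ}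
            (trans (solve 5 (λ A B C E a → A :* a :+ B :* :1 :+ C :* :0 :+ E :* :0 := A :* a :+ B) refl A B C E a₀) B-formula)
            (trans (solve 5 (λ A B C E b → A :* b :+ B :* :0 :+ C :* :1 :+ E :* :0 := A :* b :+ C) refl A B C E b₀) C-formula)))

        eΓ-section-isEΓ : ∀ {L} → L ≈ eΓ-section → T (isEΓ L)
        eΓ-section-isEΓ {L} = isEΓ⁺ {L} {p} {a₀} {w₀} w₀≢0

        eΓ-section-unique : ∀ {a w} → T (lineInPlane (lineFrom p (eΓ a w)) π) → a ≡ a₀ × w ≡ w₀
        eΓ-section-unique {a} {w} L⊂π = a≡a₀ , (begin
          w ≡⟨ sym (eΓ-coefficient a w) ⟩
          3# * b + a * a ≡⟨ cong₂ (λ a b → 3# * b + a * a) a≡a₀ (trans b≡b₀ (sym third-b₀)) ⟩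
          3# * third (w₀ + - (a₀ * a₀)) + a₀ * a₀ ≡⟨ eΓ-coefficient a₀ w₀ ⟩
          w₀ ∎)
          where
          b = third (w + - (a * a))
          on = eΓ-inPlane⁻ {p} {a} {b} L⊂π
          same : ∀ {u v c} → A * u + c ≡ 0# → A * v + c ≡ 0# → u ≡ v
          same {u} {v} {c} e f = cancelˡ A≢0 (begin
            A * u ≡⟨ solve 2 (λ x c → x := x :+ c :+ :- c) refl (A * u) c ⟩
            A * u + c + - c ≡⟨ cong (_+ - c) (trans e (sym f)) ⟩
            A * v + c + - c ≡⟨ solve 2 (λ x c → x :+ c :+ :- c := x) refl (A * v) c ⟩
            A * v ∎)
          a≡a₀ : a ≡ a₀
          a≡a₀ = same (proj₁ on) B-formula
          b≡b₀ : b ≡ b₀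
          b≡b₀ = same (proj₂ on) C-formula

      -- Together with P(p) the line spans Γ_p, since it misses P(p); in coordinates A = 0 makes B
      -- and C vanish too.
      eΓ-not-root : ∀ {p a w} → T (lineInPlane (lineFrom p (eΓ a w)) π) → ¬ Root π p
      eΓ-not-root {p} {a} {w} L⊂π root = cases (linear-frame {π} {p} π≢0 root
          (trans (dot-tangent-self π p) (vanishes (proj₁ on))))
        where
        σ = planeIn p π
        on = eΓ-inPlane⁻ {p} {a} {third (w + - (a * a))} L⊂π
        vanishes : ∀ {u c} → c0 σ * u + c ≡ 0# → c ≡ 0#
        vanishes {u} {c} e = trans (solve 2 (λ u c → c := :0 :* u :+ c) refl u c)
          (trans (cong (λ z → z * u + c) (trans (sym root) (dot-self π p))) e)
        cases : ¬ (π ∝ oscPlane p ⊎ ∃₂ λ a r → a ≢ 0# × σ ≡ scale a (linear r))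
        cases (inj₁ π∝Γ) = double-simple-¬Γ (isΓPlane⁺ {π} {p} π∝Γ)
        cases (inj₂ (a , r , a≢0 , e)) = *-nonzero a≢0 1≢0 (trans (sym (cong c2 e)) (vanishes (proj₂ on)))

      non-roots : ∀ {κ} → κ ∈ others k → unchart d κ ≢ d × unchart d κ ≢ s
      non-roots {κ} κ∈ = (λ e → unchart-≢ d κ (sym e))
        , (λ e → ∈-others⁻ κ∈ (trans (sym (chart-unchart d κ)) (cong (chart d) e)))

      double-simple-Λ-EΓ : Λ isEΓ π ≡ q ℕ.∸ 1
      double-simple-Λ-EΓ = trans (count-lines (λ L → isEΓ L ∧ lineInPlane L π) (others-unique k) line
        (λ {κ} _ → eΓ-isLine (unchart d κ) _ _)
        (λ {κ} {L} κ∈ _ e → let n₁ , n₂ = non-roots κ∈ in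
          ∧⁺ (eΓ-section-isEΓ {unchart d κ} n₁ n₂ {L} e)
             (inPlane-resp-≈˘ {L} {line κ} {π} e (eΓ-section-inPlane {unchart d κ} n₁ n₂)))
        (λ {κ} {κ′} _ κ′∈ e → let n₁ , n₂ = non-roots κ′∈ in
          unchart-injective d (proj₁ (eΓ-injective {unchart d κ} {_} {_} {unchart d κ′} (w₀≢0 {unchart d κ′} n₁ n₂) e)))
        back) (length-others k)
        where
        line-at : Param → Line
        line-at p = lineFrom p (eΓ (2# * chart p d + chart p s) ((chart p d + - chart p s) * (chart p d + - chart p s)))
        line : Carrier → Line
        -- The frame at `d` indexes every point but P(d) itself; leaving out κ = k removes P(s), and
        -- q - 1 points remain.
        line κ = line-at (unchart d κ)
        back : ∀ {L} → T (isLine L) → T (isEΓ L ∧ lineInPlane L π) → ∃ λ κ → κ ∈ others k × L ≈ line κ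
        back {L} l t = chart d p , ∈-others⁺ (λ e → p≢s (chart-injective d (p≢d ∘ sym) distinct e))
          , subst (λ p → L ≈ line-at p) (sym (unchart-chart (p≢d ∘ sym)))
              (subst₂ (λ a w → L ≈ lineFrom p (eΓ a w)) (proj₁ found) (proj₂ found) L≈)
          where
          t′ = ∧⁻ {isEΓ L} {lineInPlane L π} t
          form = isEΓ⁻ {L} l (proj₁ t′)
          p = proj₁ form
          a = proj₁ (proj₂ form)
          w = proj₁ (proj₂ (proj₂ form))
          L≈ : L ≈ lineFrom p (eΓ a w)
          L≈ = proj₂ (proj₂ (proj₂ (proj₂ form)))
          L⊂π : T (lineInPlane (lineFrom p (eΓ a w)) π)
          L⊂π = inPlane-resp-≈ {L} {lineFrom p (eΓ a w)} {π} L≈ (proj₂ t′)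
          p≢d : p ≢ d
          p≢d refl = eΓ-not-root {p} {a} {w} L⊂π root-double
          p≢s : p ≢ s
          p≢s refl = eΓ-not-root {p} {a} {w} L⊂π root-simple
          found = eΓ-section-unique {p} p≢d p≢s {a} {w} L⊂π

  nEΓ : 3# ≢ 0# → nLines isEΓ ≡ suc q ℕ.* (q ℕ.* (q ℕ.∸ 1))
  nEΓ 3≢0 = trans (count-lines isEΓ triples-unique line
    (λ { {p , a , w} _ → eΓ-isLine p a w })
    (λ { {p , a , w} {L} t∈ _ e → isEΓ⁺ {L} {p} {a} {w} (∈-triples⁻ t∈) e })
    (λ { {p , a , w} {p′ , a′ , w′} _ t∈ e →
         let p≡ , a≡ , w≡ = eΓ-injective {p} {a} {w} {p′} {a′} {w′} (∈-triples⁻ t∈) e in cong₂ _,_ p≡ (cong₂ _,_ a≡ w≡) })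
    (λ {L} l t → let p , a , w , w≢0 , e = isEΓ⁻ {L} l t in (p , a , w) , ∈-triples⁺ p a w≢0 , e))
    length-triples
    where
    open ExternalLines 𝔽 3≢0
    line : Triple → Line
    line (p , a , w) = lineFrom p (eΓ a w)

-- Planes through a line, the number of planes with three points, and incidence sums.

module PlaneCounts (𝔽 : FiniteField) where
  open FiniteField 𝔽
  open Geometry 𝔽
  open V4
  open Booleans
  open Counting
  open LineCounts 𝔽 public
  open Solver using (solve; _:+_; _:*_; :-_; _:=_)
  open ≡-Reasoning

  planeFrom-frame : ∀ {p π a σ} → π ≡ scale a (planeFrom p σ) → planeIn p π ≡ scale a σ
  planeFrom-frame {p} {π} {a} {σ} refl = trans (cong (planeIn p) (sym (planeFrom-scale p a σ))) (planeIn-planeFrom p (scale a σ))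

  frame-planeFrom : ∀ {p π a σ} → planeIn p π ≡ scale a σ → π ≡ scale a (planeFrom p σ)
  frame-planeFrom {p} {π} {a} {σ} e = trans (sym (planeFrom-planeIn p π)) (trans (cong (planeFrom p) e) (planeFrom-scale p a σ))

  planeFrom-∝ : ∀ {p σ τ} → planeFrom p σ ∝ planeFrom p τ → ∃ λ a → a ≢ 0# × σ ≡ scale a τ
  planeFrom-∝ {p} {σ} {τ} e = let a , a≢0 , e′ = ∝⁻ {planeFrom p σ} {planeFrom p τ} e in
    a , a≢0 , trans (sym (planeIn-planeFrom p σ)) (planeFrom-frame {p} {planeFrom p σ} {a} {τ} e′)

  2≢3 : 2 ≢ 3
  2≢3 ()

  is2C⁺ : ∀ {π} → nCPlane π ≡ 2 → T (is2C π)
  is2C⁺ {π} = ℕ.≡⇒≡ᵇ (nCPlane π) 2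

  is2C⁻ : ∀ {π} → T (is2C π) → nCPlane π ≡ 2
  is2C⁻ {π} = ℕ.≡ᵇ⇒≡ (nCPlane π) 2

  is3C⁺ : ∀ {π} → nCPlane π ≡ 3 → T (is3C π)
  is3C⁺ {π} = ℕ.≡⇒≡ᵇ (nCPlane π) 3

  is3C⁻ : ∀ {π} → T (is3C π) → nCPlane π ≡ 3
  is3C⁻ {π} = ℕ.≡ᵇ⇒≡ (nCPlane π) 3

  nC≢1⇒¬Γ : ∀ {π n} → nCPlane π ≡ n → n ≢ 1 → ¬ T (isΓPlane π)
  nC≢1⇒¬Γ {π} nC n≢1 Γ = let t , π∝Γ = isΓPlane⁻ {π} Γ in n≢1 (trans (sym nC) (Γ-nCPlane {π} {t} π∝Γ))

  -- Up to scale the planes through the tangent are the forms κ - r, one for each r, and the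
  -- constant form Γ_p, which has one point only.
  planesThrough-tangent : ∀ {L p} → L ≈ tangentLine p → planesThrough is2C L ≡ q
  planesThrough-tangent {L} {p} L≈ = count-planes (λ π → is2C π ∧ lineInPlane L π) unique plane
    (λ {r} _ → nonzero⁺ {plane r} (planeFrom-nonzero p {linear r} (λ e → 1≢0 (cong c2 e))))
    (λ {r} {π} _ _ e → accept {r} {π} (∝⁻ {π} {plane r} e))
    (λ {r} {r′} _ _ e → same {r} {r′} (planeFrom-∝ {p} {linear r} {linear r′} e))
    back
    where
    plane : Carrier → V4
    plane r = planeFrom p (linear r)
    accept : ∀ {r π} → (∃ λ a → a ≢ 0# × π ≡ scale a (plane r)) → T (is2C π ∧ lineInPlane L π)
    accept {r} {π} (a , a≢0 , e) = ∧⁺ {is2C π} {lineInPlane L π} (is2C⁺ {π} (linear-nCPlane {π} {p} {a} {r} a≢0 frame))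
      (inPlane-resp-≈˘ {L} {tangentLine p} {π} L≈ (inPlane⁺ {tangentLine p} {π}
        (frame-root {π} {p} (trans (cong c0 frame) (zeroʳ a)))
        (trans (dot-tangent-self π p) (trans (cong c1 frame) (zeroʳ a)))))
      where
      frame : planeIn p π ≡ scale a (linear r)
      frame = planeFrom-frame {p} {π} {a} {linear r} e
    same : ∀ {r r′} → (∃ λ a → a ≢ 0# × linear r ≡ scale a (linear r′)) → r ≡ r′
    same {r} {r′} (a , _ , e) = difference-zero (begin
      r + - r′ ≡⟨ solve 2 (λ r r′ → r :+ :- r′ := :- (:- r) :+ :- r′) refl r r′ ⟩
      - - r + - r′ ≡⟨ cong (λ x → - x + - r′) (cong c3 e) ⟩
      - (a * - r′) + - r′ ≡⟨ solve 2 (λ a r′ → :- (a :* :- r′) :+ :- r′ := (a :* :1 :+ :- :1) :* r′) refl a r′ ⟩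
      (a * 1# + - 1#) * r′ ≡⟨ cong (λ x → (x + - 1#) * r′) (sym (cong c2 e)) ⟩
      (1# + - 1#) * r′ ≡⟨ solve 1 (λ r → (:1 :+ :- :1) :* r := :0) refl r′ ⟩
      0# ∎)
    back : ∀ {π} → T (nonzero π) → T (is2C π ∧ lineInPlane L π) → ∃ λ r → r ∈ elements × π ∝ plane r
    back {π} nz t = cases (linear-frame {π} {p} (nonzero⁻ nz)
        (inPlane⁻ {tangentLine p} {π} T⊂π (∈ˡ-first {cubicPt p} {tangentDir p}))
        (inPlane⁻ {tangentLine p} {π} T⊂π (∈ˡ-second {cubicPt p} {tangentDir p})))
      where
      t′ = ∧⁻ {is2C π} {lineInPlane L π} t
      T⊂π = inPlane-resp-≈ {L} {tangentLine p} {π} L≈ (proj₂ t′)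
      cases : (π ∝ oscPlane p ⊎ ∃₂ λ a r → a ≢ 0# × planeIn p π ≡ scale a (linear r)) → ∃ λ r → r ∈ elements × π ∝ plane r
      cases (inj₁ π∝Γ) = contradiction (isΓPlane⁺ {π} {p} π∝Γ) (nC≢1⇒¬Γ {π} (is2C⁻ {π} (proj₁ t′)) (λ ()))
      cases (inj₂ (a , r , a≢0 , e)) = r , complete r , ∝⁺ {π} {plane r} a a≢0 (frame-planeFrom {p} {π} {a} {linear r} e)

  -- Such a plane is a monic quadratic in the frame; the line fixes its middle coefficient and
  -- leaves the constant term free.
  planesThrough-UΓ : ∀ {L p y} → L ≈ lineFrom p (uΓ y) →
    planesThrough (not ∘ isΓPlane) L ≡ q
  planesThrough-UΓ {L} {p} {y} L≈ = count-planes (λ π → not (isΓPlane π) ∧ lineInPlane L π) unique plane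
    (λ {d} _ → nonzero⁺ {plane d} (planeFrom-nonzero p {quadratic d} (λ e → 1≢0 (cong c1 e))))
    (λ {d} {π} _ _ e → accept {d} {π} (∝⁻ {π} {plane d} e))
    (λ {d} {d′} _ _ e → same {d} {d′} (planeFrom-∝ {p} {quadratic d} {quadratic d′} e))
    back
    where
    quadratic : Carrier → V4
    -- With B = 1 the incidence condition B y + C = 0 reads C = -y.
    quadratic d = ⟨ 0# , 1# , - y , d ⟩
    plane : Carrier → V4
    plane d = planeFrom p (quadratic d)
    accept : ∀ {d π} → (∃ λ a → a ≢ 0# × π ≡ scale a (plane d)) → T (not (isΓPlane π) ∧ lineInPlane L π)
    accept {d} {π} (a , a≢0 , e) = ∧⁺ {not (isΓPlane π)} {lineInPlane L π} (not⁺ ¬Γ)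
      (inPlane-resp-≈˘ {L} {lineFrom p (uΓ y)} {π} L≈ (uΓ-inPlane⁺ {π} {p} {y} root
        (trans (cong (λ σ → c1 σ * y + c2 σ) frame) (solve 2 (λ a y → a :* :1 :* y :+ a :* :- y := :0) refl a y))))
      where
      frame : planeIn p π ≡ scale a (quadratic d)
      frame = planeFrom-frame {p} {π} {a} {quadratic d} e
      root : Root π p
      root = frame-root {π} {p} (trans (cong c0 frame) (zeroʳ a))
      ¬Γ : ¬ T (isΓPlane π)
      ¬Γ Γ =
        let t , π∝Γ = isΓPlane⁻ {π} Γ
            p≡t = osculating-root-unique {p} {t} (root-∝ {oscPlane t} {π} {p} (∝.sym {π} {oscPlane t} π∝Γ) root)
            b , _ , π≡ = ∝⁻ {π} {oscPlane p} (subst (λ t → π ∝ oscPlane t) (sym p≡t) π∝Γ)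
        in *-nonzero a≢0 1≢0 (begin
          a * 1# ≡⟨ sym (cong c1 frame) ⟩
          c1 (planeIn p π) ≡⟨ sym (dot-tangent-self π p) ⟩
          dot π (tangentDir p) ≡⟨ cong (λ ρ → dot ρ (tangentDir p)) π≡ ⟩
          dot (scale b (oscPlane p)) (tangentDir p) ≡⟨ dot-scaleˡ b (oscPlane p) (tangentDir p) ⟩
          b * dot (oscPlane p) (tangentDir p) ≡⟨ cong (b *_) (trans (dot-tangent-self (oscPlane p) p) (cong c1 (osculating-self p))) ⟩
          b * 0# ≡⟨ zeroʳ b ⟩
          0# ∎)
    same : ∀ {d d′} → (∃ λ a → a ≢ 0# × quadratic d ≡ scale a (quadratic d′)) → d ≡ d′
    same {d} {d′} (a , _ , e) = trans (cong c3 e) (trans (cong (_* d′) (trans (sym (*-identityʳ a)) (sym (cong c1 e)))) (*-identityˡ d′))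
    back : ∀ {π} → T (nonzero π) → T (not (isΓPlane π) ∧ lineInPlane L π) → ∃ λ d → d ∈ elements × π ∝ plane d
    back {π} nz t = d , complete d , ∝⁺ {π} {plane d} a a≢0 (frame-planeFrom {p} {π} {a} {quadratic d}
        (trans frame (cong (λ z → scale a ⟨ 0# , 1# , z , d ⟩) y′≡-y)))
      where
      t′ = ∧⁻ {not (isΓPlane π)} {lineInPlane L π} t
      M⊂π = inPlane-resp-≈ {L} {lineFrom p (uΓ y)} {π} L≈ (proj₂ t′)
      in-plane = uΓ-inPlane⁻ {π} {p} {y} M⊂π
      quadratic-at = quadratic-frame {π} {p} (proj₁ in-plane) (uΓ-¬tangential {π} {p} {y} (nonzero⁻ nz) (not⁻ (proj₁ t′)) M⊂π)
      a = proj₁ quadratic-at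
      y′ = proj₁ (proj₂ quadratic-at)
      d = proj₁ (proj₂ (proj₂ quadratic-at))
      a≢0 = proj₁ (proj₂ (proj₂ (proj₂ quadratic-at)))
      frame : planeIn p π ≡ scale a ⟨ 0# , 1# , y′ , d ⟩
      frame = proj₂ (proj₂ (proj₂ (proj₂ quadratic-at)))
      y′≡-y : y′ ≡ - y
      y′≡-y = difference-zero (cancel a≢0 (trans (solve 3 (λ a y y′ → a :* (y′ :+ :- (:- y)) := a :* :1 :* y :+ a :* y′) refl a y y′)
        (trans (cong (λ σ → c1 σ * y + c2 σ) (sym frame)) (proj₂ in-plane))))

  -- Two prescribed points leave the third chart value free, except that it must differ from r: a
  -- square has two points only.
  planesThrough-3C : ∀ {p s} → p ≢ s →
    count (λ π → is3C π ∧ onPlane π (cubicPt p) ∧ onPlane π (cubicPt s)) allPlanes ≡ q ℕ.∸ 1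
  planesThrough-3C {p} {s} p≢s = trans (count-planes f (others-unique r) plane
    (λ {r′} _ → nonzero⁺ {plane r′} (planeFrom-nonzero p {split r r′} (λ e → 1≢0 (cong c1 e))))
    (λ {r′} {π} r′∈ _ e → accept {r′} {π} (∈-others⁻ r′∈ ∘ sym) (∝⁻ {π} {plane r′} e))
    (λ {r′} {r″} _ _ e → same {r′} {r″} (planeFrom-∝ {p} {split r r′} {split r r″} e))
    back) (length-others r)
    where
    f : V4 → Bool
    f π = is3C π ∧ onPlane π (cubicPt p) ∧ onPlane π (cubicPt s)
    r = chart p s
    plane : Carrier → V4
    plane r′ = planeFrom p (split r r′)
    accept : ∀ {r′ π} → r ≢ r′ → (∃ λ a → a ≢ 0# × π ≡ scale a (plane r′)) → T (f π)
    accept {r′} {π} r≢r′ (a , a≢0 , e) = ∧⁺ {is3C π} (is3C⁺ {π} (split-nCPlane {π} {p} {a} {r} {r′} a≢0 frame r≢r′))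
      (∧⁺ {onPlane π (cubicPt p)} (==⁺ (frame-root {π} {p} (trans (cong c0 frame) (zeroʳ a))))
        (==⁺ (root-scaled⁺ {π} {p} {a} {split r r′} frame a≢0 {s} p≢s (split-root₁ r r′))))
      where
      frame : planeIn p π ≡ scale a (split r r′)
      frame = planeFrom-frame {p} {π} {a} {split r r′} e
    same : ∀ {r′ r″} → (∃ λ a → a ≢ 0# × split r r′ ≡ scale a (split r r″)) → r′ ≡ r″
    same {r′} {r″} (a , _ , e) = begin
      r′ ≡⟨ solve 2 (λ r r′ → r′ := :- (:- (r :+ r′)) :+ :- r) refl r r′ ⟩
      - - (r + r′) + - r ≡⟨ cong (λ x → - x + - r) (cong c2 e) ⟩
      - (a * - (r + r″)) + - r ≡⟨ cong (λ x → - (x * - (r + r″)) + - r) (trans (sym (*-identityʳ a)) (sym (cong c1 e))) ⟩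
      - (1# * - (r + r″)) + - r ≡⟨ solve 2 (λ r r′ → :- (:1 :* :- (r :+ r′)) :+ :- r := r′) refl r r″ ⟩
      r″ ∎
    back : ∀ {π} → T (nonzero π) → T (f π) → ∃ λ r′ → r′ ∈ others r × π ∝ plane r′
    back {π} nz t = r′ , ∈-others⁺ r′≢r , ∝⁺ {π} {plane r′} a a≢0 (frame-planeFrom {p} {π} {a} {split r r′} frame)
      where
      t₁ = ∧⁻ {is3C π} t
      t₂ = ∧⁻ {onPlane π (cubicPt p)} (proj₂ t₁)
      nC = is3C⁻ {π} (proj₁ t₁)
      root-p : Root π p
      root-p = ==⁻ (proj₁ t₂)
      ¬tangential : ¬ Tangential π p
      ¬tangential tangential = 2≢3 (trans (sym (nonΓ-tangential {π} {p} (nonzero⁻ nz) root-p tangential (nC≢1⇒¬Γ {π} nC (λ ())))) nC)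
      split-at = split-frame {π} {p} {s} root-p ¬tangential p≢s (==⁻ (proj₂ t₂))
      a = proj₁ split-at
      r′ = proj₁ (proj₂ split-at)
      a≢0 = proj₁ (proj₂ (proj₂ split-at))
      frame : planeIn p π ≡ scale a (split r r′)
      frame = proj₂ (proj₂ (proj₂ split-at))
      r′≢r : r′ ≢ r
      r′≢r r′≡r = 2≢3 (trans (sym (square-nCPlane {π} {p} {a} {r} a≢0
        (subst (λ r′ → planeIn p π ≡ scale a (split r r′)) r′≡r frame))) nC)

  other-roots : ∀ {π p} → π ≢ zeroV → nCPlane π ≡ 3 → Root π p →
    count (λ κ → onPlane π (cubicPt (unchart p κ))) elements ≡ 2
  other-roots {π} {p} π≢0 nC root = count-satisfying complete unique (λ κ → onPlane π (cubicPt (unchart p κ)))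
    {r ∷ r′ ∷ []} ((r≢r′ ∷ []) ∷ [] ∷ [])
    (λ { (here refl) → ==⁺ (root-unchart {π} {p} {a} {split r r′} {r} frame a≢0 (split-root₁ r r′))
       ; (there (here refl)) → ==⁺ (root-unchart {π} {p} {a} {split r r′} {r′} frame a≢0 (split-root₂ r r′)) })
    (λ {κ} t → onto {κ} (split-roots {π} {p} {a} {r} {r′} a≢0 frame {unchart p κ} (==⁻ t)))
    where
    ¬tangential : ¬ Tangential π p
    ¬tangential tangential = 2≢3 (trans (sym (nonΓ-tangential {π} {p} π≢0 root tangential (nC≢1⇒¬Γ {π} nC (λ ())))) nC)
    another : ∃ λ s → p ≢ s × Root π s
    another = pick (roots π) nC (roots-unique π) (∈-roots⁻ π)
      where
      pick : ∀ xs → length xs ≡ 3 → Unique xs → (∀ {s} → s ∈ xs → Root π s) → ∃ λ s → p ≢ s × Root π s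
      -- Two distinct roots are enough, as at most one of them is `p`.
      pick (x ∷ y ∷ z ∷ []) refl ((x≢y ∷ _) ∷ _) sound = choose (p ≟ᴾ x)
        where
        choose : Dec (p ≡ x) → ∃ λ s → p ≢ s × Root π s
        choose (yes p≡x) = y , (λ p≡y → x≢y (trans (sym p≡x) p≡y)) , sound {y} (there (here refl))
        choose (no  p≢x) = x , p≢x , sound {x} (here refl)
    s = proj₁ another
    r = chart p s
    split-at = split-frame {π} {p} {s} root ¬tangential (proj₁ (proj₂ another)) (proj₂ (proj₂ another))
    a = proj₁ split-at
    r′ = proj₁ (proj₂ split-at)
    a≢0 = proj₁ (proj₂ (proj₂ split-at))
    frame : planeIn p π ≡ scale a (split r r′)
    frame = proj₂ (proj₂ (proj₂ split-at))
    r≢r′ : r ≢ r′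
    r≢r′ r≡r′ = 2≢3 (trans (sym (square-nCPlane {π} {p} {a} {r′} a≢0
      (subst (λ r → planeIn p π ≡ scale a (split r r′)) r≡r′ frame))) nC)
    onto : ∀ {κ} → unchart p κ ∈ p ∷ unchart p r ∷ unchart p r′ ∷ [] → κ ∈ r ∷ r′ ∷ []
    onto {κ} (here e) = contradiction (sym e) (unchart-≢ p κ)
    onto (there (here e)) = here (unchart-injective p e)
    onto (there (there (here e))) = there (here (unchart-injective p e))

  ∈-allPlanes⁻ : ∀ {π} → π ∈ allPlanes → T (nonzero π)
  ∈-allPlanes⁻ = Transversal.sound allPlanes-transversal

  ∈-filter-allPlanes⁻ : ∀ (f : V4 → Bool) {π} → π ∈ filterᵇ f allPlanes → T (nonzero π) × T (f π)
  ∈-filter-allPlanes⁻ f π∈ = let π∈all , fπ = ∈-filterᵇ⁻ f {xs = allPlanes} π∈ in ∈-allPlanes⁻ π∈all , fπ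

  -- Both sides count the incidences of the 3_C-planes through P(p) with their other two points.
  3C-through : ∀ p → 2 ℕ.* count (λ π → is3C π ∧ onPlane π (cubicPt p)) allPlanes ≡ (q ℕ.∸ 1) ℕ.* q
  3C-through p = begin
    2 ℕ.* count f allPlanes
      ≡⟨ sym (sum-const _ 2 (filterᵇ f allPlanes) (λ {π} π∈ → let nz , fπ = ∈-filter-allPlanes⁻ f {π} π∈
                                                                  t = ∧⁻ {is3C π} fπ
           in other-roots {π} {p} (nonzero⁻ nz) (is3C⁻ {π} (proj₁ t)) (==⁻ (proj₂ t)))) ⟩
    sum (map (λ π → count (λ κ → on κ π) elements) (filterᵇ f allPlanes))
      ≡⟨ sym (double-count on elements (filterᵇ f allPlanes)) ⟩
    sum (map (λ κ → count (on κ) (filterᵇ f allPlanes)) elements)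
      ≡⟨ sum-const _ (q ℕ.∸ 1) elements (λ {κ} _ → through κ) ⟩
    (q ℕ.∸ 1) ℕ.* q ∎
    where
    f : V4 → Bool
    f π = is3C π ∧ onPlane π (cubicPt p)
    on : Carrier → V4 → Bool
    on κ π = onPlane π (cubicPt (unchart p κ))
    through : ∀ κ → count (on κ) (filterᵇ f allPlanes) ≡ q ℕ.∸ 1
    through κ = trans (sym (count-∧ f (on κ) allPlanes)) (trans
      (count-cong (λ π → f π ∧ on κ π) (λ π → is3C π ∧ onPlane π (cubicPt p) ∧ on κ π) allPlanes
        (λ π → ∧-assoc (is3C π) (onPlane π (cubicPt p)) (on κ π)))
      (planesThrough-3C {p} {unchart p κ} (unchart-≢ p κ)))

  -- Every such plane is counted at each of its three points. The factor 2 stays outside, so the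
  -- count at a single point is never halved.
  n3C : 2 ℕ.* (3 ℕ.* count is3C allPlanes) ≡ (q ℕ.∸ 1) ℕ.* q ℕ.* suc q
  n3C = begin
    2 ℕ.* (3 ℕ.* count is3C allPlanes)
      ≡⟨ cong (2 ℕ.*_) (sym (sum-const _ 3 (filterᵇ is3C allPlanes)
           (λ {π} π∈ → is3C⁻ {π} (proj₂ (∈-filter-allPlanes⁻ is3C {π} π∈))))) ⟩
    2 ℕ.* sum (map nCPlane (filterᵇ is3C allPlanes))
      ≡⟨ cong (2 ℕ.*_) (sym (double-count (λ p π → onPlane π (cubicPt p)) params (filterᵇ is3C allPlanes))) ⟩
    2 ℕ.* sum (map (λ p → count (λ π → onPlane π (cubicPt p)) (filterᵇ is3C allPlanes)) params)
      ≡⟨ cong (2 ℕ.*_) (sum-cong _ through params (λ {p} _ → sym (count-∧ is3C (λ π → onPlane π (cubicPt p)) allPlanes))) ⟩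
    2 ℕ.* sum (map through params)
      ≡⟨ sym (sum-* 2 through params) ⟩
    sum (map (λ p → 2 ℕ.* through p) params)
      ≡⟨ sum-const _ ((q ℕ.∸ 1) ℕ.* q) params (λ {p} _ → 3C-through p) ⟩
    (q ℕ.∸ 1) ℕ.* q ℕ.* length params
      ≡⟨ cong ((q ℕ.∸ 1) ℕ.* q ℕ.*_) length-params ⟩
    (q ℕ.∸ 1) ℕ.* q ℕ.* suc q ∎
    where
    through : Param → ℕ
    through p = count (λ π → is3C π ∧ onPlane π (cubicPt p)) allPlanes

  -- Counting incident pairs by planes instead of by lines; this turns each constant Λ into a value
  -- of Π.
  ΠSum-const : ∀ (πt : V4 → Bool) (λt : Line → Bool) k →
    (∀ π → T (nonzero π) → T (πt π) → Λ λt π ≡ k) → ΠSum πt λt ≡ k ℕ.* count πt allPlanes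
  ΠSum-const πt λt k constant = begin
    sum (map (planesThrough πt) (filterᵇ λt allLines))
      ≡⟨ sum-cong _ _ (filterᵇ λt allLines) (λ {L} _ → count-∧ πt (lineInPlane L) allPlanes) ⟩
    sum (map (λ L → count (lineInPlane L) (filterᵇ πt allPlanes)) (filterᵇ λt allLines))
      ≡⟨ double-count lineInPlane (filterᵇ λt allLines) (filterᵇ πt allPlanes) ⟩
    sum (map (λ π → count (λ L → lineInPlane L π) (filterᵇ λt allLines)) (filterᵇ πt allPlanes))
      ≡⟨ sum-const _ k (filterᵇ πt allPlanes) (λ {π} π∈ → trans (sym (count-∧ λt (λ L → lineInPlane L π) allLines))
           (let nz , t = ∈-filter-allPlanes⁻ πt {π} π∈ in constant π nz t)) ⟩
    k ℕ.* count πt allPlanes ∎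

  -- Any plane through the line contains P(p), so type 0 cannot occur, and a non-Γ-plane has one,
  -- two or three points.
  planesThrough-split : ∀ {L p y} → L ≈ lineFrom p (uΓ y) →
    planesThrough (not ∘ isΓPlane) L ≡ planesThrough is2C L ℕ.+ planesThrough is3C L ℕ.+ planesThrough is1barC L
  planesThrough-split {L} {p} {y} L≈ = count-split _ _ _ _ allPlanes λ {π} π∈ →
    split-indicator (isΓPlane π) (lineInPlane L π) (nCPlane π)
      (λ Γ → let t , π∝Γ = isΓPlane⁻ {π} Γ in Γ-nCPlane {π} {t} π∝Γ)
      (λ ¬Γ L⊂π → nonΓ-nCPlane {π} {p} (nonzero⁻ (∈-allPlanes⁻ π∈))
        (proj₁ (uΓ-inPlane⁻ {π} {p} {y} (inPlane-resp-≈ {L} {lineFrom p (uΓ y)} {π} L≈ L⊂π))) ¬Γ)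
    where
    -- Stated for bare Booleans and a number, so that all four tests reduce by cases.
    split-indicator : ∀ γ i n → (T γ → n ≡ 1) → (¬ T γ → T i → n ≡ 1 ⊎ n ≡ 2 ⊎ n ≡ 3) →
      indicator (not γ ∧ i) ≡
      indicator ((n ℕ.≡ᵇ 2) ∧ i) ℕ.+ indicator ((n ℕ.≡ᵇ 3) ∧ i) ℕ.+ indicator ((not γ ∧ (n ℕ.≡ᵇ 1)) ∧ i)
    split-indicator γ false n _ _ rewrite ∧-zeroʳ (not γ) | ∧-zeroʳ (n ℕ.≡ᵇ 2) | ∧-zeroʳ (n ℕ.≡ᵇ 3) | ∧-zeroʳ (not γ ∧ (n ℕ.≡ᵇ 1)) = refl
    -- A Γ-plane has one point: the tests for two and three fail, and `not γ` disposes of the other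
    -- two.
    split-indicator true true n γ⇒1 _ rewrite γ⇒1 tt = refl
    split-indicator false true n _ cases with cases id tt
    ... | inj₁ refl        = refl
    ... | inj₂ (inj₁ refl) = refl
    ... | inj₂ (inj₂ refl) = refl

-- The values of Λ and Π.

open import Data.Nat using (_*_; _∸_)

module Main (𝔽 : FiniteField) where
  open FiniteField 𝔽 using (0#)
  open Geometry 𝔽
  open Booleans
  open Counting
  open PlaneCounts 𝔽
  open Characteristic 𝔽
  open ≡-Reasoning

  IsTangentSection IsUnisecantSection : V4 → Param → Set
  IsTangentSection   π t = meetsIn π (oscPlane t) (λ L → sameLine L (tangentLine t))
  IsUnisecantSection π t = meetsIn π (oscPlane t) (λ L → isUnisecant L ∧ not (isTangent L))

  -- The tangent comes from the double point; at the simple point B ≠ 0, and the section with Γ_s is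
  -- the UΓ-line of parameter `slope`.
  sections : ∀ {π d s} → DoubleSimple π d s → IsTangentSection π d × IsUnisecantSection π s
  sections {π} {d} {s} D =
    ( tangentLine d
    , ∧⁺ (tangent-isLine d) (∧⁺ (inPlane⁺ {tangentLine d} {π} root-double tangential-double)
        (∧⁺ (tangent-inΓ d) (≈-refl {tangentLine d}))))
    , ( L
      , ∧⁺ (uΓ-isLine s y) (∧⁺ (uΓ-inPlane⁺ {π} {s} {y} root-simple (slope-solves {π} {s} ¬tangential-simple))
          (∧⁺ (uΓ-inΓ s y) (let unisecant , ¬tangent = uΓ-unisecant-¬tangent {L} {s} {y} (≈-refl {L}) in ∧⁺ unisecant ¬tangent))))
    where
    open DoubleSimple D
    y = slope π s
    L = lineFrom s (uΓ y)

  chord-sections : ∀ {π d s} → DoubleSimple π d s → ∀ {t₁ t₂} → t₁ ≢ t₂ → Root π t₁ → Root π t₂ →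
    (IsTangentSection π t₁ × IsUnisecantSection π t₂) ⊎ (IsTangentSection π t₂ × IsUnisecantSection π t₁)
  chord-sections {π} {d} {s} D {t₁} {t₂} t₁≢t₂ root₁ root₂ =
    cases (DoubleSimple.root-cases D {t₁} root₁) (DoubleSimple.root-cases D {t₂} root₂)
    where
    cases : t₁ ≡ d ⊎ t₁ ≡ s → t₂ ≡ d ⊎ t₂ ≡ s →
      (IsTangentSection π t₁ × IsUnisecantSection π t₂) ⊎ (IsTangentSection π t₂ × IsUnisecantSection π t₁)
    cases (inj₁ e) (inj₁ e′) = contradiction (trans e (sym e′)) t₁≢t₂
    cases (inj₂ e) (inj₂ e′) = contradiction (trans e (sym e′)) t₁≢t₂
    cases (inj₁ e) (inj₂ e′) = inj₁ (subst₂ (λ d s → IsTangentSection π d × IsUnisecantSection π s) (sym e) (sym e′) (sections {π} {d} {s} D))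
    cases (inj₂ e) (inj₁ e′) = inj₂ (subst₂ (λ d s → IsTangentSection π d × IsUnisecantSection π s) (sym e′) (sym e) (sections {π} {d} {s} D))

  double-simple-2C : ∀ {π} → T (nonzero π) → T (is2C π) → ∃₂ (DoubleSimple π)
  double-simple-2C {π} nz t = double-simple {π} (nonzero⁻ nz) (is2C⁻ {π} t)

  Λ-tangent-2C : ∀ π → T (nonzero π) → T (is2C π) → Λ isTangent π ≡ 1
  Λ-tangent-2C π nz t = let d , s , D = double-simple-2C {π} nz t in double-simple-Λ-tangent {π} {d} {s} (nonzero⁻ nz) D

  Λ-UΓ-2C : ∀ π → T (nonzero π) → T (is2C π) → Λ isUΓ π ≡ 1
  Λ-UΓ-2C π nz t = let d , s , D = double-simple-2C {π} nz t in double-simple-Λ-UΓ {π} {d} {s} (nonzero⁻ nz) D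

  Λ-UnΓ-2C : ∀ π → T (nonzero π) → T (is2C π) → Λ isUnΓ π ≡ 2 * (q ∸ 1)
  Λ-UnΓ-2C π nz t = let d , s , D = double-simple-2C {π} nz t in double-simple-Λ-UnΓ {π} {d} {s} (nonzero⁻ nz) D

  Λ-EΓ-2C : 3# ≢ 0# → ∀ π → T (nonzero π) → T (is2C π) → Λ isEΓ π ≡ q ∸ 1
  Λ-EΓ-2C 3≢0 π nz t = let d , s , D = double-simple-2C {π} nz t in double-simple-Λ-EΓ {π} {d} {s} (nonzero⁻ nz) D 3≢0

  ¬2C-¬tangential : ∀ {π p} → T (nonzero π) → ¬ T (isΓPlane π) → nCPlane π ≢ 2 → Root π p → ¬ Tangential π p
  ¬2C-¬tangential {π} {p} nz ¬Γ nC≢2 root tangential = nC≢2 (nonΓ-tangential {π} {p} (nonzero⁻ nz) root tangential ¬Γ)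

  -- Tangency would give the plane exactly two points, so here every point is simple and contributes
  -- one line.
  Λ-UΓ-roots : ∀ {π} → T (nonzero π) → ¬ T (isΓPlane π) → nCPlane π ≢ 2 → Λ isUΓ π ≡ nCPlane π
  Λ-UΓ-roots {π} nz ¬Γ nC≢2 = Λ-UΓ {π} {roots π} (nonzero⁻ nz) ¬Γ (roots-unique π)
    (λ {p} p∈ → ∈-roots⁻ π {p} p∈ , ¬2C-¬tangential {π} {p} nz ¬Γ nC≢2 (∈-roots⁻ π {p} p∈))
    (λ {p} root _ → ∈-roots⁺ π {p} root)

  Λ-tangent-zero : ∀ {π} → T (nonzero π) → ¬ T (isΓPlane π) → nCPlane π ≢ 2 → Λ isTangent π ≡ 0
  Λ-tangent-zero {π} nz ¬Γ nC≢2 = Λ-tangent {π} {[]} [] (λ ())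
    (λ {p} root tangential → contradiction tangential (¬2C-¬tangential {π} {p} nz ¬Γ nC≢2 root))

  is1barC⁻ : ∀ {π} → T (is1barC π) → ¬ T (isΓPlane π) × nCPlane π ≡ 1
  is1barC⁻ {π} t = let ¬Γ , nC = ∧⁻ {not (isΓPlane π)} t in not⁻ ¬Γ , ℕ.≡ᵇ⇒≡ (nCPlane π) 1 nC

  is0C⁻ : ∀ {π} → T (is0C π) → nCPlane π ≡ 0
  is0C⁻ {π} = ℕ.≡ᵇ⇒≡ (nCPlane π) 0

  nC≢2 : ∀ {π n} → nCPlane π ≡ n → n ≢ 2 → nCPlane π ≢ 2
  nC≢2 nC n≢2 e = n≢2 (trans (sym nC) e)

  Λ-UΓ-1barC : ∀ π → T (nonzero π) → T (is1barC π) → Λ isUΓ π ≡ 1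
  Λ-UΓ-1barC π nz t = let ¬Γ , nC = is1barC⁻ {π} t in trans (Λ-UΓ-roots {π} nz ¬Γ (nC≢2 {π} nC (λ ()))) nC

  Λ-UΓ-3C : ∀ π → T (nonzero π) → T (is3C π) → Λ isUΓ π ≡ 3
  Λ-UΓ-3C π nz t = trans (Λ-UΓ-roots {π} nz (nC≢1⇒¬Γ {π} nC (λ ())) (nC≢2 {π} nC (λ ()))) nC
    where nC = is3C⁻ {π} t

  Λ-tangent-3C : ∀ π → T (nonzero π) → T (is3C π) → Λ isTangent π ≡ 0
  Λ-tangent-3C π nz t = Λ-tangent-zero {π} nz (nC≢1⇒¬Γ {π} nC (λ ())) (nC≢2 {π} nC (λ ()))
    where nC = is3C⁻ {π} t

  Λ-tangent-1barC : ∀ π → T (nonzero π) → T (is1barC π) → Λ isTangent π ≡ 0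
  Λ-tangent-1barC π nz t = let ¬Γ , nC = is1barC⁻ {π} t in Λ-tangent-zero {π} nz ¬Γ (nC≢2 {π} nC (λ ()))

  Λ-tangent-0C : ∀ π → T (nonzero π) → T (is0C π) → Λ isTangent π ≡ 0
  Λ-tangent-0C π nz t = Λ-tangent-zero {π} nz (nC≢1⇒¬Γ {π} nC (λ ())) (nC≢2 {π} nC (λ ()))
    where nC = is0C⁻ {π} t

  planesThrough-tangent-2C : ∀ L → T (isTangent L) → planesThrough is2C L ≡ q
  planesThrough-tangent-2C L t = let p , e = isTangent⁻ {L} t in planesThrough-tangent {L} {p} e

  ΠSum-2C-tangent : ΠSum is2C isTangent ≡ q * nLines isTangent
  ΠSum-2C-tangent = sum-const (planesThrough is2C) q (filterᵇ isTangent allLines)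
    (λ {L} L∈ → planesThrough-tangent-2C L (proj₂ (∈-filterᵇ⁻ isTangent {L} {allLines} L∈)))

  -- Each of these planes holds one tangent, so the incidences with tangents, q for each of q + 1,
  -- number the planes themselves.
  n2C : count is2C allPlanes ≡ q * suc q
  n2C = begin
    count is2C allPlanes ≡⟨ sym (ℕ.*-identityˡ _) ⟩
    1 * count is2C allPlanes ≡⟨ sym (ΠSum-const is2C isTangent 1 Λ-tangent-2C) ⟩
    ΠSum is2C isTangent ≡⟨ ΠSum-2C-tangent ⟩
    q * nLines isTangent ≡⟨ cong (q *_) nTangent ⟩
    q * suc q ∎

  -- There are as many 2_C-planes as UΓ-lines, q(q + 1), and each plane holds one such line.
  ΠSum-2C-UΓ : ΠSum is2C isUΓ ≡ 1 * nLines isUΓ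
  ΠSum-2C-UΓ = begin
    ΠSum is2C isUΓ ≡⟨ ΠSum-const is2C isUΓ 1 Λ-UΓ-2C ⟩
    1 * count is2C allPlanes ≡⟨ cong (1 *_) (trans n2C (trans (ℕ.*-comm q (suc q)) (sym nUΓ))) ⟩
    1 * nLines isUΓ ∎

  ΠSum-3C-UΓ : 2 * ΠSum is3C isUΓ ≡ (q ∸ 1) * nLines isUΓ
  ΠSum-3C-UΓ = begin
    2 * ΠSum is3C isUΓ ≡⟨ cong (2 *_) (ΠSum-const is3C isUΓ 3 Λ-UΓ-3C) ⟩
    2 * (3 * count is3C allPlanes) ≡⟨ n3C ⟩
    (q ∸ 1) * q * suc q ≡⟨ ℕ.*-assoc (q ∸ 1) q (suc q) ⟩
    (q ∸ 1) * (q * suc q) ≡⟨ cong ((q ∸ 1) *_) (trans (ℕ.*-comm q (suc q)) (sym nUΓ)) ⟩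
    (q ∸ 1) * nLines isUΓ ∎

  ΠSum-nonΓ-UΓ : q * nLines isUΓ ≡ ΠSum is2C isUΓ ℕ.+ ΠSum is3C isUΓ ℕ.+ ΠSum is1barC isUΓ
  ΠSum-nonΓ-UΓ = begin
    q * nLines isUΓ
      ≡⟨ sym (sum-const through q UΓlines (λ {L} L∈ → let p , y , e = form {L} L∈ in planesThrough-UΓ {L} {p} {y} e)) ⟩
    sum (map through UΓlines)
      ≡⟨ sum-cong through _ UΓlines (λ {L} L∈ → let p , y , e = form {L} L∈ in planesThrough-split {L} {p} {y} e) ⟩
    sum (map (λ L → planesThrough is2C L ℕ.+ planesThrough is3C L ℕ.+ planesThrough is1barC L) UΓlines)
      ≡⟨ sum-+ (λ L → planesThrough is2C L ℕ.+ planesThrough is3C L) (planesThrough is1barC) UΓlines ⟩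
    sum (map (λ L → planesThrough is2C L ℕ.+ planesThrough is3C L) UΓlines) ℕ.+ ΠSum is1barC isUΓ
      ≡⟨ cong (ℕ._+ ΠSum is1barC isUΓ) (sum-+ (planesThrough is2C) (planesThrough is3C) UΓlines) ⟩
    ΠSum is2C isUΓ ℕ.+ ΠSum is3C isUΓ ℕ.+ ΠSum is1barC isUΓ ∎
    where
    through : Line → ℕ
    through = planesThrough (not ∘ isΓPlane)
    UΓlines : List Line
    UΓlines = filterᵇ isUΓ allLines
    form : ∀ {L} → L ∈ UΓlines → ∃₂ λ p y → L ≈ lineFrom p (uΓ y)
    form {L} L∈ = let L∈all , t = ∈-filterᵇ⁻ isUΓ {L} {allLines} L∈ in
      isUΓ⁻ {L} (Transversal.sound allLines-transversal L∈all) t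

  -- Cancelling n leaves (m - 1) n = s₃ + s₁, and s₃ is half of it, so s₁ is the other half. With 1
  -- ≤ m the truncated difference is a true predecessor.
  halve : ∀ {m n s₃ s₁} → 1 ≤ m → m * n ≡ 1 * n ℕ.+ s₃ ℕ.+ s₁ → 2 * s₃ ≡ (m ∸ 1) * n → 2 * s₁ ≡ (m ∸ 1) * n
  halve {suc m} {n} {s₃} {s₁} _ total half = ℕ.+-cancelˡ-≡ (2 * s₃) _ _ (begin
    2 * s₃ ℕ.+ 2 * s₁ ≡⟨ sym (ℕ.*-distribˡ-+ 2 s₃ s₁) ⟩
    2 * (s₃ ℕ.+ s₁) ≡⟨ cong (2 *_) (sym rest) ⟩
    2 * (m * n) ≡⟨ solve 1 (λ x → con 2 :* x := x :+ x) refl (m * n) ⟩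
    m * n ℕ.+ m * n ≡⟨ cong (ℕ._+ m * n) (sym half) ⟩
    2 * s₃ ℕ.+ m * n ∎)
    where
    open +-*-Solver
    rest : m * n ≡ s₃ ℕ.+ s₁
    rest = ℕ.+-cancelˡ-≡ n _ _ (trans total (solve 3 (λ n a b → con 1 :* n :+ a :+ b := n :+ (a :+ b)) refl n s₃ s₁))

  ΠSum-1barC-UΓ : 1 ≤ q → 2 * ΠSum is1barC isUΓ ≡ (q ∸ 1) * nLines isUΓ
  ΠSum-1barC-UΓ 1≤q = halve 1≤q (subst (λ S → q * nLines isUΓ ≡ S ℕ.+ ΠSum is3C isUΓ ℕ.+ ΠSum is1barC isUΓ) ΠSum-2C-UΓ ΠSum-nonΓ-UΓ) ΠSum-3C-UΓ

  ΠSum-2C-UnΓ : ΠSum is2C isUnΓ ≡ 2 * nLines isUnΓ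
  ΠSum-2C-UnΓ = begin
    ΠSum is2C isUnΓ ≡⟨ ΠSum-const is2C isUnΓ (2 * (q ∸ 1)) Λ-UnΓ-2C ⟩
    2 * (q ∸ 1) * count is2C allPlanes ≡⟨ cong (2 * (q ∸ 1) *_) n2C ⟩
    2 * (q ∸ 1) * (q * suc q) ≡⟨ solve 3 (λ a b c → con 2 :* a :* (b :* c) := con 2 :* (c :* (b :* a))) refl (q ∸ 1) q (suc q) ⟩
    2 * (suc q * (q * (q ∸ 1))) ≡⟨ cong (2 *_) (sym nUnΓ) ⟩
    2 * nLines isUnΓ ∎
    where open +-*-Solver

  -- The incidences, q - 1 in each of q(q + 1) planes, are exactly as many as the EΓ-lines.
  ΠSum-2C-EΓ : 3# ≢ 0# → ΠSum is2C isEΓ ≡ 1 * nLines isEΓ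
  ΠSum-2C-EΓ 3≢0 = begin
    ΠSum is2C isEΓ ≡⟨ ΠSum-const is2C isEΓ (q ∸ 1) (Λ-EΓ-2C 3≢0) ⟩
    (q ∸ 1) * count is2C allPlanes ≡⟨ cong ((q ∸ 1) *_) n2C ⟩
    (q ∸ 1) * (q * suc q) ≡⟨ solve 3 (λ a b c → a :* (b :* c) := con 1 :* (c :* (b :* a))) refl (q ∸ 1) q (suc q) ⟩
    1 * (suc q * (q * (q ∸ 1))) ≡⟨ cong (1 *_) (sym (nEΓ 3≢0)) ⟩
    1 * nLines isEΓ ∎
    where open +-*-Solver

-- An average Π appears with its denominator cleared, as `ΠSum` equal to Π times `nLines`, and
-- doubled where its value is (q - 1)/2. Each Λ is asserted for every nonzero coefficient vector of
-- the plane type.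
theorem5p5 : (𝔽 : FiniteField) →
    let open Geometry 𝔽 in
    5 ≤ q →
    ((R : Line) → T (isLine R) → (t₁ t₂ : Param) → t₁ ≢ t₂ →
    T (onLine R (cubicPt t₁)) → T (onLine R (cubicPt t₂)) →
    (π : V4) → T (nonzero π) → T (is2C π) → T (lineInPlane R π) →
    (meetsIn π (oscPlane t₁) (λ L → sameLine L (tangentLine t₁))
    × meetsIn π (oscPlane t₂) (λ L → isUnisecant L ∧ not (isTangent L)))
    ⊎ (meetsIn π (oscPlane t₂) (λ L → sameLine L (tangentLine t₂))
    × meetsIn π (oscPlane t₁) (λ L → isUnisecant L ∧ not (isTangent L))))
    × ((π : V4) → T (nonzero π) → T (is2C π) → Λ isTangent π ≡ 1 × Λ isUΓ π ≡ 1)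
    × ΠSum is2C isUΓ ≡ 1 * nLines isUΓ
    × ((π : V4) → T (nonzero π) → T (is1barC π) → Λ isUΓ π ≡ 1)
    × 2 * ΠSum is1barC isUΓ ≡ (q ∸ 1) * nLines isUΓ
    × 2 * ΠSum is3C isUΓ ≡ (q ∸ 1) * nLines isUΓ
    × ((π : V4) → T (nonzero π) → T (is3C π) → Λ isUΓ π ≡ 3)
    × ((π : V4) → T (nonzero π) → T (is2C π) → Λ isUnΓ π ≡ 2 * (q ∸ 1))
    × ΠSum is2C isUnΓ ≡ 2 * nLines isUnΓ
    × (¬ (3 ∣ q) →
    ΠSum is2C isEΓ ≡ 1 * nLines isEΓ
    × ((π : V4) → T (nonzero π) → T (is2C π) → Λ isEΓ π ≡ q ∸ 1))
    × ((L : Line) → T (isLine L) → T (isTangent L) → planesThrough is2C L ≡ q)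
    × ΠSum is2C isTangent ≡ q * nLines isTangent
    × ((π : V4) → T (nonzero π) → T (is3C π) → Λ isTangent π ≡ 0)
    × ((π : V4) → T (nonzero π) → T (is1barC π) → Λ isTangent π ≡ 0)
    × ((π : V4) → T (nonzero π) → T (is0C π) → Λ isTangent π ≡ 0)
    × ΠSum is3C isTangent ≡ 0 * nLines isTangent
    × ΠSum is1barC isTangent ≡ 0 * nLines isTangent
    × ΠSum is0C isTangent ≡ 0 * nLines isTangent
theorem5p5 𝔽 5≤q =
    (λ R _ t₁ t₂ t₁≢t₂ on₁ on₂ π nz t R⊂π → let d , s , D = double-simple-2C {π} nz t in
      chord-sections {π} {d} {s} D {t₁} {t₂} t₁≢t₂
        (inPlane⁻ {R} {π} R⊂π (onLine⁻ R on₁)) (inPlane⁻ {R} {π} R⊂π (onLine⁻ R on₂)))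
  , (λ π nz t → Λ-tangent-2C π nz t , Λ-UΓ-2C π nz t)
  , ΠSum-2C-UΓ
  , Λ-UΓ-1barC
  , ΠSum-1barC-UΓ (ℕ.≤-trans (ℕ.s≤s ℕ.z≤n) 5≤q)
  , ΠSum-3C-UΓ
  , Λ-UΓ-3C
  , Λ-UnΓ-2C
  , ΠSum-2C-UnΓ
  -- The condition on q is used as 3 ≠ 0 in the field, which makes the parametrisation of the
  -- EΓ-lines possible.
  , (λ 3∤q → let 3≢0 = λ 3≡0 → 3∤q (3∣q 3≡0) in ΠSum-2C-EΓ 3≢0 , Λ-EΓ-2C 3≢0)
  , (λ L _ → planesThrough-tangent-2C L)
  , ΠSum-2C-tangent
  , Λ-tangent-3C
  , Λ-tangent-1barC
  , Λ-tangent-0C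
  , ΠSum-const is3C isTangent 0 Λ-tangent-3C
  , ΠSum-const is1barC isTangent 0 Λ-tangent-1barC
  , ΠSum-const is0C isTangent 0 Λ-tangent-0C
  where
  open Geometry 𝔽
  open Characteristic 𝔽
  open PlaneCounts 𝔽
  open Main 𝔽
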